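{- Let $b\ge 2$ be an integer. For $0\le\alpha\le\infty$ let $$S(\alpha)=\Big\{(x,y)\in(0,1]\times(0,1]:\ \lim_{n\to\infty}\frac{S_n(x,y)}{\log_b n}=\alpha\Big\},$$ where $S_n(x,y)$ is the length of the longest common substring with shifts of $x$ and $y$ in the first $n$ digits of their $b$-ary expansions. Then $$\dim_{\mathcal H}S(\alpha)=2\qquad\text{for every }\alpha\in[0,\infty].$$
   Context: Fix an integer $b\ge2$ and let $\mathcal A=\{0,1,\dots,b-1\}$. Every $x\in(0,1]$ has a unique non-terminating $b$-ary expansion $x=\sum_{i=1}^\infty x_i b^{ -i}$ with $x_i\in\mathcal A$ (non-terminating: infinitely many $x_i$ are nonzero); $(x_1,x_2,\dots)$ is the digit sequence of $x$. Write $x_{i+1}^{i+l}=(x_{i+1},\dots,x_{i+l})$. For $(x,y)\in(0,1]^2$ and an integer $n\ge1$, $$S_n(x,y)=\max\{l\ge1:\ x_{i+1}^{i+l}=y_{j+1}^{j+l}\ \text{for some}\ 0\le i,j\le n-l\},$$ with $S_n(x,y)=0$ if no such $l$ exists. $\dim_{\mathcal H}$ denotes Hausdorff dimension, taken in $\mathbb R^2$ with the Euclidean metric. The limit being $\infty$ means divergence to $+\infty$. -}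

module Defs where

open import Algebra.Bundles using (CommutativeRing)
import Algebra.Properties.Monoid.Sum as Sum
import Algebra.Properties.Semiring.Exp as Exp
import Algebra.Properties.Semiring.Mult as Mult
open import Axiom.ExcludedMiddle using (ExcludedMiddle)
open import Data.Bool.Base using (if_then_else_)
open import Data.Fin.Base using (Fin; toℕ)
open import Data.Nat.Base as ℕ using (ℕ; zero; suc)
open import Data.Product.Base using (Σ; ∃; ∃₂; _×_; _,_; proj₁; proj₂)
open import Data.Sum.Base using (_⊎_)
open import Function.Base using (_∘_)
open import Level using (0ℓ; Setω)
open import Relation.Binary.Construct.Add.Supremum.Equality as AddSupEquality using ()
open import Relation.Binary.Construct.Add.Supremum.NonStrict as AddSupOrder using ()
open import Relation.Binary.Construct.NonStrictToStrict as ToStrict using ()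
open import Relation.Binary.Core using (Rel)
open import Relation.Binary.PropositionalEquality.Core using (_≡_; _≢_)
open import Relation.Binary.Structures using (IsTotalOrder)
open import Relation.Nullary using (¬_; yes; no; does)
open import Relation.Nullary.Construct.Add.Supremum using (_⁺; [_]; ⊤⁺)
open import Relation.Unary using (Pred; _∈_; _⊆_; ⋃)

-- The real numbers, characterised (uniquely up to isomorphism) as a
-- Dedekind-complete ordered field.
record CompleteOrderedField : Setω where
  field
    commutativeRing : CommutativeRing 0ℓ 0ℓ

  open CommutativeRing commutativeRing public
    renaming (Carrier to ℝ)

  infix 4 _≤_
  infix 8 _⁻¹

  field
    _≤_          : Rel ℝ 0ℓ
    isTotalOrder : IsTotalOrder _≈_ _≤_
    +-monoˡ-≤    : ∀ z {x y} → x ≤ y → x + z ≤ y + z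
    *-nonneg     : ∀ {x y} → 0# ≤ x → 0# ≤ y → 0# ≤ x * y
    1≉0          : ¬ (1# ≈ 0#)
    -- The value of 0# ⁻¹ is irrelevant.
    _⁻¹          : ℝ → ℝ
    ⁻¹-inverseʳ  : ∀ x → ¬ (x ≈ 0#) → x * x ⁻¹ ≈ 1#

  UpperBound : ∀ {ℓ} → Pred ℝ ℓ → Pred ℝ ℓ
  UpperBound P u = ∀ x → x ∈ P → x ≤ u

  field
    complete : ∀ {ℓ} (P : Pred ℝ ℓ) → ∃ P → ∃ (UpperBound P) →
               ∃ λ s → UpperBound P s × (∀ u → UpperBound P u → s ≤ u)

module Analysis (lem : ∀ {ℓ} → ExcludedMiddle ℓ) (R : CompleteOrderedField) where

  open CompleteOrderedField R public
  open ToStrict _≈_ _≤_ public using (_<_)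
  open Mult semiring public using () renaming (_×_ to _·_)
  open Exp semiring public using (_^_)
  open Sum +-monoid public using (sum)
  open AddSupEquality _≈_ public using (_≈⁺_)
  open AddSupOrder _≤_ public using (_≤⁺_)

  fromℕ : ℕ → ℝ
  fromℕ n = n · 1#

  -- Least upper bound and greatest lower bound, with junk value 0 when
  -- the set is empty or unbounded.
  sup : ∀ {ℓ} → Pred ℝ ℓ → ℝ
  sup P with lem {P = ∃ P × ∃ (UpperBound P)}
  ... | yes (inhabited , bounded) = proj₁ (complete P inhabited bounded)
  ... | no _                      = 0#

  inf : ∀ {ℓ} → Pred ℝ ℓ → ℝ
  inf P = - sup (λ x → P (- x))

  -- ℝ ⁺ adds a point +∞ to ℝ; only its part [0,∞] is used, so the empty
  -- supremum is 0 and the empty infimum is +∞.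
  ⨆ : ∀ {i} {I : Set i} → (I → ℝ ⁺) → ℝ ⁺
  ⨆ f = if does (lem {P = ∃ λ u → ∀ i → f i ≤⁺ [ u ]})
        then [ sup (λ x → ∃ λ i → f i ≈⁺ [ x ]) ]
        else ⊤⁺

  ⨅ : ∀ {i} {I : Set i} → (I → ℝ ⁺) → ℝ ⁺
  ⨅ f = if does (lem {P = ∃₂ λ i x → f i ≈⁺ [ x ]})
        then [ inf (λ x → ∃ λ i → f i ≈⁺ [ x ]) ]
        else ⊤⁺

  √ : ℝ → ℝ
  √ t = sup λ r → 0# ≤ r × r * r ≤ t

  -- Real power for x , s ≥ 0 as the supremum of the rational powers
  -- x^(p/q) that approximate x^s from below: those with p/q ≤ s if x ≥ 1,
  -- and those with p/q ≥ s if x ≤ 1.  In particular 0 ^ʳ 0 is 1.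
  infixr 8 _^ʳ_
  _^ʳ_ : ℝ → ℝ → ℝ
  x ^ʳ s = sup λ r → 0# ≤ r × ∃₂ λ p q →
    ((1# ≤ x × fromℕ p ≤ fromℕ (suc q) * s) ⊎
     (x ≤ 1# × fromℕ (suc q) * s ≤ fromℕ p)) ×
    r ^ suc q ≤ x ^ p

  -- Intended for c > 1 and t ≥ 1.
  log : ℝ → ℝ → ℝ
  log c t = sup λ s → 0# ≤ s × c ^ʳ s ≤ t

  TendsTo : (ℕ → ℝ) → ℝ ⁺ → Set
  TendsTo f [ a ] = ∀ ε → 0# < ε → ∃ λ N → ∀ n → N ℕ.≤ n →
                    f n - a < ε × a - f n < ε
  TendsTo f ⊤⁺    = ∀ M → ∃ λ N → ∀ n → N ℕ.≤ n → M ≤ f n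

  partialSum : (ℕ → ℝ) → ℕ → ℝ
  partialSum f n = sum {n} (f ∘ toℕ)

  ℝ² : Set
  ℝ² = ℝ × ℝ

  dist : ℝ² → ℝ² → ℝ
  dist (x , y) (x′ , y′) = √ ((x - x′) * (x - x′) + (y - y′) * (y - y′))

  DiamAtMost : ℝ → Pred (Pred ℝ² 0ℓ) 0ℓ
  DiamAtMost δ U = ∀ p q → p ∈ U → q ∈ U → dist p q ≤ δ

  -- Intended for nonempty sets of finite diameter.
  diam : Pred ℝ² 0ℓ → ℝ
  diam U = sup λ r → ∃₂ λ p q → p ∈ U × q ∈ U × r ≈ dist p q

  -- |U|^s, which is 0 for empty U even when s = 0; so finite covers are
  -- included among the sequences below.
  diamPower : ℝ → Pred ℝ² 0ℓ → ℝ
  diamPower s U = if does (lem {P = ∃ U}) then diam U ^ʳ s else 0#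

  Cover : ∀ {ℓ} → ℝ → Pred ℝ² ℓ → Set _
  Cover δ E = Σ (ℕ → Pred ℝ² 0ℓ) λ U →
              (E ⊆ ⋃ ℕ U) × (∀ i → DiamAtMost δ (U i))

  ℋδ : ∀ {ℓ} → ℝ → ℝ → Pred ℝ² ℓ → ℝ ⁺
  ℋδ s δ E = ⨅ {I = Cover δ E} λ (U , _) →
             ⨆ λ n → [ partialSum (λ i → diamPower s (U i)) n ]

  ℋ : ∀ {ℓ} → ℝ → Pred ℝ² ℓ → ℝ ⁺
  ℋ s E = ⨆ {I = ∃ (0# <_)} λ (δ , _) → ℋδ s δ E

  dimℋ : ∀ {ℓ} → Pred ℝ² ℓ → ℝ ⁺
  dimℋ E = ⨅ {I = ∃ λ s → 0# ≤ s × ℋ s E ≈⁺ [ 0# ]} λ (s , _) → [ s ]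

  -- Digit sequences are indexed from 0: d i is the digit x_{i+1}.
  IsExpansion : (b : ℕ) → ℝ → (ℕ → Fin b) → Set
  IsExpansion b x d =
    (∀ N → ∃ λ n → N ℕ.≤ n × toℕ (d n) ≢ 0) ×
    TendsTo (partialSum λ i → fromℕ (toℕ (d i)) * (fromℕ b ⁻¹) ^ suc i) [ x ]

  CommonSubstring : ∀ {b} → (ℕ → Fin b) → (ℕ → Fin b) → ℕ → ℕ → Set
  CommonSubstring d e n l = ∃₂ λ i j →
    i ℕ.+ l ℕ.≤ n × j ℕ.+ l ℕ.≤ n ×
    (∀ k → k ℕ.< l → d (i ℕ.+ k) ≡ e (j ℕ.+ k))

  -- The greatest l with 1 ≤ l ≤ m and P l, or 0 if there is none.
  greatest : Pred ℕ 0ℓ → ℕ → ℕ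
  greatest P zero    = 0
  greatest P (suc m) = if does (lem {P = P (suc m)}) then suc m else greatest P m

  lcs : ∀ {b} → (ℕ → Fin b) → (ℕ → Fin b) → ℕ → ℕ
  lcs d e n = greatest (CommonSubstring d e n) n

  UnitInterval : Pred ℝ 0ℓ
  UnitInterval x = 0# < x × x ≤ 1#

  S : ℕ → ℝ ⁺ → Pred ℝ² 0ℓ
  S b α (x , y) =
    x ∈ UnitInterval × y ∈ UnitInterval ×
    ∃₂ λ d e → IsExpansion b x d × IsExpansion b y e ×
    TendsTo (λ n → fromℕ (lcs d e n) * log (fromℕ b) (fromℕ n) ⁻¹) α

{-# OPTIONS --safe #-}
module Submission where

-- Let x contain the word 0^M in every window of some fixed length while y, by
-- a 1 at every M-th digit, avoids it.  Then all common substrings are bounded.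
-- Planting in both sequences runs of ℓ k zeros at position b^k, where ℓ k is
-- about α k (or k² if α = ∞), makes the longest common substring of the first
-- n digits ℓ (log_b n) up to a bounded error.  All other digits remain free,
-- and the fixed ones have density O(1/M).
--
-- Since fixed digits recur in bounded windows, points of this set whose digits
-- first differ at position m are at distance at least β^(m + O(1)), β = 1/b, so
-- a set of diameter d meets only one cylinder, of uniform measure O(d^s) as soon
-- as s < 2 − O(1/M).  A cover of small total s-power would thus give a
-- sequence of cylinders of total measure below 1; choosing the digits one by
-- one so that the conditional measure does not increase yields a point outside
-- all of them.  The upper bound comes from the b-adic squares covering (0,1]².

open import Defs
open import Axiom.ExcludedMiddle using (ExcludedMiddle)
open import Data.Nat.Base as ℕ using (ℕ; zero; suc; z≤n; s≤s; NonZero)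
open import Relation.Nullary.Construct.Add.Supremum using (_⁺; [_]; ⊤⁺)
open import Data.Bool.Base using (if_then_else_)
open import Data.Empty using (⊥; ⊥-elim)
open import Data.Fin.Base as Fin using (Fin; toℕ; fromℕ<; combine; remQuot)
import Data.Fin.Properties as Finₚ
open import Data.Maybe.Base using (Maybe; just; nothing)
open import Data.Nat.DivMod using (_/_; _%_; /-monoˡ-≤; [m+n]%n≡m%n; %-distribˡ-+; m*n/n≡m; m/n*n≤m; m%n%n≡m%n; m%n<n; m<n*o⇒m/o<n; m<n⇒m%n≡m; m≡m%n+[m/n]*n)
import Data.Nat.Properties as ℕₚ
open import Data.Nat.Solver using (module +-*-Solver)
open import Data.Product.Base using (∃; ∃₂; _×_; _,_; proj₁; proj₂)
open import Data.Sum.Base using (_⊎_; inj₁; inj₂)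
open import Data.Unit.Base using (⊤; tt)
open import Function.Base using (_∘_)
open import Level using (0ℓ)
open import Relation.Binary.Bundles using (Poset)
open import Relation.Binary.Definitions using (tri<; tri≈; tri>)
open import Relation.Binary.PropositionalEquality.Core as ≡ using (_≡_; _≢_)
open import Relation.Binary.Structures using (IsTotalOrder)
open import Relation.Nullary using (¬_; Dec; yes; no; does)
open import Relation.Nullary.Decidable using (decidable-stable)
open import Relation.Unary using (Pred; _∈_; _⊆_)
import Algebra.Properties.Ring as RingProperties
import Algebra.Properties.Semiring.Exp as Exp
import Algebra.Properties.Semiring.Mult as Mult
import Algebra.Properties.Semiring.Sum as SumProperties
import Algebra.Solver.Ring.NaturalCoefficients.Default as SemiringSolver
import Relation.Binary.Construct.Add.Supremum.Equality as AddSupEquality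
import Relation.Binary.Construct.Add.Supremum.NonStrict as AddSupOrder
import Relation.Binary.Reasoning.PartialOrder as PosetReasoning

-- For a fixed `M` the construction only excludes exponents up to 2 - 4/`M`, so `M` is chosen after
-- the exponent: `q` is taken with s ≤ 2 - 1/(q+1), and `M` is 4(q+1). The 4 counts the families of
-- fixed digits, each of density about 1/`M` at most in its own sequence. For the words 0^M 1 of x,
-- the period `L` = `M`(`M`+1) gives their `M`+1 digits density 1/`M`. The runs are polynomially
-- long and exponentially spaced, so they are negligible even for α = ∞; but they do bring 0^M into
-- y. A match much longer than the runs in range must leave the run of y that it meets, and the gap
-- behind that run is long enough to set a word 0^M of x against a 1 of y. Real exponents are only
-- compared with rationals: the scales are powers of β^(q+1), whose p/(q+1)-th powers are again
-- integer powers of β. Likewise log_b n is only located between integers. The uniform measure is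
-- never built: a cylinder is weighed by β to the number of its free digits.

-- Ordered-field arithmetic, the archimedean property and suprema

module RealLemmas (lem : ∀ {ℓ} → ExcludedMiddle ℓ) (R : CompleteOrderedField) where

  open Analysis lem R hiding (zero)
  open IsTotalOrder isTotalOrder using (isPartialOrder; total; antisym)
    renaming (refl to ≤-refl; trans to ≤-trans; reflexive to ≤-reflexive; ≤-respˡ-≈ to ≤-respˡ; ≤-respʳ-≈ to ≤-respʳ) public
  open RingProperties ring using (-‿+-comm; -‿distribˡ-*; -‿distribʳ-*; -0#≈0#; -‿involutive) public
  module Solver = SemiringSolver commutativeSemiring

  poset : Poset _ _ _
  poset = record { isPartialOrder = isPartialOrder }

  module ≤-Reasoning = PosetReasoning poset

  +-monoʳ-≤ : ∀ z {x y} → x ≤ y → z + x ≤ z + y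
  +-monoʳ-≤ z {x} {y} x≤y = ≤-respˡ (+-comm x z) (≤-respʳ (+-comm y z) (+-monoˡ-≤ z x≤y))

  +-mono-≤ : ∀ {x y u v} → x ≤ y → u ≤ v → x + u ≤ y + v
  +-mono-≤ x≤y u≤v = ≤-trans (+-monoˡ-≤ _ x≤y) (+-monoʳ-≤ _ u≤v)

  x+y-y≈x : ∀ x y → (x + y) - y ≈ x
  x+y-y≈x x y = trans (+-assoc x y (- y)) (trans (+-congˡ (-‿inverseʳ y)) (+-identityʳ x))

  x-y+y≈x : ∀ x y → (x - y) + y ≈ x
  x-y+y≈x x y = trans (+-assoc x (- y) y) (trans (+-congˡ (-‿inverseˡ y)) (+-identityʳ x))

  +-cancelʳ-≤ : ∀ z {x y} → x + z ≤ y + z → x ≤ y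
  +-cancelʳ-≤ z {x} {y} p = ≤-respˡ (x+y-y≈x x z) (≤-respʳ (x+y-y≈x y z) (+-monoˡ-≤ (- z) p))

  +-cancelˡ-≤ : ∀ z {x y} → z + x ≤ z + y → x ≤ y
  +-cancelˡ-≤ z {x} {y} p = +-cancelʳ-≤ z (≤-respˡ (+-comm z x) (≤-respʳ (+-comm z y) p))

  x-y≤z : ∀ {x y z} → x ≤ z + y → x - y ≤ z
  x-y≤z {x} {y} {z} p = ≤-respʳ (x+y-y≈x z y) (+-monoˡ-≤ (- y) p)

  x≤z+y : ∀ {x y z} → x - y ≤ z → x ≤ z + y
  x≤z+y {x} {y} {z} p = ≤-respˡ (x-y+y≈x x y) (+-monoˡ-≤ y p)

  0≤y-x : ∀ {x y} → x ≤ y → 0# ≤ y - x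
  0≤y-x {x} {y} p = ≤-respˡ (-‿inverseʳ x) (+-monoˡ-≤ (- x) p)

  <⇒≤ : ∀ {x y} → x < y → x ≤ y
  <⇒≤ = proj₁

  <⇒≱ : ∀ {x y} → x < y → ¬ (y ≤ x)
  <⇒≱ (x≤y , x≉y) y≤x = x≉y (antisym x≤y y≤x)

  ≰⇒> : ∀ {x y} → ¬ (x ≤ y) → y < x
  ≰⇒> {x} {y} x≰y with total x y
  ... | inj₁ x≤y = ⊥-elim (x≰y x≤y)
  ... | inj₂ y≤x = y≤x , λ y≈x → x≰y (≤-reflexive (sym y≈x))

  ≮⇒≥ : ∀ {x y} → ¬ (x < y) → y ≤ x
  ≮⇒≥ {x} {y} x≮y with lem {P = y ≤ x}
  ... | yes y≤x = y≤x
  ... | no  y≰x = ⊥-elim (x≮y (≰⇒> y≰x))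

  <-≤-trans : ∀ {x y z} → x < y → y ≤ z → x < z
  <-≤-trans x<y y≤z = ≰⇒> λ z≤x → <⇒≱ x<y (≤-trans y≤z z≤x)

  ≤-<-trans : ∀ {x y z} → x ≤ y → y < z → x < z
  ≤-<-trans x≤y y<z = ≰⇒> λ z≤x → <⇒≱ y<z (≤-trans z≤x x≤y)

  +-monoˡ-< : ∀ z {x y} → x < y → x + z < y + z
  +-monoˡ-< z x<y = ≰⇒> λ p → <⇒≱ x<y (+-cancelʳ-≤ z p)

  x-y<z : ∀ {x y z} → x < z + y → x - y < z
  x-y<z {x} {y} {z} p = ≰⇒> λ q → <⇒≱ p (≤-respʳ (x-y+y≈x x y) (+-monoˡ-≤ y q))

  0<y-x : ∀ {x y} → x < y → 0# < y - x
  0<y-x {x} {y} p = ≰⇒> λ q → <⇒≱ p (≤-respʳ (+-identityˡ x) (x≤z+y q))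

  x<x+y : ∀ x {y} → 0# < y → x < x + y
  x<x+y x {y} 0<y = ≰⇒> λ p → <⇒≱ 0<y (+-cancelˡ-≤ x (≤-respʳ (sym (+-identityʳ x)) p))

  *-monoˡ-≤ : ∀ {z} → 0# ≤ z → ∀ {x y} → x ≤ y → z * x ≤ z * y
  *-monoˡ-≤ {z} 0≤z {x} {y} x≤y = +-cancelʳ-≤ (- (z * x)) (begin
    z * x - z * x       ≈⟨ -‿inverseʳ (z * x) ⟩
    0#                  ≤⟨ *-nonneg 0≤z (0≤y-x x≤y) ⟩
    z * (y - x)         ≈⟨ distribˡ z y (- x) ⟩
    z * y + z * (- x)   ≈⟨ +-congˡ (sym (-‿distribʳ-* z x)) ⟩
    z * y - z * x       ∎)
    where open ≤-Reasoning

  *-monoʳ-≤ : ∀ {z} → 0# ≤ z → ∀ {x y} → x ≤ y → x * z ≤ y * z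
  *-monoʳ-≤ {z} 0≤z {x} {y} x≤y = ≤-respˡ (*-comm z x) (≤-respʳ (*-comm z y) (*-monoˡ-≤ 0≤z x≤y))

  *-mono-≤ : ∀ {x y u v} → 0# ≤ x → 0# ≤ u → x ≤ y → u ≤ v → x * u ≤ y * v
  *-mono-≤ 0≤x 0≤u x≤y u≤v = ≤-trans (*-monoʳ-≤ 0≤u x≤y) (*-monoˡ-≤ (≤-trans 0≤x x≤y) u≤v)

  -‿square : ∀ x → - x * - x ≈ x * x
  -‿square x = trans (sym (-‿distribˡ-* x (- x))) (trans (-‿cong (sym (-‿distribʳ-* x x))) (-‿involutive (x * x)))

  0≤1 : 0# ≤ 1#
  0≤1 with total 0# 1#
  ... | inj₁ 0≤1 = 0≤1
  ... | inj₂ 1≤0 = ≤-respʳ (trans (-‿square 1#) (*-identityˡ 1#)) (*-nonneg 0≤-1 0≤-1)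
    where
    0≤-1 : 0# ≤ - 1#
    0≤-1 = ≤-respʳ (+-identityˡ (- 1#)) (0≤y-x 1≤0)

  0<1 : 0# < 1#
  0<1 = 0≤1 , λ p → 1≉0 (sym p)

  0≤+ : ∀ {x y} → 0# ≤ x → 0# ≤ y → 0# ≤ x + y
  0≤+ p q = ≤-respˡ (+-identityˡ 0#) (+-mono-≤ p q)

  x≤x+y : ∀ x {y} → 0# ≤ y → x ≤ x + y
  x≤x+y x p = ≤-respˡ (+-identityʳ x) (+-monoʳ-≤ x p)

  x≤y+x : ∀ x {y} → 0# ≤ y → x ≤ y + x
  x≤y+x x p = ≤-respˡ (+-identityˡ x) (+-monoˡ-≤ x p)

  >⇒≉ : ∀ {x} → 0# < x → ¬ (x ≈ 0#)
  >⇒≉ (_ , n) e = n (sym e)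

  0<⁻¹ : ∀ {x} → 0# < x → 0# < x ⁻¹
  0<⁻¹ {x} 0<x = ≰⇒> λ p → <⇒≱ 0<1 (begin
    1#        ≈⟨ ⁻¹-inverseʳ x (>⇒≉ 0<x) ⟨
    x * x ⁻¹  ≤⟨ *-monoˡ-≤ (<⇒≤ 0<x) p ⟩
    x * 0#    ≈⟨ zeroʳ x ⟩
    0#        ∎)
    where open ≤-Reasoning

  ⁻¹-inverseˡ : ∀ {x} → 0# < x → x ⁻¹ * x ≈ 1#
  ⁻¹-inverseˡ {x} p = trans (*-comm _ _) (⁻¹-inverseʳ x (>⇒≉ p))

  x≤z*y⁻¹ : ∀ {x y z} → 0# < y → x * y ≤ z → x ≤ z * y ⁻¹
  x≤z*y⁻¹ {x} {y} {z} 0<y p = begin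
    x              ≈⟨ *-identityʳ x ⟨
    x * 1#         ≈⟨ *-congˡ (⁻¹-inverseʳ y (>⇒≉ 0<y)) ⟨
    x * (y * y ⁻¹) ≈⟨ *-assoc x y _ ⟨
    x * y * y ⁻¹   ≤⟨ *-monoʳ-≤ (<⇒≤ (0<⁻¹ 0<y)) p ⟩
    z * y ⁻¹       ∎
    where open ≤-Reasoning

  z*y⁻¹≤x : ∀ {x y z} → 0# < y → z ≤ x * y → z * y ⁻¹ ≤ x
  z*y⁻¹≤x {x} {y} {z} 0<y p = begin
    z * y ⁻¹       ≤⟨ *-monoʳ-≤ (<⇒≤ (0<⁻¹ 0<y)) p ⟩
    x * y * y ⁻¹   ≈⟨ *-assoc x y _ ⟩
    x * (y * y ⁻¹) ≈⟨ *-congˡ (⁻¹-inverseʳ y (>⇒≉ 0<y)) ⟩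
    x * 1#         ≈⟨ *-identityʳ x ⟩
    x              ∎
    where open ≤-Reasoning

  *-cancelʳ-≤ : ∀ {x y z} → 0# < z → x * z ≤ y * z → x ≤ y
  *-cancelʳ-≤ {x} {y} {z} 0<z p = ≤-trans (x≤z*y⁻¹ 0<z p) (z*y⁻¹≤x 0<z ≤-refl)

  0<* : ∀ {x y} → 0# < x → 0# < y → 0# < x * y
  0<* {x} {y} 0<x 0<y = ≰⇒> λ p → <⇒≱ 0<x (*-cancelʳ-≤ 0<y (≤-respʳ (sym (zeroˡ y)) p))

  0≤x² : ∀ x → 0# ≤ x * x
  0≤x² x with total 0# x
  ... | inj₁ 0≤x = *-nonneg 0≤x 0≤x
  ... | inj₂ x≤0 = ≤-respʳ (-‿square x) (*-nonneg 0≤-x 0≤-x)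
    where
    0≤-x : 0# ≤ - x
    0≤-x = ≤-respʳ (+-identityˡ (- x)) (0≤y-x x≤0)

  open Mult semiring using (×-homo-+; ×1-homo-*)
  open Exp semiring using (^-homo-*; ^-assocʳ) public

  fromℕ-+ : ∀ m n → fromℕ (m ℕ.+ n) ≈ fromℕ m + fromℕ n
  fromℕ-+ m n = ×-homo-+ 1# m n

  fromℕ-* : ∀ m n → fromℕ (m ℕ.* n) ≈ fromℕ m * fromℕ n
  fromℕ-* m n = ×1-homo-* m n

  fromℕ-1 : fromℕ 1 ≈ 1#
  fromℕ-1 = +-identityʳ 1#

  fromℕ-^ : ∀ m n → fromℕ (m ℕ.^ n) ≈ fromℕ m ^ n
  fromℕ-^ m zero    = fromℕ-1
  fromℕ-^ m (suc n) = trans (fromℕ-* m (m ℕ.^ n)) (*-congˡ (fromℕ-^ m n))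

  0≤fromℕ : ∀ n → 0# ≤ fromℕ n
  0≤fromℕ zero    = ≤-refl
  0≤fromℕ (suc n) = 0≤+ 0≤1 (0≤fromℕ n)

  fromℕ-mono-≤ : ∀ {m n} → m ℕ.≤ n → fromℕ m ≤ fromℕ n
  fromℕ-mono-≤ {n = n} z≤n = 0≤fromℕ n
  fromℕ-mono-≤ (s≤s p)     = +-monoʳ-≤ 1# (fromℕ-mono-≤ p)

  fromℕ-mono-< : ∀ {m n} → m ℕ.< n → fromℕ m < fromℕ n
  fromℕ-mono-< {m} {n} p =
    <-≤-trans (<-≤-trans (x<x+y (fromℕ m) 0<1) (≤-reflexive (+-comm _ _))) (fromℕ-mono-≤ p)

  0<fromℕ : ∀ n → 0# < fromℕ (suc n)
  0<fromℕ n = fromℕ-mono-< {0} {suc n} (s≤s z≤n)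

  -- If `s` were the least upper bound of the naturals, `s - 1#` would be an upper bound too,
  -- because successors of naturals are naturals.
  archimedean : ∀ x → ∃ λ n → x ≤ fromℕ n
  archimedean x with lem {P = ∃ λ n → x ≤ fromℕ n}
  ... | yes p = p
  ... | no ¬p with complete (λ y → ∃ λ n → y ≈ fromℕ n) (0# , 0 , refl)
                     (x , λ { y (n , y≈n) → ≤-respˡ (sym y≈n) (<⇒≤ (≰⇒> λ q → ¬p (n , q))) })
  ... | s , ub , least = ⊥-elim (<⇒≱ (<-≤-trans (x<x+y (s - 1#) 0<1) (≤-reflexive (x-y+y≈x s 1#)))
          (least (s - 1#) λ { y (n , y≈n) → +-cancelʳ-≤ 1# (≤-respʳ (sym (x-y+y≈x s 1#))
             (ub _ (suc n , trans (+-congʳ y≈n) (+-comm _ _)))) }))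

  0≤^ : ∀ {x} → 0# ≤ x → ∀ n → 0# ≤ x ^ n
  0≤^ p zero    = 0≤1
  0≤^ p (suc n) = *-nonneg p (0≤^ p n)

  0<^ : ∀ {x} → 0# < x → ∀ n → 0# < x ^ n
  0<^ p zero    = 0<1
  0<^ p (suc n) = 0<* p (0<^ p n)

  ^-monoˡ-≤ : ∀ {x y} → 0# ≤ x → x ≤ y → ∀ n → x ^ n ≤ y ^ n
  ^-monoˡ-≤ 0≤x x≤y zero    = ≤-refl
  ^-monoˡ-≤ 0≤x x≤y (suc n) = *-mono-≤ 0≤x (0≤^ 0≤x n) x≤y (^-monoˡ-≤ 0≤x x≤y n)

  ^-≤1 : ∀ {x} → 0# ≤ x → x ≤ 1# → ∀ n → x ^ n ≤ 1#
  ^-≤1 0≤x x≤1 zero    = ≤-refl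
  ^-≤1 0≤x x≤1 (suc n) = ≤-respʳ (*-identityˡ 1#) (*-mono-≤ 0≤x (0≤^ 0≤x n) x≤1 (^-≤1 0≤x x≤1 n))

  1≤^ : ∀ {x} → 1# ≤ x → ∀ n → 1# ≤ x ^ n
  1≤^ 1≤x zero    = ≤-refl
  1≤^ 1≤x (suc n) = ≤-respˡ (*-identityˡ 1#) (*-mono-≤ 0≤1 0≤1 1≤x (1≤^ 1≤x n))

  ^-antitoneʳ : ∀ {x} → 0# ≤ x → x ≤ 1# → ∀ {m n} → m ℕ.≤ n → x ^ n ≤ x ^ m
  ^-antitoneʳ 0≤x x≤1 {n = n} z≤n = ^-≤1 0≤x x≤1 n
  ^-antitoneʳ 0≤x x≤1 (s≤s p)     = *-monoˡ-≤ 0≤x (^-antitoneʳ 0≤x x≤1 p)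

  ^-monoʳ : ∀ {x} → 1# ≤ x → ∀ {m n} → m ℕ.≤ n → x ^ m ≤ x ^ n
  ^-monoʳ 1≤x {n = n} z≤n = 1≤^ 1≤x n
  ^-monoʳ 1≤x (s≤s p)     = *-monoˡ-≤ (≤-trans 0≤1 1≤x) (^-monoʳ 1≤x p)

  -- Takes the place of extracting roots: inequalities between real powers are proved after raising
  -- both sides to the denominator of an exponent.
  ^-cancel-≤ : ∀ {x y} n → 0# ≤ y → x ^ suc n ≤ y ^ suc n → x ≤ y
  ^-cancel-≤ {x} {y} n 0≤y p with lem {P = x ≤ y}
  ... | yes q = q
  ... | no ¬q = ⊥-elim (¬q (*-cancelʳ-≤ (0<^ 0<x n) (≤-trans p (*-monoˡ-≤ 0≤y (^-monoˡ-≤ 0≤y (<⇒≤ y<x) n)))))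
    where
    y<x = ≰⇒> ¬q
    0<x = ≤-<-trans 0≤y y<x

  module _ {ℓ} (P : Pred ℝ ℓ) where

    -- `0≤u` accounts for the default value 0 of `sup`, which makes the bound valid for empty `P` as
    -- well; `sup-least′` trades it for an element of `P`.
    sup-least : ∀ {u} → 0# ≤ u → UpperBound P u → sup P ≤ u
    sup-least 0≤u ub with lem {P = ∃ P × ∃ (UpperBound P)}
    ... | yes (inhabited , bounded) = proj₂ (proj₂ (complete P inhabited bounded)) _ ub
    ... | no _                      = 0≤u

    sup-least′ : ∀ {u} → ∃ P → UpperBound P u → sup P ≤ u
    sup-least′ ih ub with lem {P = ∃ P × ∃ (UpperBound P)}
    ... | yes (inhabited , bounded) = proj₂ (proj₂ (complete P inhabited bounded)) _ ub
    ... | no n                      = ⊥-elim (n (ih , _ , ub))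

    sup-upper : ∀ {u} → UpperBound P u → UpperBound P (sup P)
    sup-upper ub x Px with lem {P = ∃ P × ∃ (UpperBound P)}
    ... | yes (inhabited , bounded) = proj₁ (proj₂ (complete P inhabited bounded)) x Px
    ... | no n                      = ⊥-elim (n ((x , Px) , _ , ub))

-- Extended suprema and infima, distances, real powers, logarithms and sums

module AnalysisLemmas (lem : ∀ {ℓ} → ExcludedMiddle ℓ) (R : CompleteOrderedField) where

  open Analysis lem R hiding (zero)
  open RealLemmas lem R
  open AddSupEquality _≈_ using (≈⁺-sym; [_])
  open AddSupOrder _≤_ using ([_]; _≤⊤⁺; ≤⁺-trans; ≤⁺-reflexive; [≤]-injective)
  open SumProperties semiring using (∑-distrib-+; *-distribˡ-sum)

  -‿anti-≤ : ∀ {x y} → x ≤ y → - y ≤ - x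
  -‿anti-≤ {x} {y} p = +-cancelʳ-≤ y (≤-respˡ (sym (-‿inverseˡ y)) (≤-respʳ (+-comm y (- x)) (0≤y-x p)))

  ≤⁺-refl-≈ : ∀ {u v} → u ≈⁺ v → u ≤⁺ v
  ≤⁺-refl-≈ = ≤⁺-reflexive ≤-reflexive

  ≰⁺⇒≥⁺ : ∀ {u y} → ¬ (u ≤⁺ [ y ]) → [ y ] ≤⁺ u
  ≰⁺⇒≥⁺ {[ x ]} p = [ <⇒≤ (≰⇒> λ q → p [ q ]) ]
  ≰⁺⇒≥⁺ {⊤⁺}    p = _ ≤⊤⁺

  ≤⁺⇒≈⁺ : ∀ {u y} → u ≤⁺ [ y ] → ∃ λ x → u ≈⁺ [ x ]
  ≤⁺⇒≈⁺ {[ x ]} _ = x , [ refl ]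

  module _ {i} {I : Set i} (f : I → ℝ ⁺) where

    ⨆-upper : ∀ {x} → ⨆ f ≤⁺ [ x ] → ∀ i → f i ≤⁺ [ x ]
    ⨆-upper p i with lem {P = ∃ λ u → ∀ i → f i ≤⁺ [ u ]}
    ⨆-upper () i | no _
    ⨆-upper [ p ] i | yes (u , h) with ≤⁺⇒≈⁺ (h i)
    ... | y , e = ≤⁺-trans ≤-trans (≤⁺-refl-≈ e) [ ≤-trans
          (sup-upper _ (λ { z (j , e′) → [≤]-injective (≤⁺-trans ≤-trans (≤⁺-refl-≈ (≈⁺-sym sym e′)) (h j)) }) y (i , e)) p ]

    ⨆-least : ∀ {u} → 0# ≤ u → (∀ i → f i ≤⁺ [ u ]) → ⨆ f ≤⁺ [ u ]
    ⨆-least {u} 0≤u h with lem {P = ∃ λ u → ∀ i → f i ≤⁺ [ u ]}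
    ... | yes _ = [ sup-least _ 0≤u (λ { z (j , e) → [≤]-injective (≤⁺-trans ≤-trans (≤⁺-refl-≈ (≈⁺-sym sym e)) (h j)) }) ]
    ... | no n  = ⊥-elim (n (u , h))

    private
      lower-bound : ∀ {a} → (∀ i → [ a ] ≤⁺ f i) →
                    UpperBound (λ x → ∃ λ i → f i ≈⁺ [ - x ]) (- a)
      lower-bound h z (j , e) = ≤-respˡ (-‿involutive z) (-‿anti-≤ ([≤]-injective (≤⁺-trans ≤-trans (h j) (≤⁺-refl-≈ e))))

    ⨅-greatest : ∀ {a} → (∀ i → [ a ] ≤⁺ f i) → [ a ] ≤⁺ ⨅ f
    ⨅-greatest {a} h with lem {P = ∃₂ λ i x → f i ≈⁺ [ x ]}
    ... | yes (i , x , e) = [ ≤-respˡ (-‿involutive a) (-‿anti-≤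
            (sup-least′ _ (- x , i , ≤⁺-≈ e) (lower-bound h))) ]
      where
      ≤⁺-≈ : ∀ {u} → u ≈⁺ [ x ] → u ≈⁺ [ - (- x) ]
      ≤⁺-≈ [ p ] = [ trans p (sym (-‿involutive x)) ]
    ... | no _ = _ ≤⊤⁺

    -- `inf` is read off the supremum of the negatives, whose boundedness is what the lower bound
    -- `a` supplies; otherwise the default value 0 could exceed `x`.
    ⨅-lower : ∀ {a} → (∀ i → [ a ] ≤⁺ f i) → ∀ {x} i → f i ≤⁺ [ x ] → ⨅ f ≤⁺ [ x ]
    ⨅-lower {a} h {x} i p with lem {P = ∃₂ λ i x → f i ≈⁺ [ x ]} | ≤⁺⇒≈⁺ p
    ... | no n  | y , e = ⊥-elim (n (i , y , e))
    ... | yes _ | y , e = ≤⁺-trans ≤-trans [ ≤-respʳ (-‿involutive y) (-‿anti-≤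
            (sup-upper _ (lower-bound h) (- y) (i , ≤⁺-≈ e))) ] (≤⁺-trans ≤-trans (≤⁺-refl-≈ (≈⁺-sym sym e)) p)
      where
      ≤⁺-≈ : ∀ {u} → u ≈⁺ [ y ] → u ≈⁺ [ - (- y) ]
      ≤⁺-≈ [ p ] = [ trans p (sym (-‿involutive y)) ]

    ⨅-approx : ∀ {x y} → ⨅ f ≤⁺ [ x ] → x < y → ∃ λ i → f i ≤⁺ [ y ]
    ⨅-approx {x} {y} p x<y with lem {P = ∃ λ i → f i ≤⁺ [ y ]}
    ... | yes q = q
    ... | no n  = ⊥-elim (<⇒≱ x<y ([≤]-injective (≤⁺-trans ≤-trans
                    (⨅-greatest λ i → ≰⁺⇒≥⁺ λ q → n (i , q)) p)))

  sup-nonneg : ∀ {ℓ} (P : Pred ℝ ℓ) → (∀ x → x ∈ P → 0# ≤ x) → 0# ≤ sup P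
  sup-nonneg P h with lem {P = ∃ P × ∃ (UpperBound P)}
  ... | yes (inhabited , bounded) =
          ≤-trans (h _ (proj₂ inhabited)) (proj₁ (proj₂ (complete P inhabited bounded)) _ (proj₂ inhabited))
  ... | no _ = ≤-refl

  x*x≤y*y⇒x≤y : ∀ {x y} → 0# ≤ y → x * x ≤ y * y → x ≤ y
  x*x≤y*y⇒x≤y {x} {y} 0≤y p = ^-cancel-≤ 1 0≤y (≤-respˡ (sq x) (≤-respʳ (sq y) p))
    where
    sq : ∀ z → z * z ≈ z ^ 2
    sq z = *-congˡ (sym (*-identityʳ z))

  √-least : ∀ {t u} → 0# ≤ u → t ≤ u * u → √ t ≤ u
  √-least 0≤u p = sup-least _ 0≤u λ r (_ , q) → x*x≤y*y⇒x≤y 0≤u (≤-trans q p)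

  √-upper : ∀ {r t} → 0# ≤ r → r * r ≤ t → r ≤ √ t
  √-upper {r} {t} 0≤r p = sup-upper (λ r → 0# ≤ r × r * r ≤ t) {t + 1#} bound r (0≤r , p)
    where
    bound : UpperBound (λ r → 0# ≤ r × r * r ≤ t) (t + 1#)
    -- Either `z ≤ 1#`, and `t` is nonnegative because it bounds a square, or `z ≤ z * z ≤ t`.
    bound z (0≤z , q) with total z 1#
    ... | inj₁ z≤1 = ≤-trans z≤1 (x≤y+x 1# (≤-trans (0≤x² z) q))
    ... | inj₂ 1≤z = ≤-trans (≤-respˡ (*-identityˡ z) (*-monoʳ-≤ 0≤z 1≤z)) (≤-trans q (x≤x+y t 0≤1))

  0≤√ : ∀ t → 0# ≤ √ t
  0≤√ t = sup-nonneg _ λ _ → proj₁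

  0≤dist : ∀ p q → 0# ≤ dist p q
  0≤dist p q = 0≤√ _

  -‿swap : ∀ x y → - (x - y) ≈ y - x
  -‿swap x y = trans (sym (-‿+-comm x (- y))) (trans (+-congˡ (-‿involutive y)) (+-comm (- x) y))

  private
    ∣x∣≤√ : ∀ x {t} → x * x ≤ t → x ≤ √ t
    ∣x∣≤√ x {t} p with total 0# x
    ... | inj₁ 0≤x = √-upper 0≤x p
    ... | inj₂ x≤0 = ≤-trans x≤0 (0≤√ t)

  Δx≤dist : ∀ x y x′ y′ → x - x′ ≤ dist (x , y) (x′ , y′)
  Δx≤dist x y x′ y′ = ∣x∣≤√ _ (x≤x+y _ (0≤x² _))

  Δy≤dist : ∀ x y x′ y′ → y - y′ ≤ dist (x , y) (x′ , y′)
  Δy≤dist x y x′ y′ = ∣x∣≤√ _ (x≤y+x _ (0≤x² _))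

  square-≤ : ∀ {u c} → u ≤ c → - u ≤ c → u * u ≤ c * c
  square-≤ {u} {c} p q with total 0# u
  ... | inj₁ 0≤u = *-mono-≤ 0≤u 0≤u p p
  ... | inj₂ u≤0 = ≤-respˡ (-‿square u) (*-mono-≤ 0≤-u 0≤-u q q)
    where
    0≤-u : 0# ≤ - u
    0≤-u = ≤-respˡ -0#≈0# (-‿anti-≤ u≤0)

  -- The bound 2c replaces √2 c, so that comparing squares suffices.
  dist-≤ : ∀ {x y x′ y′ c} → 0# ≤ c → x ≤ c + x′ → x′ ≤ c + x → y ≤ c + y′ → y′ ≤ c + y →
           dist (x , y) (x′ , y′) ≤ c + c
  dist-≤ {x} {y} {x′} {y′} {c} 0≤c p q r s = √-least (0≤+ 0≤c 0≤c) (begin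
    (x - x′) * (x - x′) + (y - y′) * (y - y′)
      ≤⟨ +-mono-≤ (square-≤ (x-y≤z p) (≤-respˡ (sym (-‿swap x x′)) (x-y≤z q)))
                  (square-≤ (x-y≤z r) (≤-respˡ (sym (-‿swap y y′)) (x-y≤z s))) ⟩
    c * c + c * c
      ≤⟨ x≤x+y _ (0≤+ (*-nonneg 0≤c 0≤c) (*-nonneg 0≤c 0≤c)) ⟩
    (c * c + c * c) + (c * c + c * c)
      ≈⟨ Solver.solve 1 (λ c → (c :* c :+ c :* c) :+ (c :* c :+ c :* c) := (c :+ c) :* (c :+ c)) refl c ⟩
    (c + c) * (c + c) ∎)
    where
    open ≤-Reasoning
    open Solver using (_:+_; _:*_; _:=_)

  dist≤diam : ∀ {U δ} → DiamAtMost δ U → ∀ p q → p ∈ U → q ∈ U → dist p q ≤ diam U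
  dist≤diam {U} {δ} small p q p∈U q∈U =
    sup-upper (λ r → ∃₂ λ p q → p ∈ U × q ∈ U × r ≈ dist p q)
      (λ { r (p , q , p∈U , q∈U , e) → ≤-respˡ (sym e) (small p q p∈U q∈U) }) _ (p , q , p∈U , q∈U , refl)

  diam≤ : ∀ {U δ} → 0# ≤ δ → DiamAtMost δ U → diam U ≤ δ
  diam≤ 0≤δ small = sup-least _ 0≤δ λ { r (p , q , p∈U , q∈U , e) → ≤-respˡ (sym e) (small p q p∈U q∈U) }

  0≤diam : ∀ U → 0# ≤ diam U
  0≤diam U = sup-nonneg _ λ { r (p , q , _ , _ , e) → ≤-respʳ (sym e) (0≤dist p q) }

  fromℕ-cancel-≤ : ∀ {m n} → fromℕ m ≤ fromℕ n → m ℕ.≤ n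
  fromℕ-cancel-≤ {m} {n} p with ℕₚ.≤-<-connex m n
  ... | inj₁ q = q
  ... | inj₂ q = ⊥-elim (<⇒≱ (fromℕ-mono-< q) p)

  0≤^ʳ : ∀ x s → 0# ≤ x ^ʳ s
  0≤^ʳ x s = sup-nonneg _ λ _ → proj₁

  0≤diamPower : ∀ s U → 0# ≤ diamPower s U
  0≤diamPower s U with lem {P = ∃ U}
  ... | yes _ = 0≤^ʳ _ s
  ... | no _  = ≤-refl

  private
    1^≈1 : ∀ n → 1# ^ n ≈ 1#
    1^≈1 zero    = refl
    1^≈1 (suc n) = trans (*-identityˡ _) (1^≈1 n)

    cross-multiply : ∀ {s} p q p′ q′ → fromℕ p ≤ fromℕ q * s → fromℕ q′ * s ≤ fromℕ p′ →
                     p ℕ.* q′ ℕ.≤ q ℕ.* p′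
    cross-multiply {s} p q p′ q′ h h′ = fromℕ-cancel-≤ {p ℕ.* q′} {q ℕ.* p′} (begin
      fromℕ (p ℕ.* q′)          ≈⟨ fromℕ-* p q′ ⟩
      fromℕ p * fromℕ q′        ≤⟨ *-monoʳ-≤ (0≤fromℕ q′) h ⟩
      fromℕ q * s * fromℕ q′    ≈⟨ trans (*-assoc _ _ _) (*-congˡ (*-comm _ _)) ⟩
      fromℕ q * (fromℕ q′ * s)  ≤⟨ *-monoˡ-≤ (0≤fromℕ q) h′ ⟩
      fromℕ q * fromℕ p′        ≈⟨ fromℕ-* q p′ ⟨
      fromℕ (q ℕ.* p′)          ∎)
      where open ≤-Reasoning

  -- With `c` in the role of a (q+1)-th root, a rational p/(q+1) ≤ s turns the real power into the
  -- integer power `c ^ p`. The exponents in the defining supremum are at least s and are compared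
  -- with p/(q+1) by cross-multiplication.
  ^ʳ-least : ∀ {x s c} p q → 0# ≤ x → 0# ≤ c → c ≤ 1# → x ≤ c ^ suc q →
             fromℕ p ≤ fromℕ (suc q) * s → x ^ʳ s ≤ c ^ p
  ^ʳ-least {x} {s} {c} p q 0≤x 0≤c c≤1 x≤c^q p≤qs = sup-least _ (0≤^ 0≤c p) bound
    where
    open ≤-Reasoning
    bound : UpperBound _ (c ^ p)
    -- A boundary case: `1# ≤ x` and `c ≤ 1#` force both `x` and `c` to be 1.
    bound r (_ , p′ , q′ , inj₁ (1≤x , _) , r^q≤x^p) = ^-cancel-≤ q′ (0≤^ 0≤c p) (begin
      r ^ suc q′         ≤⟨ r^q≤x^p ⟩
      x ^ p′             ≤⟨ ^-≤1 0≤x (≤-trans x≤c^q (^-≤1 0≤c c≤1 (suc q))) p′ ⟩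
      1#                 ≤⟨ 1≤^ (1≤^ 1≤c p) (suc q′) ⟩
      (c ^ p) ^ suc q′   ∎)
      where
      1≤c : 1# ≤ c
      1≤c = ≤-trans 1≤x (≤-trans x≤c^q (≤-respʳ (*-identityʳ c) (*-monoˡ-≤ 0≤c (^-≤1 0≤c c≤1 q))))
    bound r (_ , p′ , q′ , inj₂ (_ , qs≤p) , r^q≤x^p) = ^-cancel-≤ q′ (0≤^ 0≤c p) (begin
      r ^ suc q′         ≤⟨ r^q≤x^p ⟩
      x ^ p′             ≤⟨ ^-monoˡ-≤ 0≤x x≤c^q p′ ⟩
      (c ^ suc q) ^ p′   ≈⟨ ^-assocʳ c (suc q) p′ ⟩
      c ^ (suc q ℕ.* p′) ≤⟨ ^-antitoneʳ 0≤c c≤1 (cross-multiply p (suc q) p′ (suc q′) p≤qs qs≤p) ⟩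
      c ^ (p ℕ.* suc q′) ≈⟨ ^-assocʳ c p (suc q′) ⟨
      (c ^ p) ^ suc q′   ∎)

  ^ʳ-upper : ∀ {x s r} p q → 0# ≤ x → x ≤ 1# → 0# ≤ r → fromℕ (suc q) * s ≤ fromℕ p →
             r ^ suc q ≤ x ^ p → r ≤ x ^ʳ s
  ^ʳ-upper {x} {s} {r} p q 0≤x x≤1 0≤r qs≤p h = sup-upper _ {1#} bound r (0≤r , p , q , inj₂ (x≤1 , qs≤p) , h)
    where
    bound : UpperBound _ 1#
    bound z (_ , p′ , q′ , _ , z^q≤x^p) = ^-cancel-≤ q′ 0≤1
      (≤-trans z^q≤x^p (≤-trans (^-≤1 0≤x x≤1 p′) (≤-reflexive (sym (1^≈1 (suc q′))))))

  module _ {c : ℝ} (1<c : 1# < c) (c^-unbounded : ∀ t → ∃ λ n → t < c ^ n) where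

    private
      ^ʳ-bound : ∀ {s} m → s ≤ fromℕ m → UpperBound (λ r → 0# ≤ r × ∃₂ λ p q →
        ((1# ≤ c × fromℕ p ≤ fromℕ (suc q) * s) ⊎ (c ≤ 1# × fromℕ (suc q) * s ≤ fromℕ p)) ×
        r ^ suc q ≤ c ^ p) (c ^ m)
      ^ʳ-bound m s≤m r (_ , p , q , inj₂ (c≤1 , _) , _) = ⊥-elim (<⇒≱ 1<c c≤1)
      ^ʳ-bound {s} m s≤m r (_ , p , q , inj₁ (1≤c , p≤qs) , r^q≤c^p) =
        ^-cancel-≤ q (0≤^ (≤-trans 0≤1 1≤c) m) (begin
          r ^ suc q           ≤⟨ r^q≤c^p ⟩
          c ^ p               ≤⟨ ^-monoʳ 1≤c (fromℕ-cancel-≤ {p} {suc q ℕ.* m} p≤qm) ⟩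
          c ^ (suc q ℕ.* m)   ≡⟨ ≡.cong (c ^_) (ℕₚ.*-comm (suc q) m) ⟩
          c ^ (m ℕ.* suc q)   ≈⟨ ^-assocʳ c m (suc q) ⟨
          (c ^ m) ^ suc q     ∎)
        where
        open ≤-Reasoning
        p≤qm : fromℕ p ≤ fromℕ (suc q ℕ.* m)
        p≤qm = ≤-respʳ (sym (fromℕ-* (suc q) m)) (≤-trans p≤qs (*-monoˡ-≤ (0≤fromℕ (suc q)) s≤m))

      ^≤^ʳ : ∀ {s} m → fromℕ m ≤ s → c ^ m ≤ c ^ʳ s
      ^≤^ʳ {s} m m≤s with archimedean s
      ... | m′ , s≤m′ = sup-upper _ (^ʳ-bound m′ s≤m′) (c ^ m)
            (0≤^ 0≤c m , m , 0 , inj₁ (<⇒≤ 1<c , ≤-respʳ (sym (trans (*-congʳ fromℕ-1) (*-identityˡ s))) m≤s) ,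
             ≤-reflexive (*-identityʳ _))
        where 0≤c = ≤-trans 0≤1 (<⇒≤ 1<c)

    -- For s ≥ m the power `c ^ʳ s` dominates `c ^ m`, so the exponents s with `c ^ʳ s ≤ t` stay
    -- below every m with t < c^m. This bounds the set whose supremum is the logarithm.
    log-upper : ∀ {t} k → c ^ k ≤ t → fromℕ k ≤ log c t
    log-upper {t} k p with c^-unbounded t
    ... | m , t<c^m = sup-upper (λ s → 0# ≤ s × c ^ʳ s ≤ t) {fromℕ m}
          (λ { s (_ , q) → <⇒≤ (≰⇒> λ m≤s → <⇒≱ t<c^m (≤-trans (^≤^ʳ m m≤s) q)) }) (fromℕ k)
          (0≤fromℕ k , ≤-trans (sup-least _ (0≤^ (≤-trans 0≤1 (<⇒≤ 1<c)) k) (^ʳ-bound k ≤-refl)) p)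

    log-least : ∀ {t} k → t < c ^ k → log c t ≤ fromℕ k
    log-least k p = sup-least _ (0≤fromℕ k)
      λ { s (_ , q) → <⇒≤ (≰⇒> λ m≤s → <⇒≱ p (≤-trans (^≤^ʳ k m≤s) q)) }

  partialSum-suc : ∀ f n → partialSum f (suc n) ≈ partialSum f n + f n
  partialSum-suc f zero    = +-comm _ _
  partialSum-suc f (suc n) = trans (+-congˡ (partialSum-suc (f ∘ suc) n)) (sym (+-assoc _ _ _))

  partialSum-mono : ∀ {f g} n → (∀ i → i ℕ.< n → f i ≤ g i) → partialSum f n ≤ partialSum g n
  partialSum-mono zero    h = ≤-refl
  partialSum-mono (suc n) h = +-mono-≤ (h 0 (s≤s z≤n)) (partialSum-mono n λ i p → h (suc i) (s≤s p))

  partialSum-nonneg : ∀ {f} n → (∀ i → 0# ≤ f i) → 0# ≤ partialSum f n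
  partialSum-nonneg zero    h = ≤-refl
  partialSum-nonneg (suc n) h = 0≤+ (h 0) (partialSum-nonneg n (h ∘ suc))

  partialSum-monoʳ : ∀ {f m n} → (∀ i → 0# ≤ f i) → m ℕ.≤ n → partialSum f m ≤ partialSum f n
  partialSum-monoʳ {n = n} h z≤n = partialSum-nonneg n h
  partialSum-monoʳ h (s≤s p)     = +-monoʳ-≤ _ (partialSum-monoʳ (h ∘ suc) p)

  partialSum-+ : ∀ f g n → partialSum (λ i → f i + g i) n ≈ partialSum f n + partialSum g n
  partialSum-+ f g n = ∑-distrib-+ {n} (f ∘ toℕ) (g ∘ toℕ)

  partialSum-* : ∀ c f n → c * partialSum f n ≈ partialSum (λ i → c * f i) n
  partialSum-* c f n = *-distribˡ-sum {n} c (f ∘ toℕ)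

  term≤partialSum : ∀ {f n} i → (∀ i → 0# ≤ f i) → i ℕ.< n → f i ≤ partialSum f n
  term≤partialSum {f} {suc n} zero h (s≤s p) = x≤x+y _ (partialSum-nonneg n (h ∘ suc))
  term≤partialSum {f} {suc n} (suc i) h (s≤s p) = ≤-trans (term≤partialSum i (h ∘ suc) p) (x≤y+x _ (h 0))

-- Least witnesses and powers of the base

module Least (lem : ∀ {ℓ} → ExcludedMiddle ℓ) where

  least : ∀ {ℓ} (P : Pred ℕ ℓ) n → P n → ∃ λ u → u ℕ.≤ n × P u × (∀ v → v ℕ.< u → ¬ P v)
  least P zero    p = 0 , z≤n , p , λ _ ()
  least P (suc n) p with lem {P = P 0}
  ... | yes p₀ = 0 , z≤n , p₀ , λ _ ()
  ... | no ¬p₀ with least (P ∘ suc) n p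
  ...   | u , u≤n , pu , min = suc u , s≤s u≤n , pu , λ { zero _ → ¬p₀ ; (suc v) (s≤s v<u) → min v v<u }

module Powers (b : ℕ) (2≤b : 2 ℕ.≤ b) where

  b^n+b^n≤b^1+n : ∀ n → b ℕ.^ n ℕ.+ b ℕ.^ n ℕ.≤ b ℕ.^ suc n
  b^n+b^n≤b^1+n n = begin
    b ℕ.^ n ℕ.+ b ℕ.^ n        ≡⟨ ≡.cong (b ℕ.^ n ℕ.+_) (ℕₚ.+-identityʳ (b ℕ.^ n)) ⟨
    2 ℕ.* b ℕ.^ n              ≤⟨ ℕₚ.*-monoˡ-≤ (b ℕ.^ n) 2≤b ⟩
    b ℕ.^ suc n                ∎
    where open ℕₚ.≤-Reasoning

  n<b^n : ∀ n → n ℕ.< b ℕ.^ n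
  n<b^n zero    = s≤s z≤n
  n<b^n (suc n) = begin-strict
    suc n                      <⟨ s≤s (n<b^n n) ⟩
    suc (b ℕ.^ n)              ≤⟨ ℕₚ.+-monoˡ-≤ (b ℕ.^ n) (ℕₚ.≤-trans (s≤s z≤n) (n<b^n n)) ⟩
    b ℕ.^ n ℕ.+ b ℕ.^ n        ≤⟨ b^n+b^n≤b^1+n n ⟩
    b ℕ.^ suc n                ∎
    where open ℕₚ.≤-Reasoning

  b^-mono : ∀ {m n} → m ℕ.≤ n → b ℕ.^ m ℕ.≤ b ℕ.^ n
  b^-mono = ℕₚ.^-monoʳ-≤ b {{ℕ.>-nonZero (ℕₚ.≤-trans (s≤s z≤n) 2≤b)}}

-- Estimates in powers of the base and its reciprocal

module BaseLemmas (lem : ∀ {ℓ} → ExcludedMiddle ℓ) (R : CompleteOrderedField)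
    (b : ℕ) (2≤b : 2 ℕ.≤ b) where

  open Analysis lem R hiding (zero)
  open RealLemmas lem R
  open AnalysisLemmas lem R
  open Powers b 2≤b
  open AddSupOrder _≤_ using ([_]; [≤]-injective)

  B β : ℝ
  B = fromℕ b
  β = B ⁻¹

  0<B : 0# < B
  0<B = <-≤-trans (0<fromℕ 1) (fromℕ-mono-≤ 2≤b)

  1<B : 1# < B
  1<B = <-≤-trans (<-≤-trans (x<x+y 1# 0<1) (+-monoʳ-≤ 1# (≤-reflexive (sym fromℕ-1)))) (fromℕ-mono-≤ 2≤b)

  0<β : 0# < β
  0<β = 0<⁻¹ 0<B

  0≤β : 0# ≤ β
  0≤β = <⇒≤ 0<β

  B*β≈1 : B * β ≈ 1#
  B*β≈1 = ⁻¹-inverseʳ B (>⇒≉ 0<B)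

  β+β≤1 : β + β ≤ 1#
  β+β≤1 = begin
    β + β             ≈⟨ +-cong (*-identityˡ β) (*-identityˡ β) ⟨
    1# * β + 1# * β   ≈⟨ distribʳ β 1# 1# ⟨
    (1# + 1#) * β     ≤⟨ *-monoʳ-≤ 0≤β (≤-trans (+-monoʳ-≤ 1# (≤-reflexive (sym fromℕ-1))) (fromℕ-mono-≤ 2≤b)) ⟩
    B * β             ≈⟨ B*β≈1 ⟩
    1#                ∎
    where open ≤-Reasoning

  β≤1 : β ≤ 1#
  β≤1 = ≤-trans (x≤x+y β 0≤β) β+β≤1

  -- `β` is positive and at most 1/2; it serves wherever a positive but strictly smaller part of a
  -- quantity is wanted.
  x*β<x : ∀ {x} → 0# < x → x * β < x
  x*β<x {x} 0<x = <-≤-trans (x<x+y _ (0<* 0<x 0<β)) (begin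
    x * β + x * β    ≈⟨ distribˡ x β β ⟨
    x * (β + β)      ≤⟨ *-monoˡ-≤ (<⇒≤ 0<x) β+β≤1 ⟩
    x * 1#           ≈⟨ *-identityʳ x ⟩
    x                ∎)
    where open ≤-Reasoning

  ≤+ε⇒≤ : ∀ {u a} → (∀ ε → 0# < ε → u ≤⁺ [ a + ε ]) → u ≤⁺ [ a ]
  ≤+ε⇒≤ {[ x ]} {a} h = [ ≮⇒≥ (λ a<x → <⇒≱ (x*β<x (0<y-x a<x))
    (x-y≤z (≤-respʳ (+-comm _ _) ([≤]-injective (h ((x - a) * β) (0<* (0<y-x a<x) 0<β)))))) ]
  ≤+ε⇒≤ {⊤⁺} h with h 1# 0<1
  ... | ()

  B^*β^≈1 : ∀ n → B ^ n * β ^ n ≈ 1#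
  B^*β^≈1 zero    = *-identityˡ 1#
  B^*β^≈1 (suc n) = trans
    (Solver.solve 4 (λ B β x y → (B :* x) :* (β :* y) := (B :* β) :* (x :* y)) refl B β (B ^ n) (β ^ n))
    (trans (*-cong B*β≈1 (B^*β^≈1 n)) (*-identityˡ 1#))
    where open Solver using (_:*_; _:=_)

  B^-unbounded : ∀ t → ∃ λ n → t < B ^ n
  B^-unbounded t with archimedean t
  ... | n , t≤n = n , ≤-<-trans t≤n (<-≤-trans (fromℕ-mono-< (n<b^n n)) (≤-reflexive (fromℕ-^ b n)))

  β^-small : ∀ {ε} → 0# < ε → ∃ λ n → β ^ n ≤ ε
  β^-small {ε} 0<ε with B^-unbounded (ε ⁻¹)
  ... | n , p = n , (begin
    β ^ n                   ≈⟨ *-identityˡ _ ⟨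
    1# * β ^ n              ≈⟨ *-congʳ (⁻¹-inverseʳ ε (>⇒≉ 0<ε)) ⟨
    ε * ε ⁻¹ * β ^ n        ≤⟨ *-monoʳ-≤ (0≤^ 0≤β n) (*-monoˡ-≤ (<⇒≤ 0<ε) (<⇒≤ p)) ⟩
    ε * B ^ n * β ^ n       ≈⟨ trans (*-assoc _ _ _) (trans (*-congˡ (B^*β^≈1 n)) (*-identityʳ ε)) ⟩
    ε                       ∎)
    where open ≤-Reasoning

  -- The extra `β ^ n` makes the induction close: two copies of `β ^ suc n` fit into it since 2β ≤
  -- 1.
  geometric : ∀ n → partialSum (λ i → β ^ suc i) n + β ^ n ≤ 1#
  geometric zero    = ≤-reflexive (+-identityˡ 1#)
  geometric (suc n) = begin
    partialSum (λ i → β ^ suc i) (suc n) + β ^ suc n                ≈⟨ +-congʳ (partialSum-suc (λ i → β ^ suc i) n) ⟩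
    partialSum (λ i → β ^ suc i) n + β ^ suc n + β ^ suc n          ≈⟨ +-assoc _ _ _ ⟩
    partialSum (λ i → β ^ suc i) n + (β * β ^ n + β * β ^ n)        ≈⟨ +-congˡ (sym (distribʳ _ β β)) ⟩
    partialSum (λ i → β ^ suc i) n + (β + β) * β ^ n                ≤⟨ +-monoʳ-≤ _ (*-monoʳ-≤ (0≤^ 0≤β n) β+β≤1) ⟩
    partialSum (λ i → β ^ suc i) n + 1# * β ^ n                     ≈⟨ +-congˡ (*-identityˡ _) ⟩
    partialSum (λ i → β ^ suc i) n + β ^ n                          ≤⟨ geometric n ⟩
    1#                                                              ∎
    where open ≤-Reasoning

  ∑β^≤1 : ∀ n → partialSum (λ i → β ^ suc i) n ≤ 1#
  ∑β^≤1 n = ≤-trans (x≤x+y (partialSum (λ i → β ^ suc i) n) (0≤^ 0≤β n)) (geometric n)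

-- Upper bound: covers of the unit square by b-adic squares

module UpperBoundOnDimension (lem : ∀ {ℓ} → ExcludedMiddle ℓ) (R : CompleteOrderedField)
    (b : ℕ) (2≤b : 2 ℕ.≤ b) where

  open Analysis lem R hiding (zero)
  open RealLemmas lem R
  open AnalysisLemmas lem R
  open Least lem
  open BaseLemmas lem R b 2≤b
  open Powers b 2≤b
  open AddSupEquality _≈_ using ([_])
  open AddSupOrder _≤_ using ([_]; _≤⊤⁺; ≤⁺-trans; ≤⁺-antisym; [≤]-injective)

  ⨆-nonneg : ∀ {i} {I : Set i} (f : I → ℝ ⁺) → (∀ i → [ 0# ] ≤⁺ f i) → [ 0# ] ≤⁺ ⨆ f
  ⨆-nonneg f h with lem {P = ∃ λ u → ∀ i → f i ≤⁺ [ u ]}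
  ... | yes _ = [ sup-nonneg _ (λ { x (i , e) → [≤]-injective (≤⁺-trans ≤-trans (h i) (≤⁺-refl-≈ e)) }) ]
  ... | no _  = _ ≤⊤⁺

  Cell : ℕ → ℕ → Pred ℝ 0ℓ
  Cell K a x = fromℕ a * β ^ K ≤ x × x ≤ fromℕ (suc a) * β ^ K

  cell-diameter : ∀ K a {x x′} → Cell K a x → Cell K a x′ → x ≤ β ^ K + x′
  cell-diameter K a {x} {x′} (_ , x≤) (≤x′ , _) = begin
    x                                 ≤⟨ x≤ ⟩
    (1# + fromℕ a) * β ^ K            ≈⟨ distribʳ _ _ _ ⟩
    1# * β ^ K + fromℕ a * β ^ K      ≤⟨ +-mono-≤ (≤-reflexive (*-identityˡ _)) ≤x′ ⟩
    β ^ K + x′                        ∎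
    where open ≤-Reasoning

  cells-cover : ∀ K {x} → x ∈ UnitInterval → ∀ {m} → m ≡ b ℕ.^ K → ∃ λ (a : Fin m) → Cell K (toℕ a) x
  cells-cover K {x} (0<x , x≤1) ≡.refl with least (λ u → x ≤ fromℕ (suc u) * β ^ K) (ℕ.pred (b ℕ.^ K)) top
    where
    open ≤-Reasoning
    b^K≢0 = ℕ.>-nonZero (ℕₚ.≤-trans (s≤s z≤n) (n<b^n K))
    top : x ≤ fromℕ (suc (ℕ.pred (b ℕ.^ K))) * β ^ K
    top = begin
      x                                            ≤⟨ x≤1 ⟩
      1#                                           ≈⟨ B^*β^≈1 K ⟨
      B ^ K * β ^ K                                ≈⟨ *-congʳ (fromℕ-^ b K) ⟨
      fromℕ (b ℕ.^ K) * β ^ K                      ≡⟨ ≡.cong (λ n → fromℕ n * β ^ K) (ℕₚ.suc-pred (b ℕ.^ K) {{b^K≢0}}) ⟨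
      fromℕ (suc (ℕ.pred (b ℕ.^ K))) * β ^ K       ∎
  ... | u , u≤ , x≤ , min = fromℕ< u<m , ≡.subst (λ a → Cell K a x) (≡.sym (Finₚ.toℕ-fromℕ< u<m)) (lower u min , x≤)
    where
    b^K≢0 = ℕ.>-nonZero (ℕₚ.≤-trans (s≤s z≤n) (n<b^n K))
    u<m : u ℕ.< b ℕ.^ K
    u<m = ≡.subst (u ℕ.<_) (ℕₚ.suc-pred (b ℕ.^ K) {{b^K≢0}}) (s≤s u≤)
    lower : ∀ u → (∀ v → v ℕ.< u → ¬ (x ≤ fromℕ (suc v) * β ^ K)) → fromℕ u * β ^ K ≤ x
    lower zero    _ = ≤-respˡ (sym (zeroˡ _)) (<⇒≤ 0<x)
    lower (suc u) h = <⇒≤ (≰⇒> (h u ℕₚ.≤-refl))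

  partialSum-bounded : ∀ {f w} m n → 0# ≤ w → (∀ i → f i ≤ w) → (∀ i → m ℕ.≤ i → f i ≤ 0#) →
                       partialSum f n ≤ fromℕ m * w
  partialSum-bounded m zero 0≤w h h₀ = *-nonneg (0≤fromℕ m) 0≤w
  partialSum-bounded zero (suc n) 0≤w h h₀ = ≤-trans
    (+-mono-≤ (h₀ 0 z≤n) (partialSum-bounded zero n 0≤w (h ∘ suc) (λ i _ → h₀ (suc i) z≤n)))
    (≤-reflexive (+-identityˡ _))
  partialSum-bounded {f} {w} (suc m) (suc n) 0≤w h h₀ = ≤-trans
    (+-mono-≤ (h 0) (partialSum-bounded m n 0≤w (h ∘ suc) (λ i p → h₀ (suc i) (s≤s p))))
    (≤-reflexive (sym (trans (distribʳ w 1# (fromℕ m)) (+-congʳ (*-identityˡ w)))))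

  UnitSquare : Pred ℝ² 0ℓ
  UnitSquare (x , y) = x ∈ UnitInterval × y ∈ UnitInterval

  module _ {ℓ} {E : Pred ℝ² ℓ} (E⊆square : E ⊆ UnitSquare) {s : ℝ} (q : ℕ)
           (s-large : fromℕ (suc (suc q ℕ.+ suc q)) ≤ fromℕ (suc q) * s) where

    private
      p : ℕ
      p = suc (suc q ℕ.+ suc q)

      -- The multiple of q+1 makes the diameter bound a (q+1)-th power of `β ^ j`, as `^ʳ-least`
      -- requires; the extra level absorbs the factor 2 of `dist-≤`.
      depth : ℕ → ℕ
      depth j = suc (suc q ℕ.* j)

    private
      0≤⨆ : ∀ (U : ℕ → Pred ℝ² 0ℓ) → [ 0# ] ≤⁺ ⨆ λ n → [ partialSum (λ i → diamPower s (U i)) n ]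
      0≤⨆ U = ⨆-nonneg _ λ n → [ partialSum-nonneg n (λ i → 0≤diamPower s (U i)) ]

    module _ (j m : ℕ) (m≡b^K : m ≡ b ℕ.^ depth j) where

      K : ℕ
      K = depth j

      -- A finite cover in the form of a sequence: from index `m * m` on the sets are empty, and
      -- their `diamPower` is 0.
      Square : ℕ → Pred ℝ² 0ℓ
      Square i (x , y) = ∃ λ (k : Fin (m ℕ.* m)) → toℕ k ≡ i ×
        Cell K (toℕ (proj₁ (remQuot {m} m k))) x × Cell K (toℕ (proj₂ (remQuot {m} m k))) y

      diameter : ∀ i → DiamAtMost ((β ^ j) ^ suc q) (Square i)
      diameter i (x , y) (x′ , y′) (k , k≡i , cx , cy) (k′ , k′≡i , cx′ , cy′)
        with ≡.refl ← Finₚ.toℕ-injective (≡.trans k≡i (≡.sym k′≡i)) = begin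
          dist (x , y) (x′ , y′)        ≤⟨ dist-≤ (0≤^ 0≤β K) (cell-diameter K a cx cx′) (cell-diameter K a cx′ cx)
                                                (cell-diameter K c cy cy′) (cell-diameter K c cy′ cy) ⟩
          β ^ K + β ^ K                 ≈⟨ distribʳ (β ^ (suc q ℕ.* j)) β β ⟨
          (β + β) * β ^ (suc q ℕ.* j)   ≤⟨ *-monoʳ-≤ (0≤^ 0≤β (suc q ℕ.* j)) β+β≤1 ⟩
          1# * β ^ (suc q ℕ.* j)        ≈⟨ *-identityˡ _ ⟩
          β ^ (suc q ℕ.* j)             ≡⟨ ≡.cong (β ^_) (ℕₚ.*-comm (suc q) j) ⟩
          β ^ (j ℕ.* suc q)             ≈⟨ ^-assocʳ β j (suc q) ⟨
          (β ^ j) ^ suc q               ∎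
          where
          open ≤-Reasoning
          a = toℕ (proj₁ (remQuot {m} m k))
          c = toℕ (proj₂ (remQuot {m} m k))

      covers : ∀ {z} → z ∈ E → ∃ λ i → z ∈ Square i
      covers {x , y} z∈E with E⊆square z∈E
      ... | x∈I , y∈I with cells-cover K x∈I m≡b^K | cells-cover K y∈I m≡b^K
      ... | a , ca | c , cc = toℕ k , k , ≡.refl ,
            ≡.subst (λ r → Cell K (toℕ (proj₁ r)) x) (≡.sym (Finₚ.remQuot-combine {m} {m} a c)) ca ,
            ≡.subst (λ r → Cell K (toℕ (proj₂ r)) y) (≡.sym (Finₚ.remQuot-combine {m} {m} a c)) cc
        where
        k = combine {m} {m} a c

      diamPower-≤ : ∀ i → diamPower s (Square i) ≤ (β ^ j) ^ p
      diamPower-≤ i with lem {P = ∃ (Square i)}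
      ... | yes _ = ^ʳ-least p q (0≤diam _) (0≤^ 0≤β j) (^-≤1 0≤β β≤1 j)
                      (diam≤ (0≤^ (0≤^ 0≤β j) (suc q)) (diameter i)) s-large
      ... | no _  = 0≤^ (0≤^ 0≤β j) p

      diamPower-empty : ∀ i → m ℕ.* m ℕ.≤ i → diamPower s (Square i) ≤ 0#
      diamPower-empty i mm≤i with lem {P = ∃ (Square i)}
      ... | yes (_ , k , ≡.refl , _) = ⊥-elim (ℕₚ.<⇒≱ (Finₚ.toℕ<n k) mm≤i)
      ... | no _  = ≤-refl

      -- There are b^(2K) squares, each contributing at most β^(jp) with p = 2(q+1) + 1. The
      -- exponents cancel up to the one `β ^ j` that the excess of s over 2 leaves, and `B ^ 2` pays
      -- for the extra level of `depth`.
      total-bound : fromℕ (m ℕ.* m) * (β ^ j) ^ p ≈ B ^ 2 * β ^ j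
      total-bound = begin-equality
        fromℕ (m ℕ.* m) * (β ^ j) ^ p         ≈⟨ *-cong (trans (fromℕ-* m m) (*-cong fromℕ-m fromℕ-m)) (^-assocʳ β j p) ⟩
        (B ^ K * B ^ K) * β ^ (j ℕ.* p)       ≈⟨ *-congʳ (^-homo-* B K K) ⟨
        B ^ (K ℕ.+ K) * β ^ (j ℕ.* p)         ≡⟨ ≡.cong₂ (λ u v → B ^ u * β ^ v) e₁ e₂ ⟩
        B ^ (2 ℕ.+ t) * β ^ (t ℕ.+ j)         ≈⟨ *-cong (^-homo-* B 2 t) (^-homo-* β t j) ⟩
        (B ^ 2 * B ^ t) * (β ^ t * β ^ j)     ≈⟨ Solver.solve 4 (λ x y z w → (x :* y) :* (z :* w) := (y :* z) :* (x :* w)) refl (B ^ 2) (B ^ t) (β ^ t) (β ^ j) ⟩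
        (B ^ t * β ^ t) * (B ^ 2 * β ^ j)     ≈⟨ trans (*-congʳ (B^*β^≈1 t)) (*-identityˡ _) ⟩
        B ^ 2 * β ^ j                         ∎
        where
        open ≤-Reasoning
        open Solver using (_:*_; _:=_)
        t = suc q ℕ.* j ℕ.+ suc q ℕ.* j
        fromℕ-m : fromℕ m ≈ B ^ K
        fromℕ-m = trans (reflexive (≡.cong fromℕ m≡b^K)) (fromℕ-^ b K)
        e₁ : K ℕ.+ K ≡ 2 ℕ.+ t
        e₁ = ≡.cong suc (ℕₚ.+-suc (suc q ℕ.* j) (suc q ℕ.* j))
        e₂ : j ℕ.* p ≡ t ℕ.+ j
        e₂ = +-*-Solver.solve 2 (λ j q → j S.:* (S.con 1 S.:+ (q S.:+ q)) S.:= (q S.:* j S.:+ q S.:* j) S.:+ j) ≡.refl j (suc q)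
          where module S = +-*-Solver

      total-≤ : ∀ n → partialSum (λ i → diamPower s (Square i)) n ≤ B ^ 2 * β ^ j
      total-≤ n = ≤-trans (partialSum-bounded (m ℕ.* m) n (0≤^ (0≤^ 0≤β j) p) diamPower-≤ diamPower-empty)
                          (≤-reflexive total-bound)

      ℋδ≤ : ∀ {δ ε} → (β ^ j) ^ suc q ≤ δ → B ^ 2 * β ^ j ≤ ε → 0# ≤ ε → ℋδ s δ E ≤⁺ [ ε ]
      ℋδ≤ diameter≤δ total≤ε 0≤ε = ⨅-lower _ (λ (U , _) → 0≤⨆ U)
        (Square , covers , λ i z w z∈ w∈ → ≤-trans (diameter i z w z∈ w∈) diameter≤δ)
        (⨆-least _ 0≤ε λ n → [ ≤-trans (total-≤ n) total≤ε ])

    ℋδ≤ε : ∀ {δ} → 0# < δ → ∀ ε → 0# < ε → ℋδ s δ E ≤⁺ [ ε ]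
    ℋδ≤ε {δ} 0<δ ε 0<ε = ℋδ≤ j (b ℕ.^ depth j) ≡.refl β^j≤δ B²β^j≤ε (<⇒≤ 0<ε)
      where
      open ≤-Reasoning
      small₁ = β^-small 0<δ
      small₂ = β^-small (0<* (0<^ 0<β 2) 0<ε)
      j₁ = proj₁ small₁
      j₂ = proj₁ small₂
      j = j₁ ℕ.+ j₂
      β^j≤δ : (β ^ j) ^ suc q ≤ δ
      β^j≤δ = begin
        β ^ j * (β ^ j) ^ q   ≤⟨ *-monoˡ-≤ (0≤^ 0≤β j) (^-≤1 (0≤^ 0≤β j) (^-≤1 0≤β β≤1 j) q) ⟩
        β ^ j * 1#            ≈⟨ *-identityʳ _ ⟩
        β ^ j                 ≤⟨ ^-antitoneʳ 0≤β β≤1 (ℕₚ.m≤m+n j₁ j₂) ⟩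
        β ^ j₁                ≤⟨ proj₂ small₁ ⟩
        δ                     ∎
      B²β^j≤ε : B ^ 2 * β ^ j ≤ ε
      B²β^j≤ε = begin
        B ^ 2 * β ^ j         ≤⟨ *-monoˡ-≤ (0≤^ (<⇒≤ 0<B) 2) (≤-trans (^-antitoneʳ 0≤β β≤1 (ℕₚ.m≤n+m j₂ j₁)) (proj₂ small₂)) ⟩
        B ^ 2 * (β ^ 2 * ε)   ≈⟨ *-assoc _ _ _ ⟨
        B ^ 2 * β ^ 2 * ε     ≈⟨ trans (*-congʳ (B^*β^≈1 2)) (*-identityˡ ε) ⟩
        ε                     ∎

    ℋ≈0 : ℋ s E ≈⁺ [ 0# ]
    ℋ≈0 = ≤⁺-antisym antisym
      (⨆-least _ ≤-refl λ (δ , 0<δ) → ≤+ε⇒≤ λ ε 0<ε → ≤⁺-trans ≤-trans (ℋδ≤ε 0<δ ε 0<ε) [ x≤y+x ε ≤-refl ])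
      (⨆-nonneg _ λ (δ , _) → ⨅-greatest _ λ (U , _) → 0≤⨆ U)

-- Free digits and the avoidance of light cylinders

module Counting where

  private
    isFree : ∀ {a} {A : Set a} → Maybe A → ℕ
    isFree nothing  = 1
    isFree (just _) = 0

  -- β to this count is the uniform measure of a cylinder of depth n among the sequences that obey
  -- the template.
  free : ∀ {a} {A : Set a} → (ℕ → Maybe A) → ℕ → ℕ
  free template zero    = 0
  free template (suc n) = isFree (template n) ℕ.+ free template n

  module _ {a} {A : Set a} (template : ℕ → Maybe A) where

    free-mono : ∀ {m n} → m ℕ.≤ n → free template m ℕ.≤ free template n
    free-mono {n = zero}  z≤n = z≤n
    free-mono {m} {suc n} m≤1+n with ℕₚ.m≤n⇒m<n∨m≡n m≤1+n
    ... | inj₁ (s≤s m≤n) = ℕₚ.≤-trans (free-mono m≤n) (ℕₚ.m≤n+m _ (isFree (template n)))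
    ... | inj₂ ≡.refl    = ℕₚ.≤-refl

    free-nothing : ∀ n → template n ≡ nothing → free template (suc n) ≡ suc (free template n)
    free-nothing n eq = ≡.cong (λ m → isFree m ℕ.+ free template n) eq

    free-just : ∀ n {c} → template n ≡ just c → free template (suc n) ≡ free template n
    free-just n eq = ≡.cong (λ m → isFree m ℕ.+ free template n) eq

module Avoidance (lem : ∀ {ℓ} → ExcludedMiddle ℓ) (R : CompleteOrderedField)
    (b : ℕ) (2≤b : 2 ℕ.≤ b) where

  open Analysis lem R hiding (zero)
  open RealLemmas lem R
  open AnalysisLemmas lem R
  open BaseLemmas lem R b 2≤b
  open Counting
  open SumProperties semiring using (∑-comm)

  sum-≤-const : ∀ n {f : Fin n → ℝ} {x} → (∀ i → f i ≤ x) → sum {n} f ≤ fromℕ n * x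
  sum-≤-const zero    h = ≤-reflexive (sym (zeroˡ _))
  sum-≤-const (suc n) h = ≤-trans (+-mono-≤ (h Fin.zero) (sum-≤-const n (h ∘ Fin.suc)))
    (≤-reflexive (sym (trans (distribʳ _ _ _) (+-congʳ (*-identityˡ _)))))

  const-≤-sum : ∀ n {f : Fin n → ℝ} {x} → (∀ i → x ≤ f i) → fromℕ n * x ≤ sum {n} f
  const-≤-sum zero    h = ≤-reflexive (zeroˡ _)
  const-≤-sum (suc n) h = ≤-trans (≤-reflexive (trans (distribʳ _ _ _) (+-congʳ (*-identityˡ _))))
    (+-mono-≤ (h Fin.zero) (const-≤-sum n (h ∘ Fin.suc)))

  const-<-sum : ∀ n {f : Fin n → ℝ} {x} → 0 ℕ.< n → (∀ i → x < f i) → fromℕ n * x < sum {n} f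
  const-<-sum (suc n) {f} {x} _ h = ≤-<-trans
    (≤-trans (≤-reflexive (trans (distribʳ _ _ _) (+-congʳ (*-identityˡ _))))
             (+-monoʳ-≤ x (const-≤-sum n (<⇒≤ ∘ h ∘ Fin.suc))))
    (+-monoˡ-< _ (h Fin.zero))

  sum-single : ∀ n {f : Fin n → ℝ} {x} c → 0# ≤ x → f c ≤ x → (∀ i → i ≢ c → f i ≤ 0#) → sum {n} f ≤ x
  sum-single (suc n) Fin.zero 0≤x fc≤x h = ≤-trans
    (+-mono-≤ fc≤x (≤-trans (sum-≤-const n (λ i → h (Fin.suc i) λ ())) (≤-reflexive (zeroʳ _))))
    (≤-reflexive (+-identityʳ _))
  sum-single (suc n) (Fin.suc c) 0≤x fc≤x h = ≤-trans
    (+-mono-≤ (h Fin.zero λ ()) (sum-single n c 0≤x fc≤x (λ i i≢c → h (Fin.suc i) (i≢c ∘ Finₚ.suc-injective))))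
    (≤-reflexive (+-identityˡ _))

  upper-bound : ∀ n (f : Fin n → ℕ) → ∃ λ N → ∀ i → f i ℕ.≤ N
  upper-bound zero    f = 0 , λ ()
  upper-bound (suc n) f with upper-bound n (f ∘ Fin.suc)
  ... | N , h = f Fin.zero ℕ.+ N , λ { Fin.zero → ℕₚ.m≤m+n _ N ; (Fin.suc i) → ℕₚ.≤-trans (h i) (ℕₚ.m≤n+m N _) }

  private
    abstract
      w : Set → ℕ → ℝ
      w A e = if does (lem {P = A}) then β ^ e else 0#

      w-yes : ∀ {A} e → A → w A e ≈ β ^ e
      w-yes {A} e a with lem {P = A}
      ... | yes _ = refl
      ... | no ¬a = ⊥-elim (¬a a)

      w-no : ∀ {A} e → ¬ A → w A e ≤ 0#
      w-no {A} e ¬a with lem {P = A}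
      ... | yes a = ⊥-elim (¬a a)
      ... | no _  = ≤-refl

      w-≤ : ∀ A e → w A e ≤ β ^ e
      w-≤ A e with lem {P = A}
      ... | yes _ = ≤-refl
      ... | no _  = 0≤^ 0≤β e

      0≤w : ∀ A e → 0# ≤ w A e
      0≤w A e with lem {P = A}
      ... | yes _ = 0≤^ 0≤β e
      ... | no _  = ≤-refl

      w-mono : ∀ {A A′ e e′} → (A → A′) → e′ ≡ e → w A e ≤ w A′ e′
      w-mono {A} {A′} {e} f ≡.refl with lem {P = A}
      ... | yes a = ≤-reflexive (sym (w-yes e (f a)))
      ... | no _  = 0≤w A′ e

  module _ (template : ℕ → Maybe (Fin b)) (k : ℕ → ℕ) (σ : ℕ → ℕ → Fin b) (t : ℝ) (t<1 : t < 1#)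
           (small : ∀ N → partialSum (λ i → β ^ free template (k i)) N ≤ t) where

    private
      F : ℕ → ℕ
      F = free template

      next : Pred ℕ 0ℓ → ℕ → Fin b → Pred ℕ 0ℓ
      next A n c i = A i × (n ℕ.< k i → σ i n ≡ c)

      -- The probability that a random completion of the n digits chosen so
      -- far lies in cylinder i; A i says that they agree with word i.
      weight : ℕ → Pred ℕ 0ℓ → ℕ → ℝ
      weight n A i = w (A i) (F (k i) ℕ.∸ F n)

      Good : ℕ → Pred ℕ 0ℓ → Set
      Good n A = ∀ N → partialSum (weight n A) N ≤ t

      -- While word `i` is being read, only the branch `σ i n` survives, and it gains a factor b =
      -- 1/β because one free digit fewer lies ahead. For a word that is dead or read to its end no
      -- branch increases the weight: truncated subtraction keeps the exponent at 0 after the end.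
      average : ∀ n A i → template n ≡ nothing →
                sum {b} (λ c → weight (suc n) (next A n c) i) ≤ B * weight n A i
      average n A i eq with lem {P = n ℕ.< k i × A i}
      ... | yes (n<k , a) = sum-single b (σ i n) (*-nonneg (<⇒≤ 0<B) (0≤w _ _))
              (begin
                w (next A n (σ i n) i) e                    ≤⟨ w-≤ _ e ⟩
                β ^ e                                       ≈⟨ trans (sym (*-identityˡ (β ^ e))) (*-congʳ (sym B*β≈1)) ⟩
                B * β * β ^ e                               ≈⟨ *-assoc _ _ _ ⟩
                B * β ^ suc e                               ≡⟨ ≡.cong (λ x → B * β ^ x) suc-e ⟩
                B * β ^ (F (k i) ℕ.∸ F n)                   ≈⟨ *-congˡ (w-yes _ a) ⟨
                B * weight n A i                            ∎)
              λ c c≢σ → w-no _ λ { (_ , h) → c≢σ (≡.sym (h n<k)) }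
        where
        open ≤-Reasoning
        e = F (k i) ℕ.∸ F (suc n)
        suc-e : suc e ≡ F (k i) ℕ.∸ F n
        suc-e = ≡.trans (≡.sym (ℕₚ.+-∸-assoc 1 (free-mono template n<k)))
                        (≡.cong (suc (F (k i)) ℕ.∸_) (free-nothing template n eq))
      ... | no ¬p = sum-≤-const b λ c → term c
        where
        term : ∀ c → weight (suc n) (next A n c) i ≤ weight n A i
        term c with lem {P = A i}
        ... | no ¬a = ≤-trans (w-no _ (¬a ∘ proj₁)) (0≤w _ _)
        ... | yes a = w-mono proj₁ (≡.trans (ℕₚ.m≤n⇒m∸n≡0 (free-mono template k≤n))
                        (≡.sym (ℕₚ.m≤n⇒m∸n≡0 (free-mono template (ℕₚ.m≤n⇒m≤1+n k≤n)))))
          where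
          k≤n : k i ℕ.≤ n
          k≤n = ℕₚ.≮⇒≥ λ n<k → ¬p (n<k , a)

      free-step : ∀ n A → Good n A → template n ≡ nothing → ∃ λ c → Good (suc n) (next A n c)
      free-step n A good eq with lem {P = ∃ λ c → Good (suc n) (next A n c)}
      ... | yes p = p
      ... | no ¬p = ⊥-elim (<⇒≱ (const-<-sum b (ℕₚ.≤-trans (s≤s z≤n) 2≤b) exceeds) (begin
              sum {b} (λ c → partialSum (weight (suc n) (next A n c)) N)
                ≈⟨ ∑-comm {b} {N} (λ c i → weight (suc n) (next A n c) (toℕ i)) ⟩
              partialSum (λ i → sum {b} (λ c → weight (suc n) (next A n c) i)) N
                ≤⟨ partialSum-mono {λ i → sum {b} (λ c → weight (suc n) (next A n c) i)} {λ i → B * weight n A i} N (λ i _ → average n A i eq) ⟩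
              partialSum (λ i → B * weight n A i) N
                ≈⟨ partialSum-* B (weight n A) N ⟨
              B * partialSum (weight n A) N
                ≤⟨ *-monoˡ-≤ (<⇒≤ 0<B) (good N) ⟩
              B * t ∎))
        where
        open ≤-Reasoning
        fails : ∀ c → ∃ λ N → ¬ (partialSum (weight (suc n) (next A n c)) N ≤ t)
        fails c with lem {P = ∃ λ N → ¬ (partialSum (weight (suc n) (next A n c)) N ≤ t)}
        ... | yes q = q
        ... | no ¬q = ⊥-elim (¬p (c , λ N → ≮⇒≥ λ t<s → ¬q (N , <⇒≱ t<s)))
        -- Each digit fails at a horizon of its own; the sums grow with the horizon, so the finitely
        -- many horizons can be replaced by a common bound before adding over the digits.
        N : ℕ
        N = proj₁ (upper-bound b (proj₁ ∘ fails))
        exceeds : ∀ c → t < partialSum (weight (suc n) (next A n c)) N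
        exceeds c = <-≤-trans (≰⇒> (proj₂ (fails c)))
          (partialSum-monoʳ {weight (suc n) (next A n c)} (λ i → 0≤w _ _) (proj₂ (upper-bound b (proj₁ ∘ fails)) c))

      Step : ℕ → Pred ℕ 0ℓ → Set
      Step n A = ∃ λ c → (∀ c′ → template n ≡ just c′ → c ≡ c′) × Good (suc n) (next A n c)

      step : ∀ n A → Good n A → ∀ m → template n ≡ m → Step n A
      step n A good nothing eq =
        let c , good′ = free-step n A good eq in
        c , (λ c′ eq′ → case≡ (≡.trans (≡.sym eq) eq′)) , good′
        where
        case≡ : ∀ {c c′ : Fin b} → nothing ≡ just c′ → c ≡ c′
        case≡ ()
      -- A forced digit never increases a weight: words that disagree die, and the others keep the
      -- same number of free digits ahead.
      step n A good (just c) eq =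
        c , (λ c′ eq′ → just-inj (≡.trans (≡.sym eq) eq′)) ,
        λ N → ≤-trans (partialSum-mono {weight (suc n) (next A n c)} {weight n A} N λ i _ →
                w-mono proj₁ (≡.cong (F (k i) ℕ.∸_) (≡.sym (free-just template n eq)))) (good N)
        where
        just-inj : ∀ {c c′ : Fin b} → just c ≡ just c′ → c ≡ c′
        just-inj ≡.refl = ≡.refl

      mutual
        alive : ℕ → Pred ℕ 0ℓ
        alive zero    = λ _ → ⊤
        alive (suc n) = next (alive n) n (proj₁ (choice n))

        good : ∀ n → Good n (alive n)
        good zero    N = ≤-trans (partialSum-mono {weight 0 (alive 0)} {λ i → β ^ F (k i)} N λ i _ → w-≤ _ _) (small N)
        good (suc n)   = proj₂ (proj₂ (choice n))

        choice : ∀ n → Step n (alive n)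
        choice n = step n (alive n) (good n) (template n) ≡.refl

      z : ℕ → Fin b
      z n = proj₁ (choice n)

      survives : ∀ i → (∀ j → j ℕ.< k i → z j ≡ σ i j) → ∀ n → alive n i
      survives i h zero    = tt
      survives i h (suc n) = survives i h n , λ n<k → ≡.sym (h n n<k)

    -- A word that `z` follows to its end would have weight `β ^ 0` at stage `k i`, that is 1,
    -- against the bound t < 1 that all choices preserve.
    avoid : ∃ λ z → (∀ n c → template n ≡ just c → z n ≡ c) × (∀ i → ¬ (∀ j → j ℕ.< k i → z j ≡ σ i j))
    avoid = z , (λ n → proj₁ (proj₂ (choice n))) , λ i h → <⇒≱ t<1 (begin
        1#                                             ≡⟨ ≡.cong (β ^_) (ℕₚ.n∸n≡0 (F (k i))) ⟨
        β ^ (F (k i) ℕ.∸ F (k i))                      ≈⟨ w-yes _ (survives i h (k i)) ⟨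
        weight (k i) (alive (k i)) i                   ≤⟨ term≤partialSum {weight (k i) (alive (k i))} i (λ j → 0≤w _ _) ℕₚ.≤-refl ⟩
        partialSum (weight (k i) (alive (k i))) (suc i) ≤⟨ good (k i) (suc i) ⟩
        t                                              ∎)
      where open ≤-Reasoning

-- Digit prefixes as integers

module Prefixes {b : ℕ} where

  prefix : (ℕ → Fin b) → ℕ → ℕ
  prefix d zero    = 0
  prefix d (suc n) = b ℕ.* prefix d n ℕ.+ toℕ (d n)

  prefix-extend-≤ : ∀ d n m → suc (prefix d (m ℕ.+ n)) ℕ.≤ b ℕ.^ m ℕ.* suc (prefix d n)
  prefix-extend-≤ d n zero    = ℕₚ.m≤m+n _ 0
  prefix-extend-≤ d n (suc m) = begin
    suc (b ℕ.* prefix d (m ℕ.+ n) ℕ.+ toℕ (d (m ℕ.+ n)))  ≡⟨ ℕₚ.+-suc _ _ ⟨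
    b ℕ.* prefix d (m ℕ.+ n) ℕ.+ suc (toℕ (d (m ℕ.+ n)))  ≤⟨ ℕₚ.+-monoʳ-≤ _ (Finₚ.toℕ<n (d (m ℕ.+ n))) ⟩
    b ℕ.* prefix d (m ℕ.+ n) ℕ.+ b                        ≡⟨ ℕₚ.+-comm _ b ⟩
    b ℕ.+ b ℕ.* prefix d (m ℕ.+ n)                        ≡⟨ ℕₚ.*-suc b (prefix d (m ℕ.+ n)) ⟨
    b ℕ.* suc (prefix d (m ℕ.+ n))                        ≤⟨ ℕₚ.*-monoʳ-≤ b (prefix-extend-≤ d n m) ⟩
    b ℕ.* (b ℕ.^ m ℕ.* suc (prefix d n))                  ≡⟨ ℕₚ.*-assoc b (b ℕ.^ m) _ ⟨
    b ℕ.^ suc m ℕ.* suc (prefix d n)                      ∎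
    where open ℕₚ.≤-Reasoning

  private
    step : ∀ u v x y → suc u ℕ.≤ v → suc x ℕ.≤ b ℕ.+ y → suc (b ℕ.* u ℕ.+ x) ℕ.≤ b ℕ.* v ℕ.+ y
    step u v x y u<v x<b+y = begin
      suc (b ℕ.* u ℕ.+ x)     ≡⟨ ℕₚ.+-suc _ x ⟨
      b ℕ.* u ℕ.+ suc x       ≤⟨ ℕₚ.+-monoʳ-≤ (b ℕ.* u) x<b+y ⟩
      b ℕ.* u ℕ.+ (b ℕ.+ y)   ≡⟨ ℕₚ.+-assoc (b ℕ.* u) b y ⟨
      b ℕ.* u ℕ.+ b ℕ.+ y     ≡⟨ ≡.cong (ℕ._+ y) (≡.trans (ℕₚ.+-comm (b ℕ.* u) b) (≡.sym (ℕₚ.*-suc b u))) ⟩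
      b ℕ.* suc u ℕ.+ y       ≤⟨ ℕₚ.+-monoˡ-≤ y (ℕₚ.*-monoʳ-≤ b u<v) ⟩
      b ℕ.* v ℕ.+ y           ∎
      where open ℕₚ.≤-Reasoning

  prefix-agree : ∀ d d′ n → (∀ i → i ℕ.< n → d i ≡ d′ i) → prefix d n ≡ prefix d′ n
  prefix-agree d d′ zero    h = ≡.refl
  prefix-agree d d′ (suc n) h = ≡.cong₂ (λ u v → b ℕ.* u ℕ.+ toℕ v)
    (prefix-agree d d′ n (λ i i<n → h i (ℕₚ.m≤n⇒m≤1+n i<n))) (h n ℕₚ.≤-refl)

  module _ {d d′ : ℕ → Fin b} {m : ℕ} (agree : ∀ i → i ℕ.< m → d i ≡ d′ i) (d<d′ : toℕ (d m) ℕ.< toℕ (d′ m)) where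

    -- The gap 1 may persist for ever: the digits 0, b-1, b-1, ... against 1, 0, 0, ... have
    -- adjacent prefixes throughout. A first difference alone thus does not separate the values.
    prefix-< : ∀ {n} → m ℕ.< n → suc (prefix d n) ℕ.≤ prefix d′ n
    prefix-< {suc n} (s≤s m≤n) with ℕₚ.m≤n⇒m<n∨m≡n m≤n
    ... | inj₁ m<n    = step (prefix d n) (prefix d′ n) (toℕ (d n)) (toℕ (d′ n)) (prefix-< m<n)
                             (ℕₚ.≤-trans (Finₚ.toℕ<n (d n)) (ℕₚ.m≤m+n b _))
    ... | inj₂ ≡.refl = ≡.subst (λ x → suc (b ℕ.* x ℕ.+ toℕ (d n)) ℕ.≤ b ℕ.* prefix d′ n ℕ.+ toℕ (d′ n))
                          (≡.sym (prefix-agree d d′ n agree))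
                          (ℕₚ.≤-trans (ℕₚ.≤-reflexive (≡.sym (ℕₚ.+-suc (b ℕ.* prefix d′ n) _))) (ℕₚ.+-monoʳ-≤ (b ℕ.* prefix d′ n) d<d′))

    -- After the first difference the prefixes stay at least 1 apart, and a
    -- common digit multiplies the difference by b.
    prefix-gap : 2 ℕ.≤ b → ∀ p → m ℕ.< p → d p ≡ d′ p → 2 ℕ.+ prefix d (suc p) ℕ.≤ prefix d′ (suc p)
    prefix-gap 2≤b p m<p eq rewrite eq = begin
      2 ℕ.+ (b ℕ.* prefix d p ℕ.+ toℕ (d′ p))    ≤⟨ ℕₚ.+-monoˡ-≤ _ 2≤b ⟩
      b ℕ.+ (b ℕ.* prefix d p ℕ.+ toℕ (d′ p))    ≡⟨ ℕₚ.+-assoc b _ _ ⟨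
      b ℕ.+ b ℕ.* prefix d p ℕ.+ toℕ (d′ p)      ≡⟨ ≡.cong (ℕ._+ toℕ (d′ p)) (ℕₚ.*-suc b (prefix d p)) ⟨
      b ℕ.* suc (prefix d p) ℕ.+ toℕ (d′ p)      ≤⟨ ℕₚ.+-monoˡ-≤ _ (ℕₚ.*-monoʳ-≤ b (prefix-< m<p)) ⟩
      b ℕ.* prefix d′ p ℕ.+ toℕ (d′ p)           ∎
      where open ℕₚ.≤-Reasoning

-- Values of digit sequences and their separation

module Expansions (lem : ∀ {ℓ} → ExcludedMiddle ℓ) (R : CompleteOrderedField)
    (b : ℕ) (2≤b : 2 ℕ.≤ b) where

  open Analysis lem R hiding (zero)
  open RealLemmas lem R
  open AnalysisLemmas lem R
  open BaseLemmas lem R b 2≤b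
  open Least lem
  open Prefixes {b}

  module _ (d : ℕ → Fin b) where

    term : ℕ → ℝ
    term i = fromℕ (toℕ (d i)) * β ^ suc i

    partialSum≈prefix : ∀ n → partialSum term n ≈ fromℕ (prefix d n) * β ^ n
    partialSum≈prefix zero    = sym (zeroˡ 1#)
    partialSum≈prefix (suc n) = begin-equality
      partialSum term (suc n)                                        ≈⟨ partialSum-suc term n ⟩
      partialSum term n + x * β ^ suc n                              ≈⟨ +-congʳ (partialSum≈prefix n) ⟩
      X * β ^ n + x * β ^ suc n                                      ≈⟨ +-congʳ (*-congʳ (*-identityˡ X)) ⟨
      1# * X * β ^ n + x * β ^ suc n                                 ≈⟨ +-congʳ (*-congʳ (*-congʳ B*β≈1)) ⟨
      B * β * X * β ^ n + x * (β * β ^ n)                            ≈⟨ Solver.solve 5 (λ B β X y x → B :* β :* X :* y :+ x :* (β :* y) := (B :* X :+ x) :* (β :* y)) refl B β X (β ^ n) x ⟩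
      (B * X + x) * β ^ suc n                                        ≈⟨ *-congʳ (trans (fromℕ-+ (b ℕ.* prefix d n) (toℕ (d n))) (+-congʳ (fromℕ-* b (prefix d n)))) ⟨
      fromℕ (prefix d (suc n)) * β ^ suc n                           ∎
      where
      open ≤-Reasoning
      open Solver using (_:+_; _:*_; _:=_)
      x = fromℕ (toℕ (d n))
      X = fromℕ (prefix d n)

    0≤term : ∀ i → 0# ≤ term i
    0≤term i = *-nonneg (0≤fromℕ (toℕ (d i))) (0≤^ 0≤β (suc i))

    -- Passing to `k + n` digits yields an extension of the prefix of length `n`, whatever the order
    -- of `k` and `n`.
    partialSum-upper : ∀ n k → partialSum term k ≤ fromℕ (suc (prefix d n)) * β ^ n
    partialSum-upper n k = ≤-trans (partialSum-monoʳ 0≤term (ℕₚ.m≤m+n k n)) (begin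
      partialSum term (k ℕ.+ n)                                       ≈⟨ partialSum≈prefix (k ℕ.+ n) ⟩
      fromℕ (prefix d (k ℕ.+ n)) * β ^ (k ℕ.+ n)                      ≤⟨ *-monoʳ-≤ (0≤^ 0≤β (k ℕ.+ n)) (fromℕ-mono-≤ (ℕₚ.≤-trans (ℕₚ.n≤1+n _) (prefix-extend-≤ d n k))) ⟩
      fromℕ (b ℕ.^ k ℕ.* suc (prefix d n)) * β ^ (k ℕ.+ n)            ≈⟨ *-cong (trans (fromℕ-* (b ℕ.^ k) (suc (prefix d n))) (*-congʳ (fromℕ-^ b k))) (^-homo-* β k n) ⟩
      (B ^ k * Y) * (β ^ k * β ^ n)                                   ≈⟨ Solver.solve 4 (λ x y z u → (x :* y) :* (z :* u) := (x :* z) :* (y :* u)) refl (B ^ k) Y (β ^ k) (β ^ n) ⟩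
      (B ^ k * β ^ k) * (Y * β ^ n)                                   ≈⟨ trans (*-congʳ (B^*β^≈1 k)) (*-identityˡ _) ⟩
      Y * β ^ n                                                       ∎)
      where
      open ≤-Reasoning
      open Solver using (_:+_; _:*_; _:=_)
      Y = fromℕ (suc (prefix d n))

    value : ℝ
    value = sup λ r → ∃ λ n → r ≈ partialSum term n

    partialSum≤value : ∀ n → partialSum term n ≤ value
    partialSum≤value n = sup-upper _ {fromℕ (suc (prefix d 0)) * β ^ 0}
      (λ { r (k , e) → ≤-respˡ (sym e) (partialSum-upper 0 k) }) _ (n , refl)

    prefix≤value : ∀ n → fromℕ (prefix d n) * β ^ n ≤ value
    prefix≤value n = ≤-respˡ (partialSum≈prefix n) (partialSum≤value n)

    value≤prefix : ∀ n → value ≤ fromℕ (suc (prefix d n)) * β ^ n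
    value≤prefix n = sup-least _ (*-nonneg (0≤fromℕ (suc (prefix d n))) (0≤^ 0≤β n))
      λ { r (k , e) → ≤-respˡ (sym e) (partialSum-upper n k) }

    value≤partialSum+β^ : ∀ n → value ≤ β ^ n + partialSum term n
    value≤partialSum+β^ n = begin
      value                                            ≤⟨ value≤prefix n ⟩
      (1# + fromℕ (prefix d n)) * β ^ n                ≈⟨ distribʳ _ _ _ ⟩
      1# * β ^ n + fromℕ (prefix d n) * β ^ n          ≈⟨ +-cong (*-identityˡ _) (sym (partialSum≈prefix n)) ⟩
      β ^ n + partialSum term n                        ∎
      where open ≤-Reasoning

    converges : TendsTo (partialSum term) [ value ]
    -- Asking for `ε * β` instead of `ε` provides the strict inequality of `TendsTo`.
    converges ε 0<ε = let N , β^N≤ = β^-small (0<* 0<ε 0<β) in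
      N , λ n N≤n →
        x-y<z (≤-<-trans (partialSum≤value n) (<-≤-trans (x<x+y value 0<ε) (≤-reflexive (+-comm value ε)))) ,
        x-y<z (≤-<-trans (value≤partialSum+β^ n) (+-monoˡ-< _
          (≤-<-trans (≤-trans (^-antitoneʳ 0≤β β≤1 N≤n) β^N≤) (x*β<x 0<ε))))

    module _ (nonterminating : ∀ N → ∃ λ n → N ℕ.≤ n × toℕ (d n) ≢ 0) where

      isExpansion : IsExpansion b value d
      isExpansion = nonterminating , converges

      value∈UnitInterval : value ∈ UnitInterval
      value∈UnitInterval = 0<value , ≤-trans (value≤prefix 0) (≤-reflexive (trans (*-identityʳ _) fromℕ-1))
        where
        n = proj₁ (nonterminating 0)
        0<d : 0 ℕ.< toℕ (d n)
        0<d = ℕₚ.n≢0⇒n>0 (proj₂ (proj₂ (nonterminating 0)))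
        0<value : 0# < value
        0<value = <-≤-trans (0<* (fromℕ-mono-< {0} 0<d) (0<^ 0<β (suc n)))
          (≤-trans (term≤partialSum n 0≤term ℕₚ.≤-refl) (partialSum≤value (suc n)))

  module _ (L : ℕ) {d d′ : ℕ → Fin b} (common : ∀ m → ∃ λ p → m ℕ.< p × p ℕ.≤ m ℕ.+ L × d p ≡ d′ p) where

    private
      -- After a common digit the prefixes are 2 apart. One unit may be used up by the tail of `d`;
      -- the other remains as `β ^ suc p`.
      gap : ∀ {m} → (∀ i → i ℕ.< m → d i ≡ d′ i) → toℕ (d m) ℕ.< toℕ (d′ m) →
            ∃ λ p → p ℕ.≤ m ℕ.+ L × β ^ suc p ≤ value d′ - value d
      gap {m} agree d<d′ = let p , m<p , p≤m+L , eq = common m in p , p≤m+L ,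
        +-cancelʳ-≤ (value d) (≤-respʳ (sym (x-y+y≈x (value d′) (value d))) (begin
          β ^ suc p + value d                                                ≤⟨ +-mono-≤ (≤-reflexive (sym (*-identityˡ _))) (value≤prefix d (suc p)) ⟩
          1# * β ^ suc p + fromℕ (suc (prefix d (suc p))) * β ^ suc p        ≈⟨ distribʳ _ _ _ ⟨
          fromℕ (2 ℕ.+ prefix d (suc p)) * β ^ suc p                         ≤⟨ *-monoʳ-≤ (0≤^ 0≤β (suc p)) (fromℕ-mono-≤ (prefix-gap agree d<d′ 2≤b p m<p eq)) ⟩
          fromℕ (prefix d′ (suc p)) * β ^ suc p                              ≤⟨ prefix≤value d′ (suc p) ⟩
          value d′                                                           ∎))
        where open ≤-Reasoning

    first-difference : ∀ {m} → (∀ i → i ℕ.< m → d i ≡ d′ i) → toℕ (d m) ℕ.< toℕ (d′ m) →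
                       β ^ suc (m ℕ.+ L) ≤ value d′ - value d
    first-difference agree d<d′ = let p , p≤ , h = gap agree d<d′ in
      ≤-trans (^-antitoneʳ 0≤β β≤1 (s≤s p≤)) h

  -- The two one-sided bounds stand for an absolute value; which of them is contradicted depends on
  -- which sequence has the larger digit at the first difference.
  separated : ∀ L {d d′ : ℕ → Fin b} → (∀ m → ∃ λ p → m ℕ.< p × p ℕ.≤ m ℕ.+ L × d p ≡ d′ p) →
              ∀ {k} → value d - value d′ < β ^ k → value d′ - value d < β ^ k →
              ∀ i → i ℕ.+ L ℕ.< k → d i ≡ d′ i
  separated L {d} {d′} common {k} h h′ i i+L<k with d i Finₚ.≟ d′ i
  ... | yes p = p
  ... | no i-bad with least (λ i → d i ≢ d′ i) i i-bad
  ... | m , m≤i , bad , min with ℕₚ.<-cmp (toℕ (d m)) (toℕ (d′ m))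
  ... | tri< lt _ _ = ⊥-elim (<⇒≱ h′ (≤-trans (^-antitoneʳ 0≤β β≤1 (ℕₚ.≤-trans (s≤s (ℕₚ.+-monoˡ-≤ L m≤i)) i+L<k))
                        (first-difference L common (λ j j<m → decidable-stable (d j Finₚ.≟ d′ j) (min j j<m)) lt)))
  ... | tri≈ _ eq _ = ⊥-elim (bad (Finₚ.toℕ-injective eq))
  ... | tri> _ _ gt = ⊥-elim (<⇒≱ h (≤-trans (^-antitoneʳ 0≤β β≤1 (ℕₚ.≤-trans (s≤s (ℕₚ.+-monoˡ-≤ L m≤i)) i+L<k))
                        (first-difference L (λ m → let p , a , b , e = common m in p , a , b , ≡.sym e)
                          (λ j j<m → ≡.sym (decidable-stable (d j Finₚ.≟ d′ j) (min j j<m))) gt)))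

-- Residues in windows and interleaved sequences

module Residues where

  open import Data.Nat.Base using (_+_; _<_)

  residue : ∀ L .{{_ : NonZero L}} {r} → r < L → ∀ a → ∃ λ e → e < L × (a + e) % L ≡ r
  residue L {r} r<L zero = r , r<L , m<n⇒m%n≡m r<L
  residue L@(suc L′) r<L (suc a) with residue L r<L a
  ... | suc e , e<L , eq = e , ℕₚ.<-trans ℕₚ.≤-refl e<L , ≡.trans (≡.cong (_% L) (≡.sym (ℕₚ.+-suc a e))) eq
  ... | zero  , e<L , eq = L′ , ℕₚ.≤-refl , ≡.trans (≡.cong (_% L) (≡.sym (ℕₚ.+-suc a L′)))
          (≡.trans ([m+n]%n≡m%n a L) (≡.trans (≡.cong (_% L) (≡.sym (ℕₚ.+-identityʳ a))) eq))

module Doubling where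

  -- Defined by recursion rather than as `k + k`, so that `interleave` computes two steps at once on
  -- `double (suc k)`.
  double : ℕ → ℕ
  double zero    = zero
  double (suc k) = suc (suc (double k))

  double≡ : ∀ k → double k ≡ k ℕ.+ k
  double≡ zero    = ≡.refl
  double≡ (suc k) = ≡.cong suc (≡.trans (≡.cong suc (double≡ k)) (≡.sym (ℕₚ.+-suc k k)))

  half : ∀ n → ∃ λ k → n ≡ double k ⊎ n ≡ suc (double k)
  half zero = 0 , inj₁ ≡.refl
  half (suc n) with half n
  ... | k , inj₁ eq = k , inj₂ (≡.cong suc eq)
  ... | k , inj₂ eq = suc k , inj₁ (≡.cong suc eq)

  double-cancel-< : ∀ {m n} → double m ℕ.< double n → m ℕ.< n
  double-cancel-< {zero}  {suc n} _ = s≤s z≤n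
  double-cancel-< {suc m} {suc n} (s≤s (s≤s p)) = s≤s (double-cancel-< p)

  interleave : ∀ {a} {A : Set a} → (ℕ → A) → (ℕ → A) → ℕ → A
  interleave f g zero    = f 0
  interleave f g (suc n) = interleave g (f ∘ suc) n

  interleave-even : ∀ {a} {A : Set a} (f g : ℕ → A) k → interleave f g (double k) ≡ f k
  interleave-even f g zero    = ≡.refl
  interleave-even f g (suc k) = interleave-even (f ∘ suc) (g ∘ suc) k

  interleave-odd : ∀ {a} {A : Set a} (f g : ℕ → A) k → interleave f g (suc (double k)) ≡ g k
  interleave-odd f g k = interleave-even g (f ∘ suc) k

-- Counting positions and densities

module Counts (lem : ∀ {ℓ} → ExcludedMiddle ℓ) where

  open import Data.Nat.Base using (_+_; _*_; _≤_; _<_)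
  open Counting
  open Doubling
  open ℕₚ.≤-Reasoning

  count : (ℕ → Set) → ℕ → ℕ
  count P zero    = 0
  count P (suc n) = (if does (lem {P = P n}) then 1 else 0) + count P n

  module _ {P : ℕ → Set} where

    count-yes : ∀ {n} → P n → count P (suc n) ≡ suc (count P n)
    count-yes {n} p with lem {P = P n}
    ... | yes _ = ≡.refl
    ... | no ¬p = ⊥-elim (¬p p)

    count-no : ∀ {n} → ¬ P n → count P (suc n) ≡ count P n
    count-no {n} ¬p with lem {P = P n}
    ... | yes p = ⊥-elim (¬p p)
    ... | no _  = ≡.refl

    count-suc-≤ : ∀ n → count P (suc n) ≤ suc (count P n)
    count-suc-≤ n with lem {P = P n}
    ... | yes _ = ℕₚ.≤-refl
    ... | no _  = ℕₚ.n≤1+n _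

    count-suc-≥ : ∀ n → count P n ≤ count P (suc n)
    count-suc-≥ n = ℕₚ.m≤n+m _ _

    count-+ : ∀ a m → count P (m + a) ≤ m + count P a
    count-+ a zero    = ℕₚ.≤-refl
    count-+ a (suc m) = ℕₚ.≤-trans (count-suc-≤ (m + a)) (s≤s (count-+ a m))

    count-none : ∀ a m → (∀ i → a ≤ i → i < m + a → ¬ P i) → count P (m + a) ≡ count P a
    count-none a zero    h = ≡.refl
    count-none a (suc m) h = ≡.trans (count-no (h (m + a) (ℕₚ.m≤n+m a m) ℕₚ.≤-refl))
      (count-none a m λ i a≤i i<m → h i a≤i (ℕₚ.m≤n⇒m≤1+n i<m))

    count-window : ∀ a ℓ m → (∀ i → ℓ + a ≤ i → i < m + a → ¬ P i) → count P (m + a) ≤ ℓ + count P a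
    count-window a ℓ m h with ℕₚ.≤-total m ℓ
    ... | inj₁ m≤ℓ = ℕₚ.≤-trans (count-+ a m) (ℕₚ.+-monoˡ-≤ _ m≤ℓ)
    ... | inj₂ ℓ≤m = begin
      count P (m + a)                    ≡⟨ ≡.cong (count P) split ⟩
      count P ((m ℕ.∸ ℓ) + (ℓ + a))      ≡⟨ count-none (ℓ + a) (m ℕ.∸ ℓ) (λ i p q → h i p (≡.subst (i <_) (≡.sym split) q)) ⟩
      count P (ℓ + a)                    ≤⟨ count-+ a ℓ ⟩
      ℓ + count P a                      ∎
      where
      split : m + a ≡ (m ℕ.∸ ℓ) + (ℓ + a)
      split = ≡.trans (≡.cong (_+ a) (≡.sym (ℕₚ.m∸n+n≡m ℓ≤m))) (ℕₚ.+-assoc (m ℕ.∸ ℓ) ℓ a)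

  count-⊆-∪ : ∀ {P Q S : ℕ → Set} → (∀ n → P n → Q n ⊎ S n) → ∀ n → count P n ≤ count Q n + count S n
  count-⊆-∪ {P} {Q} {S} h zero = z≤n
  count-⊆-∪ {P} {Q} {S} h (suc n) = by-cases (lem {P = P n})
    where
    by-cases : Dec (P n) → count P (suc n) ≤ count Q (suc n) + count S (suc n)
    by-cases (no ¬p) = begin
      count P (suc n)                        ≡⟨ count-no {P} ¬p ⟩
      count P n                              ≤⟨ count-⊆-∪ h n ⟩
      count Q n + count S n                  ≤⟨ ℕₚ.+-mono-≤ (count-suc-≥ n) (count-suc-≥ n) ⟩
      count Q (suc n) + count S (suc n)      ∎
    by-cases (yes p) with h n p
    ... | inj₁ q = begin
      count P (suc n)                        ≤⟨ count-suc-≤ n ⟩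
      suc (count P n)                        ≤⟨ s≤s (count-⊆-∪ h n) ⟩
      suc (count Q n) + count S n            ≡⟨ ≡.cong (_+ count S n) (count-yes {Q} q) ⟨
      count Q (suc n) + count S n            ≤⟨ ℕₚ.+-monoʳ-≤ (count Q (suc n)) (count-suc-≥ n) ⟩
      count Q (suc n) + count S (suc n)      ∎
    ... | inj₂ s = begin
      count P (suc n)                        ≤⟨ count-suc-≤ n ⟩
      suc (count P n)                        ≤⟨ s≤s (count-⊆-∪ h n) ⟩
      suc (count Q n + count S n)            ≡⟨ ℕₚ.+-suc (count Q n) (count S n) ⟨
      count Q n + suc (count S n)            ≡⟨ ≡.cong (count Q n +_) (count-yes {S} s) ⟨
      count Q n + count S (suc n)            ≤⟨ ℕₚ.+-monoˡ-≤ (count S (suc n)) (count-suc-≥ n) ⟩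
      count Q (suc n) + count S (suc n)      ∎

  -- The count is compared with the quotient of `k + e` by `L`; the shift e = L-1-c makes this
  -- quotient step up exactly when a number of residue `c` is passed.
  count-residue : ∀ L .{{_ : NonZero L}} {c} → c < L → ∀ k → L * count (λ n → n % L ≡ c) k ≤ k + L
  count-residue L {c} c<L k = begin
    L * count P k        ≤⟨ ℕₚ.*-monoʳ-≤ L (bound k) ⟩
    L * ((k + e) / L)    ≡⟨ ℕₚ.*-comm L _ ⟩
    (k + e) / L * L      ≤⟨ m/n*n≤m (k + e) L ⟩
    k + e                ≤⟨ ℕₚ.+-monoʳ-≤ k (ℕₚ.m∸n≤m L (suc c)) ⟩
    k + L                ∎
    where
    P : ℕ → Set
    P n = n % L ≡ c
    e : ℕ
    e = L ℕ.∸ suc c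
    bound : ∀ k → count P k ≤ (k + e) / L
    bound zero = z≤n
    bound (suc k) = by-cases (k % L ℕₚ.≟ c)
      where
      by-cases : Dec (P k) → count P (suc k) ≤ (suc k + e) / L
      by-cases (no ¬p) = begin
        count P (suc k)      ≡⟨ count-no {P} ¬p ⟩
        count P k            ≤⟨ bound k ⟩
        (k + e) / L          ≤⟨ /-monoˡ-≤ L (ℕₚ.n≤1+n (k + e)) ⟩
        (suc k + e) / L      ∎
      by-cases (yes p) = begin
        count P (suc k)      ≡⟨ count-yes {P} p ⟩
        suc (count P k)      ≤⟨ s≤s (bound k) ⟩
        suc ((k + e) / L)    ≤⟨ m<n*o⇒m/o<n {k + e} {suc t} {L} (ℕₚ.≤-reflexive eq) ⟩
        suc t                ≡⟨ m*n/n≡m (suc t) L ⟨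
        suc t * L / L        ≡⟨ ≡.cong (_/ L) eq ⟨
        (suc k + e) / L      ∎
        where
        t : ℕ
        t = k / L
        eq : suc k + e ≡ suc t * L
        eq = begin-equality
          suc k + e              ≡⟨ ≡.cong (λ x → suc x + e) (m≡m%n+[m/n]*n k L) ⟩
          suc (k % L + t * L) + e ≡⟨ ≡.cong (λ x → suc (x + t * L) + e) p ⟩
          suc (c + t * L) + e    ≡⟨ +-*-Solver.solve 3 (λ c x e → con 1 :+ (c :+ x) :+ e := (con 1 :+ c :+ e) :+ x) ≡.refl c (t * L) e ⟩
          (suc c + e) + t * L    ≡⟨ ≡.cong (_+ t * L) (ℕₚ.m+[n∸m]≡n c<L) ⟩
          suc t * L              ∎
          where open +-*-Solver using (con; _:+_; _:=_)

  count-residue-below : ∀ L .{{_ : NonZero L}} m → m ≤ L → ∀ k → L * count (λ n → n % L < m) k ≤ m * (k + L)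
  count-residue-below L zero    _   k = ℕₚ.≤-reflexive (≡.trans (≡.cong (L *_) (none k)) (ℕₚ.*-zeroʳ L))
    where
    none : ∀ k → count (λ n → n % L < 0) k ≡ 0
    none zero    = ≡.refl
    none (suc k) = ≡.trans (count-no {λ n → n % L < 0} λ ()) (none k)
  count-residue-below L (suc m) m<L k = begin
    L * count (λ n → n % L < suc m) k                                      ≤⟨ ℕₚ.*-monoʳ-≤ L (count-⊆-∪ (λ n p → split n p) k) ⟩
    L * (count (λ n → n % L ≡ m) k + count (λ n → n % L < m) k)            ≡⟨ ℕₚ.*-distribˡ-+ L _ _ ⟩
    L * count (λ n → n % L ≡ m) k + L * count (λ n → n % L < m) k          ≤⟨ ℕₚ.+-mono-≤ (count-residue L m<L k) (count-residue-below L m (ℕₚ.<⇒≤ m<L) k) ⟩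
    suc m * (k + L)                                                        ∎
    where
    split : ∀ n → n % L < suc m → n % L ≡ m ⊎ n % L < m
    split n (s≤s p) with ℕₚ.m≤n⇒m<n∨m≡n p
    ... | inj₁ lt = inj₂ lt
    ... | inj₂ eq = inj₁ eq

  module _ {a} {A : Set a} where

    free+count : ∀ (t : ℕ → Maybe A) {P Q : ℕ → Set} → (∀ n → t n ≡ nothing ⊎ P n ⊎ Q n) →
                 ∀ n → n ≤ free t n + (count P n + count Q n)
    free+count t {P} {Q} h zero = z≤n
    free+count t {P} {Q} h (suc n) = by-cases (h n)
      where
      f = free t n
      c = count P n
      d = count Q n
      ih : n ≤ f + (c + d)
      ih = free+count t h n
      by-cases : t n ≡ nothing ⊎ P n ⊎ Q n → suc n ≤ free t (suc n) + (count P (suc n) + count Q (suc n))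
      by-cases (inj₁ eq) = begin
        suc n                                ≤⟨ s≤s ih ⟩
        suc f + (c + d)                      ≡⟨ ≡.cong (_+ (c + d)) (free-nothing t n eq) ⟨
        free t (suc n) + (c + d)             ≤⟨ ℕₚ.+-monoʳ-≤ (free t (suc n)) (ℕₚ.+-mono-≤ (count-suc-≥ n) (count-suc-≥ n)) ⟩
        free t (suc n) + (count P (suc n) + count Q (suc n)) ∎
      by-cases (inj₂ (inj₁ p)) = begin
        suc n                                ≤⟨ s≤s ih ⟩
        suc (f + (c + d))                    ≡⟨ ℕₚ.+-suc f (c + d) ⟨
        f + (suc c + d)                      ≡⟨ ≡.cong (λ x → f + (x + d)) (count-yes {P} p) ⟨
        f + (count P (suc n) + d)            ≤⟨ ℕₚ.+-mono-≤ (free-mono t (ℕₚ.n≤1+n n)) (ℕₚ.+-monoʳ-≤ (count P (suc n)) (count-suc-≥ n)) ⟩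
        free t (suc n) + (count P (suc n) + count Q (suc n)) ∎
      by-cases (inj₂ (inj₂ q)) = begin
        suc n                                ≤⟨ s≤s ih ⟩
        suc (f + (c + d))                    ≡⟨ ≡.trans (≡.cong (f +_) (ℕₚ.+-suc c d)) (ℕₚ.+-suc f (c + d)) ⟨
        f + (c + suc d)                      ≡⟨ ≡.cong (λ x → f + (c + x)) (count-yes {Q} q) ⟨
        f + (c + count Q (suc n))            ≤⟨ ℕₚ.+-mono-≤ (free-mono t (ℕₚ.n≤1+n n)) (ℕₚ.+-monoˡ-≤ (count Q (suc n)) (count-suc-≥ n)) ⟩
        free t (suc n) + (count P (suc n) + count Q (suc n)) ∎

    private
      one : Maybe A → ℕ
      one m = free (λ _ → m) 1

      free-suc : ∀ (t : ℕ → Maybe A) n → free t (suc n) ≡ one (t n) + free t n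
      free-suc t n with t n
      ... | nothing = ≡.refl
      ... | just _  = ≡.refl

    free-interleave : ∀ (t u : ℕ → Maybe A) k → free (interleave t u) (double k) ≡ free t k + free u k
    free-interleave t u zero    = ≡.refl
    free-interleave t u (suc k) = begin-equality
      free v (double (suc k))                                    ≡⟨ ≡.trans (free-suc v (suc (double k))) (≡.cong (one (v (suc (double k))) +_) (free-suc v (double k))) ⟩
      one (v (suc (double k))) + (one (v (double k)) + free v (double k))
        ≡⟨ ≡.cong₂ (λ x y → one x + (one y + free v (double k))) (interleave-odd t u k) (interleave-even t u k) ⟩
      one (u k) + (one (t k) + free v (double k))                ≡⟨ ≡.cong (λ x → one (u k) + (one (t k) + x)) (free-interleave t u k) ⟩
      one (u k) + (one (t k) + (free t k + free u k))            ≡⟨ +-*-Solver.solve 4 (λ a b c d → a :+ (b :+ (c :+ d)) := (b :+ c) :+ (a :+ d)) ≡.refl (one (u k)) (one (t k)) (free t k) (free u k) ⟩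
      (one (t k) + free t k) + (one (u k) + free u k)            ≡⟨ ≡.cong₂ _+_ (free-suc t k) (free-suc u k) ⟨
      free t (suc k) + free u (suc k)                            ∎
      where
      open +-*-Solver using (_:+_; _:=_)
      v = interleave t u

-- Templates for x and y: density of free digits and bounds on matches

module Templates (lem : ∀ {ℓ} → ExcludedMiddle ℓ) (b : ℕ) (2≤b : 2 ℕ.≤ b)
    (M L : ℕ) .{{_ : NonZero M}} .{{_ : NonZero L}} (L≡ : L ≡ M ℕ.* suc M)
    (ℓ : ℕ → ℕ) (ℓ-mono : ∀ {m n} → m ℕ.≤ n → ℓ m ℕ.≤ ℓ n)
    (k₀ : ℕ) (sparse : ∀ k → k₀ ℕ.≤ k → 2 ℕ.* M ℕ.* (ℓ k ℕ.+ (L ℕ.+ L)) ℕ.≤ b ℕ.^ k) where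

  open import Data.Nat.Base using (_+_; _*_; _≤_; _<_; _^_)
  open Powers b 2≤b
  open Least lem
  open Counting
  open Doubling
  open Residues
  open Counts lem

  private
    0<M : 0 < M
    0<M = ℕ.>-nonZero⁻¹ M

  M<L : M < L
  M<L = begin-strict
    M                <⟨ ℕₚ.m<m+n M (ℕₚ.*-mono-< 0<M 0<M) ⟩
    M + M * M        ≡⟨ ℕₚ.*-suc M M ⟨
    M * suc M        ≡⟨ L≡ ⟨
    L                ∎
    where open ℕₚ.≤-Reasoning

  Run : ℕ → Set
  Run i = ∃ λ k → k₀ ≤ k × b ^ k ≤ i × i < ℓ k + b ^ k

  ℓ+W≤b^k : ∀ {k} → k₀ ≤ k → ℓ k + (L + L) ≤ b ^ k
  ℓ+W≤b^k {k} k₀≤k = ℕₚ.≤-trans (ℕₚ.m≤n*m _ (2 * M) {{ℕₚ.m*n≢0 2 M}}) (sparse k k₀≤k)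

  -- The room `L + L` behind each run holds an alignment to period `L` followed by one to period
  -- `M`; it also keeps supplying ones for non-termination.
  run-end : ∀ {k} → k₀ ≤ k → (L + L) + (ℓ k + b ^ k) ≤ b ^ suc k
  run-end {k} k₀≤k = begin
    (L + L) + (ℓ k + b ^ k)    ≡⟨ +-*-Solver.solve 3 (λ x y z → x :+ (y :+ z) := (y :+ x) :+ z) ≡.refl (L + L) (ℓ k) (b ^ k) ⟩
    (ℓ k + (L + L)) + b ^ k    ≤⟨ ℕₚ.+-monoˡ-≤ (b ^ k) (ℓ+W≤b^k k₀≤k) ⟩
    b ^ k + b ^ k              ≤⟨ b^n+b^n≤b^1+n k ⟩
    b ^ suc k                  ∎
    where
    open ℕₚ.≤-Reasoning
    open +-*-Solver using (_:+_; _:=_)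

  run-gap : ∀ {k i} → ℓ k + b ^ k ≤ i → i < b ^ suc k → ¬ Run i
  run-gap {k} {i} end≤i i<next (k′ , k₀≤k′ , start≤ , <end) with ℕₚ.<-cmp k′ k
  ... | tri< k′<k _ _ = ℕₚ.<-irrefl ≡.refl (begin-strict
          i                  <⟨ <end ⟩
          ℓ k′ + b ^ k′      ≤⟨ ℕₚ.≤-trans (ℕₚ.m≤n+m _ (L + L)) (run-end k₀≤k′) ⟩
          b ^ suc k′         ≤⟨ b^-mono k′<k ⟩
          b ^ k              ≤⟨ ℕₚ.≤-trans (ℕₚ.m≤n+m (b ^ k) (ℓ k)) end≤i ⟩
          i                  ∎)
    where open ℕₚ.≤-Reasoning
  ... | tri≈ _ ≡.refl _ = ℕₚ.<⇒≱ <end end≤i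
  ... | tri> _ _ k<k′ = ℕₚ.<⇒≱ i<next (ℕₚ.≤-trans (b^-mono k<k′) start≤)

  0F 1F : Fin b
  0F = fromℕ< (ℕₚ.≤-trans (s≤s z≤n) 2≤b)
  1F = fromℕ< 2≤b

  toℕ-1F : toℕ 1F ≡ 1
  toℕ-1F = Finₚ.toℕ-fromℕ< 2≤b

  0F≢1F : 0F ≢ 1F
  0F≢1F eq = ℕₚ.0≢1+n (≡.trans (≡.sym (Finₚ.toℕ-fromℕ< _)) (≡.trans (≡.cong toℕ eq) toℕ-1F))

  -- Outside the runs, x contains 0^M at every multiple of L, followed by a
  -- 1 that keeps its expansion non-terminating, whereas a 1 at every multiple
  -- of M keeps 0^M out of y.
  tX tY : ℕ → Maybe (Fin b)
  tX n with lem {P = Run n} | n % L ℕₚ.<? M | n % L ℕₚ.≟ M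
  ... | yes _ | _     | _     = just 0F
  ... | no _  | yes _ | _     = just 0F
  ... | no _  | no _  | yes _ = just 1F
  ... | no _  | no _  | no _  = nothing
  tY n with lem {P = Run n} | n % M ℕₚ.≟ 0
  ... | yes _ | _     = just 0F
  ... | no _  | yes _ = just 1F
  ... | no _  | no _  = nothing

  tX-run : ∀ {n} → Run n → tX n ≡ just 0F
  tX-run {n} r with lem {P = Run n} | n % L ℕₚ.<? M | n % L ℕₚ.≟ M
  ... | yes _ | _     | _     = ≡.refl
  ... | no ¬r | _     | _     = ⊥-elim (¬r r)

  tX-zero : ∀ {n} → n % L < M → tX n ≡ just 0F
  tX-zero {n} p with lem {P = Run n} | n % L ℕₚ.<? M | n % L ℕₚ.≟ M
  ... | yes _ | _     | _     = ≡.refl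
  ... | no _  | yes _ | _     = ≡.refl
  ... | no _  | no ¬p | _     = ⊥-elim (¬p p)

  tX-one : ∀ {n} → ¬ Run n → n % L ≡ M → tX n ≡ just 1F
  tX-one {n} ¬r p with lem {P = Run n} | n % L ℕₚ.<? M | n % L ℕₚ.≟ M
  ... | yes r | _     | _     = ⊥-elim (¬r r)
  ... | no _  | yes q | _     = ⊥-elim (ℕₚ.<⇒≢ q p)
  ... | no _  | no _  | yes _ = ≡.refl
  ... | no _  | no _  | no ¬p = ⊥-elim (¬p p)

  tX-fixed : ∀ {n} → n % L ≡ M → ∃ λ c → tX n ≡ just c
  tX-fixed {n} p = by-cases lem
    where
    by-cases : Dec (Run n) → ∃ λ c → tX n ≡ just c
    by-cases (yes r) = 0F , tX-run r
    by-cases (no ¬r) = 1F , tX-one ¬r p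

  tX-free : ∀ n → tX n ≡ nothing ⊎ Run n ⊎ n % L < suc M
  tX-free n with lem {P = Run n} | n % L ℕₚ.<? M | n % L ℕₚ.≟ M
  ... | yes r | _     | _     = inj₂ (inj₁ r)
  ... | no _  | yes p | _     = inj₂ (inj₂ (ℕₚ.m≤n⇒m≤1+n p))
  ... | no _  | no _  | yes p = inj₂ (inj₂ (s≤s (ℕₚ.≤-reflexive p)))
  ... | no _  | no _  | no _  = inj₁ ≡.refl

  tY-run : ∀ {n} → Run n → tY n ≡ just 0F
  tY-run {n} r with lem {P = Run n} | n % M ℕₚ.≟ 0
  ... | yes _ | _     = ≡.refl
  ... | no ¬r | _     = ⊥-elim (¬r r)

  tY-one : ∀ {n} → ¬ Run n → n % M ≡ 0 → tY n ≡ just 1F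
  tY-one {n} ¬r p with lem {P = Run n} | n % M ℕₚ.≟ 0
  ... | yes r | _     = ⊥-elim (¬r r)
  ... | no _  | yes _ = ≡.refl
  ... | no _  | no ¬p = ⊥-elim (¬p p)

  tY-fixed : ∀ {n} → n % M ≡ 0 → ∃ λ c → tY n ≡ just c
  tY-fixed {n} p = by-cases lem
    where
    by-cases : Dec (Run n) → ∃ λ c → tY n ≡ just c
    by-cases (yes r) = 0F , tY-run r
    by-cases (no ¬r) = 1F , tY-one ¬r p

  tY-free : ∀ n → tY n ≡ nothing ⊎ Run n ⊎ n % M ≡ 0
  tY-free n with lem {P = Run n} | n % M ℕₚ.≟ 0
  ... | yes r | _     = inj₂ (inj₁ r)
  ... | no _  | yes p = inj₂ (inj₂ p)
  ... | no _  | no _  = inj₁ ≡.refl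

  log-floor : ∀ {n} → 0 < n → ∃ λ K → b ^ K ≤ n × n < b ^ suc K
  log-floor {n} 0<n with least (λ K → n < b ^ suc K) n (ℕₚ.<-≤-trans (n<b^n n) (b^-mono (ℕₚ.n≤1+n n)))
  ... | zero  , _ , p , _   = 0 , 0<n , p
  ... | suc K , _ , p , min = suc K , ℕₚ.≮⇒≥ (min K ℕₚ.≤-refl) , p

  private
    no-early-run : ∀ i → i < b ^ k₀ → ¬ Run i
    no-early-run i i< (k , k₀≤k , start≤ , _) = ℕₚ.<⇒≱ i< (ℕₚ.≤-trans (b^-mono k₀≤k) start≤)

    count-early : ∀ n → n ≤ b ^ k₀ → count Run n ≡ 0
    count-early zero    _ = ≡.refl
    count-early (suc n) p = ≡.trans (count-no {Run} (no-early-run n p)) (count-early n (ℕₚ.<⇒≤ p))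

    count-from-power : ∀ {k n} → k₀ ≤ k → b ^ k ≤ n → n ≤ b ^ suc k → count Run n ≤ ℓ k + count Run (b ^ k)
    count-from-power {k} {n} k₀≤k b^k≤n n≤ = ≡.subst (λ x → count Run x ≤ ℓ k + count Run (b ^ k)) split
      (count-window (b ^ k) (ℓ k) (n ℕ.∸ b ^ k)
        λ i p q → run-gap p (ℕₚ.<-≤-trans (≡.subst (i <_) split q) n≤))
      where
      split : (n ℕ.∸ b ^ k) + b ^ k ≡ n
      split = ℕₚ.m∸n+n≡m b^k≤n

    sparse′ : ∀ {k} → k₀ ≤ k → 2 * M * ℓ k ≤ b ^ k
    sparse′ {k} k₀≤k = ℕₚ.≤-trans (ℕₚ.*-monoʳ-≤ (2 * M) (ℕₚ.m≤m+n (ℓ k) (L + L))) (sparse k k₀≤k)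

    -- One copy of `b ^ k` pays for the newest run and another for all earlier ones; b ≥ 2 makes
    -- room for both below `b ^ suc k`.
    count-at-power : ∀ e → 2 * M * count Run (b ^ (e + k₀)) ≤ b ^ (e + k₀)
    count-at-power zero    = ℕₚ.≤-trans (ℕₚ.≤-reflexive (≡.trans (≡.cong (2 * M *_) (count-early (b ^ k₀) ℕₚ.≤-refl)) (ℕₚ.*-zeroʳ (2 * M)))) z≤n
    count-at-power (suc e) = begin
      2 * M * count Run (b ^ suc k)               ≤⟨ ℕₚ.*-monoʳ-≤ (2 * M) (count-from-power k₀≤k (b^-mono (ℕₚ.n≤1+n k)) ℕₚ.≤-refl) ⟩
      2 * M * (ℓ k + count Run (b ^ k))           ≡⟨ ℕₚ.*-distribˡ-+ (2 * M) (ℓ k) _ ⟩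
      2 * M * ℓ k + 2 * M * count Run (b ^ k)     ≤⟨ ℕₚ.+-mono-≤ (sparse′ k₀≤k) (count-at-power e) ⟩
      b ^ k + b ^ k                               ≤⟨ b^n+b^n≤b^1+n k ⟩
      b ^ suc k                                   ∎
      where
      open ℕₚ.≤-Reasoning
      k = e + k₀
      k₀≤k : k₀ ≤ k
      k₀≤k = ℕₚ.m≤n+m k₀ e

  -- Just behind a run, `n` may be hardly larger than `b ^ K`, so the newest run and the older ones
  -- are each charged a full `n`. The factor 2 in `sparse` makes up for this.
  count-run : ∀ n → M * count Run n ≤ n
  count-run n with ℕₚ.≤-total n (b ^ k₀)
  ... | inj₁ n≤ = ℕₚ.≤-trans (ℕₚ.≤-reflexive (≡.trans (≡.cong (M *_) (count-early n n≤)) (ℕₚ.*-zeroʳ M))) z≤n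
  ... | inj₂ b^k₀≤n with log-floor (ℕₚ.<-≤-trans (ℕₚ.≤-<-trans z≤n (n<b^n k₀)) b^k₀≤n)
  ...   | K , b^K≤n , n< = ℕₚ.*-cancelˡ-≤ 2 (begin
    2 * (M * count Run n)                       ≡⟨ ℕₚ.*-assoc 2 M _ ⟨
    2 * M * count Run n                         ≤⟨ ℕₚ.*-monoʳ-≤ (2 * M) (count-from-power k₀≤K b^K≤n (ℕₚ.<⇒≤ n<)) ⟩
    2 * M * (ℓ K + count Run (b ^ K))           ≡⟨ ℕₚ.*-distribˡ-+ (2 * M) (ℓ K) _ ⟩
    2 * M * ℓ K + 2 * M * count Run (b ^ K)     ≤⟨ ℕₚ.+-mono-≤ (sparse′ k₀≤K) at-power ⟩
    b ^ K + b ^ K                               ≤⟨ ℕₚ.+-mono-≤ b^K≤n b^K≤n ⟩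
    n + n                                       ≡⟨ ≡.cong (n +_) (ℕₚ.+-identityʳ n) ⟨
    2 * n                                       ∎)
    where
    open ℕₚ.≤-Reasoning
    k₀≤K : k₀ ≤ K
    k₀≤K = ℕₚ.≮⇒≥ λ K<k₀ → ℕₚ.<⇒≱ n< (ℕₚ.≤-trans (b^-mono K<k₀) b^k₀≤n)
    at-power : 2 * M * count Run (b ^ K) ≤ b ^ K
    at-power = ≡.subst (λ k → 2 * M * count Run (b ^ k) ≤ b ^ k) (ℕₚ.m∸n+n≡m k₀≤K) (count-at-power (K ℕ.∸ k₀))

  template : ℕ → Maybe (Fin b)
  template = interleave tX tY

  -- After multiplication by `M`, four families of fixed digits cost `k` each: the runs of `tX`, the
  -- runs of `tY`, the residues up to `M` modulo `L`, and the multiples of `M`. The boundary terms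
  -- of the two residue counts make up `L + M`.
  free-density : ∀ k → M * double k ≤ M * free template (double k) + (4 * k + (L + M))
  free-density k = begin
    M * double k                                              ≤⟨ ℕₚ.*-monoʳ-≤ M double≤ ⟩
    M * ((fx + (r + p)) + (fy + (r + s)))                     ≡⟨ solve 6 (λ M fx fy r p s → M :* ((fx :+ (r :+ p)) :+ (fy :+ (r :+ s))) := M :* (fx :+ fy) :+ ((M :* r :+ M :* r) :+ (M :* p :+ M :* s))) ≡.refl M fx fy r p s ⟩
    M * (fx + fy) + ((M * r + M * r) + (M * p + M * s))       ≤⟨ ℕₚ.+-monoʳ-≤ (M * (fx + fy)) (ℕₚ.+-mono-≤ (ℕₚ.+-mono-≤ (count-run k) (count-run k)) (ℕₚ.+-mono-≤ Mp≤ (count-residue M 0<M k))) ⟩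
    M * (fx + fy) + ((k + k) + ((k + L) + (k + M)))           ≡⟨ ≡.cong₂ _+_ (≡.cong (M *_) (≡.sym (free-interleave tX tY k))) (solve 3 (λ k L M → (k :+ k) :+ ((k :+ L) :+ (k :+ M)) := con 4 :* k :+ (L :+ M)) ≡.refl k L M) ⟩
    M * free template (double k) + (4 * k + (L + M))          ∎
    where
    open ℕₚ.≤-Reasoning
    open +-*-Solver using (solve; con; _:+_; _:*_; _:=_)
    fx = free tX k
    fy = free tY k
    r = count Run k
    p = count (λ n → n % L < suc M) k
    s = count (λ n → n % M ≡ 0) k
    double≤ : double k ≤ (fx + (r + p)) + (fy + (r + s))
    double≤ = ℕₚ.≤-trans (ℕₚ.≤-reflexive (double≡ k)) (ℕₚ.+-mono-≤ (free+count tX tX-free k) (free+count tY tY-free k))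
    Mp≤ : M * p ≤ k + L
    Mp≤ = ℕₚ.*-cancelˡ-≤ (suc M) (begin
      suc M * (M * p)      ≡⟨ ≡.trans (≡.sym (ℕₚ.*-assoc (suc M) M p)) (≡.cong (_* p) (≡.trans (ℕₚ.*-comm (suc M) M) (≡.sym L≡))) ⟩
      L * p                ≤⟨ count-residue-below L (suc M) M<L k ⟩
      suc M * (k + L)      ∎)

  Follows : (ℕ → Maybe (Fin b)) → (ℕ → Fin b) → Set
  Follows t d = ∀ n c → t n ≡ just c → d n ≡ c

  run-free-window : ∀ N → ∃ λ s → N ≤ s × (∀ e → e < L + L → ¬ Run (s + e))
  run-free-window N = ℓ k + b ^ k ,
    ℕₚ.≤-trans (ℕₚ.≤-trans (ℕₚ.m≤m+n N k₀) (ℕₚ.<⇒≤ (n<b^n k))) (ℕₚ.m≤n+m (b ^ k) (ℓ k)) ,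
    λ e e<W → run-gap {k} (ℕₚ.m≤m+n _ e) (ℕₚ.<-≤-trans (ℕₚ.<-≤-trans (ℕₚ.+-monoʳ-< (ℓ k + b ^ k) e<W)
      (ℕₚ.≤-reflexive (ℕₚ.+-comm _ (L + L)))) (run-end (ℕₚ.m≤n+m k₀ N)))
    where k = N + k₀

  private
    1F≢0 : ∀ {c : Fin b} → c ≡ 1F → toℕ c ≢ 0
    1F≢0 eq e = ℕₚ.0≢1+n (≡.trans (≡.sym e) (≡.trans (≡.cong toℕ eq) toℕ-1F))

  nonterminating-X : ∀ {d} → Follows tX d → ∀ N → ∃ λ n → N ≤ n × toℕ (d n) ≢ 0
  nonterminating-X f N with run-free-window N
  ... | s , N≤s , h with residue L M<L s
  ...   | e , e<L , p = s + e , ℕₚ.≤-trans N≤s (ℕₚ.m≤m+n s e) ,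
          1F≢0 (f (s + e) 1F (tX-one (h e (ℕₚ.<-≤-trans e<L (ℕₚ.m≤m+n L L))) p))

  nonterminating-Y : ∀ {d} → Follows tY d → ∀ N → ∃ λ n → N ≤ n × toℕ (d n) ≢ 0
  nonterminating-Y f N with run-free-window N
  ... | s , N≤s , h with residue M 0<M s
  ...   | e , e<M , p = s + e , ℕₚ.≤-trans N≤s (ℕₚ.m≤m+n s e) ,
          1F≢0 (f (s + e) 1F (tY-one (h e (ℕₚ.<-≤-trans (ℕₚ.<-trans e<M M<L) (ℕₚ.m≤m+n L L))) p))

  -- Positions of residue `M` are fixed inside and outside the runs; the digit there depends on the
  -- position but not on the sequence.
  common-X : ∀ {d d′} → Follows tX d → Follows tX d′ → ∀ m → ∃ λ p → m < p × p ≤ m + L × d p ≡ d′ p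
  common-X f f′ m with residue L M<L (suc m)
  ... | e , e<L , eq with tX-fixed eq
  ...   | c , fixed = suc m + e , s≤s (ℕₚ.m≤m+n m e) , ℕₚ.+-monoʳ-< m e<L , ≡.trans (f _ c fixed) (≡.sym (f′ _ c fixed))

  common-Y : ∀ {d d′} → Follows tY d → Follows tY d′ → ∀ m → ∃ λ p → m < p × p ≤ m + L × d p ≡ d′ p
  common-Y f f′ m with residue M 0<M (suc m)
  ... | e , e<M , eq with tY-fixed eq
  ...   | c , fixed = suc m + e , s≤s (ℕₚ.m≤m+n m e) , ℕₚ.+-monoʳ-< m (ℕₚ.<-trans e<M M<L) , ≡.trans (f _ c fixed) (≡.sym (f′ _ c fixed))

  module _ {x y : ℕ → Fin b} (fx : Follows tX x) (fy : Follows tY y) where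

    common-run : ∀ {K} → k₀ ≤ K → ∀ k → k < ℓ K → x (b ^ K + k) ≡ y (b ^ K + k)
    common-run {K} k₀≤K k k<ℓ = ≡.trans (fx _ 0F (tX-run run)) (≡.sym (fy _ 0F (tY-run run)))
      where
      run : Run (b ^ K + k)
      run = K , k₀≤K , ℕₚ.m≤m+n (b ^ K) k , ℕₚ.<-≤-trans (ℕₚ.+-monoʳ-< (b ^ K) k<ℓ) (ℕₚ.≤-reflexive (ℕₚ.+-comm (b ^ K) (ℓ K)))

    -- The window of x contains the word 0^M, which y contains only inside
    -- the runs.
    no-common-window : ∀ i j o → (∀ e → e < L + L → ¬ Run (j + (o + e))) →
                       ¬ (∀ e → e < L + L → x (i + (o + e)) ≡ y (j + (o + e)))
    -- `e₁` brings x to a multiple of `L`, and a further `e₂ < M` brings y to a multiple of `M`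
    -- while x is still within its 0^M. Inside the runs of x these digits are zeros too.
    no-common-window i j o norun eq with residue L (ℕₚ.<-trans 0<M M<L) (i + o)
    ... | e₁ , e₁<L , p₁ with residue M 0<M (j + o + e₁)
    ...   | e₂ , e₂<M , p₂ = 0F≢1F (≡.trans (≡.sym x≡0) (≡.trans (eq e e<) y≡1))
      where
      e = e₁ + e₂
      e< : e < L + L
      e< = ℕₚ.+-mono-< e₁<L (ℕₚ.<-trans e₂<M M<L)
      shift : ∀ a → a + o + e₁ + e₂ ≡ a + (o + e)
      shift a = +-*-Solver.solve 4 (λ a o u v → a :+ o :+ u :+ v := a :+ (o :+ (u :+ v))) ≡.refl a o e₁ e₂
        where open +-*-Solver using (_:+_; _:=_)
      y≡1 : y (j + (o + e)) ≡ 1F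
      y≡1 = fy _ 1F (tY-one (norun e e<) (≡.trans (≡.cong (_% M) (≡.sym (shift j))) p₂))
      x≡0 : x (i + (o + e)) ≡ 0F
      x≡0 = fx _ 0F (tX-zero (≡.subst (_< M) (≡.sym residue-e₂) e₂<M))
        where
        residue-e₂ : (i + (o + e)) % L ≡ e₂
        residue-e₂ = ≡.trans (≡.cong (_% L) (≡.sym (shift i))) (≡.trans (%-distribˡ-+ (i + o + e₁) e₂ L)
          (≡.trans (≡.cong (λ z → (z + e₂ % L) % L) p₁) (≡.trans (m%n%n≡m%n e₂ L) (m<n⇒m%n≡m (ℕₚ.<-trans e₂<M M<L)))))

    -- Either no run meets the first `L + L` positions of the match in y, or one does and the match
    -- is re-entered where that run ends, at most `ℓ K + (L + L)` places later. Both ways a run-free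
    -- window of length `L + L` lies inside a match this long.
    common-bound : ∀ {K n l} i j → n < b ^ suc K → j + l ≤ n →
                   (∀ k → k < l → x (i + k) ≡ y (j + k)) → l < ℓ K + ((L + L) + (L + L))
    common-bound {K} {n} {l} i j n< j+l≤n eq = ℕₚ.≰⇒> λ long → excluded long (lem {P = ∃ λ e → e < L + L × Run (j + e)})
      where
      W = L + L
      excluded : ℓ K + (W + W) ≤ l → Dec (∃ λ e → e < W × Run (j + e)) → ⊥
      excluded long (no none) = no-common-window i j 0 (λ e e<W r → none (e , e<W , r))
        λ e e<W → eq e (ℕₚ.<-≤-trans e<W (ℕₚ.≤-trans (ℕₚ.m≤m+n W W) (ℕₚ.≤-trans (ℕₚ.m≤n+m (W + W) (ℓ K)) long)))
      excluded long (yes (e , e<W , k , k₀≤k , start≤ , <end)) = no-common-window i j o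
        (λ e′ e′<W → run-gap {k} (begin
            ℓ k + b ^ k          ≡⟨ j+o≡ ⟨
            j + o                ≤⟨ ℕₚ.m≤m+n (j + o) e′ ⟩
            j + o + e′           ≡⟨ ℕₚ.+-assoc j o e′ ⟩
            j + (o + e′)         ∎)
          (begin-strict
            j + (o + e′)             ≡⟨ ℕₚ.+-assoc j o e′ ⟨
            j + o + e′               <⟨ ℕₚ.+-monoʳ-< (j + o) e′<W ⟩
            j + o + W                ≡⟨ ℕₚ.+-comm (j + o) W ⟩
            W + (j + o)              ≡⟨ ≡.cong (W +_) j+o≡ ⟩
            W + (ℓ k + b ^ k)        ≤⟨ run-end k₀≤k ⟩
            b ^ suc k                ∎))
        λ e′ e′<W → eq (o + e′) (begin-strict
            o + e′               <⟨ ℕₚ.+-mono-≤-< o≤ e′<W ⟩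
            ℓ K + W + W          ≡⟨ ℕₚ.+-assoc (ℓ K) W W ⟩
            ℓ K + (W + W)        ≤⟨ long ⟩
            l                    ∎)
        where
        open ℕₚ.≤-Reasoning
        o = (ℓ k + b ^ k) ℕ.∸ j
        j+o≡ : j + o ≡ ℓ k + b ^ k
        j+o≡ = ℕₚ.m+[n∸m]≡n (ℕₚ.<⇒≤ (ℕₚ.≤-<-trans (ℕₚ.m≤m+n j e) <end))
        -- A run met so early starts before `n`, hence at a power with exponent at most `K`;
        -- monotonicity of `ℓ` then bounds its length.
        k≤K : k ≤ K
        k≤K = ℕₚ.≮⇒≥ λ K<k → ℕₚ.<-irrefl ≡.refl (begin-strict
          n              <⟨ n< ⟩
          b ^ suc K      ≤⟨ b^-mono K<k ⟩
          b ^ k          ≤⟨ start≤ ⟩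
          j + e          <⟨ ℕₚ.+-monoʳ-< j e<W ⟩
          j + W          ≤⟨ ℕₚ.+-monoʳ-≤ j (ℕₚ.≤-trans (ℕₚ.m≤m+n W W) (ℕₚ.≤-trans (ℕₚ.m≤n+m (W + W) (ℓ K)) long)) ⟩
          j + l          ≤⟨ j+l≤n ⟩
          n              ∎)
        o≤ : o ≤ ℓ K + W
        o≤ = ℕₚ.m≤n+o⇒m∸n≤o (ℓ k + b ^ k) j (begin
          ℓ k + b ^ k          ≤⟨ ℕₚ.+-mono-≤ (ℓ-mono k≤K) (ℕₚ.≤-trans start≤ (ℕₚ.+-monoʳ-≤ j (ℕₚ.<⇒≤ e<W))) ⟩
          ℓ K + (j + W)        ≡⟨ +-*-Solver.solve 3 (λ a j w → a :+ (j :+ w) := j :+ (a :+ w)) ≡.refl (ℓ K) j W ⟩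
          j + (ℓ K + W)        ∎)
          where open +-*-Solver using (_:+_; _:=_)

-- Polynomial against exponential growth

module Growth (b : ℕ) (2≤b : 2 ℕ.≤ b) where

  open import Data.Nat.Base using (_+_; _*_; _≤_; _^_)
  open Powers b 2≤b
  open ℕₚ.≤-Reasoning

  -- With j = k/3, using j < b^j three times gives a cubic lower bound for `b ^ k`. Two factors pay
  -- for the square and the third for the constant, whence 27.
  quadratic≤exponential : ∀ C k → C * 9 * 3 ≤ k → C * (suc k * suc k) ≤ b ^ k
  quadratic≤exponential C k 27C≤k = begin
    C * (suc k * suc k)                        ≤⟨ ℕₚ.*-monoʳ-≤ C (ℕₚ.*-mono-≤ 1+k≤ 1+k≤) ⟩
    C * ((3 * suc j) * (3 * suc j))            ≡⟨ solve 2 (λ C j → C :* ((con 3 :* j) :* (con 3 :* j)) := (C :* con 9) :* (j :* j)) ≡.refl C (suc j) ⟩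
    C * 9 * (suc j * suc j)                    ≤⟨ ℕₚ.*-monoˡ-≤ (suc j * suc j) 9C≤ ⟩
    suc j * (suc j * suc j)                    ≤⟨ ℕₚ.*-mono-≤ (n<b^n j) (ℕₚ.*-mono-≤ (n<b^n j) (n<b^n j)) ⟩
    b ^ j * (b ^ j * b ^ j)                    ≡⟨ ≡.cong (b ^ j *_) (ℕₚ.^-distribˡ-+-* b j j) ⟨
    b ^ j * b ^ (j + j)                        ≡⟨ ℕₚ.^-distribˡ-+-* b j (j + j) ⟨
    b ^ (j + (j + j))                          ≡⟨ ≡.cong (b ^_) (solve 1 (λ j → j :+ (j :+ j) := j :* con 3) ≡.refl j) ⟩
    b ^ (j * 3)                                ≤⟨ b^-mono (m/n*n≤m k 3) ⟩
    b ^ k                                      ∎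
    where
    open +-*-Solver using (solve; con; _:+_; _:*_; _:=_)
    j = k / 3
    1+k≤ : suc k ≤ 3 * suc j
    1+k≤ = begin
      suc k                    ≡⟨ ≡.cong suc (m≡m%n+[m/n]*n k 3) ⟩
      suc (k % 3) + j * 3      ≤⟨ ℕₚ.+-monoˡ-≤ (j * 3) (m%n<n k 3) ⟩
      3 + j * 3                ≡⟨ ℕₚ.*-comm (suc j) 3 ⟩
      3 * suc j                ∎
    9C≤ : C * 9 ≤ suc j
    9C≤ = ℕₚ.m≤n⇒m≤1+n (begin
      C * 9              ≡⟨ m*n/n≡m (C * 9) 3 ⟨
      C * 9 * 3 / 3      ≤⟨ /-monoˡ-≤ 3 27C≤k ⟩
      j                  ∎)

  eventually-sparse : ∀ {ℓ : ℕ → ℕ} {A} → (∀ k → ℓ k ≤ A * (suc k * suc k)) →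
                      ∀ Q W → ∃ λ k₀ → ∀ k → k₀ ≤ k → Q * (ℓ k + W) ≤ b ^ k
  eventually-sparse {ℓ} {A} ℓ≤ Q W = Q * (A + W) * 9 * 3 , λ k k₀≤k → begin
    Q * (ℓ k + W)                            ≤⟨ ℕₚ.*-monoʳ-≤ Q (ℕₚ.+-mono-≤ (ℓ≤ k) (ℕₚ.m≤m*n W (suc k * suc k))) ⟩
    Q * (A * (suc k * suc k) + W * (suc k * suc k)) ≡⟨ ≡.cong (Q *_) (ℕₚ.*-distribʳ-+ (suc k * suc k) A W) ⟨
    Q * ((A + W) * (suc k * suc k))          ≡⟨ ℕₚ.*-assoc Q (A + W) _ ⟨
    Q * (A + W) * (suc k * suc k)            ≤⟨ quadratic≤exponential (Q * (A + W)) k k₀≤k ⟩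
    b ^ k                                    ∎

-- Run lengths for a prescribed rate

module Rates (lem : ∀ {ℓ} → ExcludedMiddle ℓ) (R : CompleteOrderedField) where

  open Analysis lem R hiding (zero)
  open RealLemmas lem R
  open AnalysisLemmas lem R
  open Least lem
  open AddSupOrder _≤_ using ([_])

  -- At infinite rate, squares outgrow every multiple of `k` and still obey the quadratic bound that
  -- `eventually-sparse` takes.
  HasRate : (ℕ → ℕ) → ℝ ⁺ → Set
  HasRate ℓ [ a ] = ∀ k → fromℕ (ℓ k) ≤ a * fromℕ k × a * fromℕ k ≤ fromℕ (suc (ℓ k))
  HasRate ℓ ⊤⁺    = ∀ k → k ℕ.* k ℕ.≤ ℓ k

  record RunLengths (α : ℝ ⁺) : Set where
    field
      ℓ        : ℕ → ℕ
      ℓ-mono   : ∀ {m n} → m ℕ.≤ n → ℓ m ℕ.≤ ℓ n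
      A        : ℕ
      ℓ-growth : ∀ k → ℓ k ℕ.≤ A ℕ.* (suc k ℕ.* suc k)
      ℓ-rate   : HasRate ℓ α

  runLengths : ∀ α → [ 0# ] ≤⁺ α → RunLengths α
  runLengths ⊤⁺ _ = record
    { ℓ        = λ k → k ℕ.* k
    ; ℓ-mono   = λ m≤n → ℕₚ.*-mono-≤ m≤n m≤n
    ; A        = 1
    ; ℓ-growth = λ k → ℕₚ.≤-trans (ℕₚ.*-mono-≤ (ℕₚ.n≤1+n k) (ℕₚ.n≤1+n k)) (ℕₚ.m≤m+n _ 0)
    ; ℓ-rate   = λ k → ℕₚ.≤-refl
    }
  runLengths [ a ] [ 0≤a ] = record
    { ℓ        = proj₁ ∘ floor
    ; ℓ-mono   = λ {m} {n} m≤n → ℕₚ.≮⇒≥ λ ℓn<ℓm → minimal m _ ℓn<ℓm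
                   (≤-trans (*-monoˡ-≤ 0≤a (fromℕ-mono-≤ m≤n)) (upper n))
    ; A        = A
    ; ℓ-growth = λ k → ℕₚ.≤-trans (proj₁ (proj₂ (floor k)))
                   (ℕₚ.*-monoʳ-≤ A (ℕₚ.≤-trans (ℕₚ.n≤1+n k) (ℕₚ.m≤m*n (suc k) (suc k))))
    ; ℓ-rate   = λ k → lower k _ (minimal k) , upper k
    }
    where
    A : ℕ
    A = proj₁ (archimedean a)
    -- The least u with a k ≤ u + 1 serves as an integer part: minimality gives u ≤ a k when u is
    -- positive, and monotonicity in `k`.
    floor : ∀ k → ∃ λ u → u ℕ.≤ A ℕ.* k × a * fromℕ k ≤ fromℕ (suc u) × (∀ v → v ℕ.< u → ¬ (a * fromℕ k ≤ fromℕ (suc v)))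
    floor k = least (λ u → a * fromℕ k ≤ fromℕ (suc u)) (A ℕ.* k)
      (≤-trans (*-monoʳ-≤ (0≤fromℕ k) (proj₂ (archimedean a)))
        (≤-trans (≤-reflexive (sym (fromℕ-* A k))) (fromℕ-mono-≤ (ℕₚ.n≤1+n (A ℕ.* k)))))
    upper : ∀ k → a * fromℕ k ≤ fromℕ (suc (proj₁ (floor k)))
    upper k = proj₁ (proj₂ (proj₂ (floor k)))
    minimal : ∀ k v → v ℕ.< proj₁ (floor k) → ¬ (a * fromℕ k ≤ fromℕ (suc v))
    minimal k = proj₂ (proj₂ (proj₂ (floor k)))
    lower : ∀ k u → (∀ v → v ℕ.< u → ¬ (a * fromℕ k ≤ fromℕ (suc v))) → fromℕ u ≤ a * fromℕ k
    lower k zero    _   = *-nonneg 0≤a (0≤fromℕ k)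
    lower k (suc u) min = <⇒≤ (≰⇒> (min u ℕₚ.≤-refl))

-- The limit of the longest common substring

module LongestCommonSubstrings (lem : ∀ {ℓ} → ExcludedMiddle ℓ) (R : CompleteOrderedField)
    (b : ℕ) (2≤b : 2 ℕ.≤ b)
    (M L : ℕ) .{{_ : NonZero M}} .{{_ : NonZero L}} (L≡ : L ≡ M ℕ.* suc M)
    (ℓ : ℕ → ℕ) (ℓ-mono : ∀ {m n} → m ℕ.≤ n → ℓ m ℕ.≤ ℓ n)
    (k₀ : ℕ) (sparse : ∀ k → k₀ ℕ.≤ k → 2 ℕ.* M ℕ.* (ℓ k ℕ.+ (L ℕ.+ L)) ℕ.≤ b ℕ.^ k) where

  open Analysis lem R hiding (zero)
  open RealLemmas lem R
  open AnalysisLemmas lem R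
  open Powers b 2≤b
  open BaseLemmas lem R b 2≤b
  open Templates lem b 2≤b M L L≡ ℓ ℓ-mono k₀ sparse
  open Rates lem R
  open AddSupOrder _≤_ using ([_])

  greatest-upper : ∀ (P : Pred ℕ 0ℓ) {l} m → P l → l ℕ.≤ m → l ℕ.≤ greatest P m
  greatest-upper P zero    p l≤0 = l≤0
  greatest-upper P (suc m) p l≤1+m with lem {P = P (suc m)}
  ... | yes _ = l≤1+m
  ... | no ¬p with ℕₚ.m≤n⇒m<n∨m≡n l≤1+m
  ...   | inj₁ (s≤s l≤m) = greatest-upper P m p l≤m
  ...   | inj₂ ≡.refl    = ⊥-elim (¬p p)

  greatest-least : ∀ (P : Pred ℕ 0ℓ) {u} m → (∀ l → P l → l ℕ.≤ u) → greatest P m ℕ.≤ u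
  greatest-least P zero    h = z≤n
  greatest-least P (suc m) h with lem {P = P (suc m)}
  ... | yes p = h (suc m) p
  ... | no _  = greatest-least P m h

  x≤z*y⁻¹⇒x*y≤z : ∀ {x y z} → 0# < y → x ≤ z * y ⁻¹ → x * y ≤ z
  x≤z*y⁻¹⇒x*y≤z {x} {y} {z} 0<y p = begin
    x * y            ≤⟨ *-monoʳ-≤ (<⇒≤ 0<y) p ⟩
    z * y ⁻¹ * y     ≈⟨ trans (*-assoc _ _ _) (trans (*-congˡ (⁻¹-inverseˡ 0<y)) (*-identityʳ z)) ⟩
    z                ∎
    where open ≤-Reasoning

  z*y⁻¹≤x⇒z≤x*y : ∀ {x y z} → 0# < y → z * y ⁻¹ ≤ x → z ≤ x * y
  z*y⁻¹≤x⇒z≤x*y {x} {y} {z} 0<y p = begin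
    z                ≈⟨ trans (*-assoc _ _ _) (trans (*-congˡ (⁻¹-inverseˡ 0<y)) (*-identityʳ z)) ⟨
    z * y ⁻¹ * y     ≤⟨ *-monoʳ-≤ (<⇒≤ 0<y) p ⟩
    x * y            ∎
    where open ≤-Reasoning

  module _ {x y : ℕ → Fin b} (fx : Follows tX x) (fy : Follows tY y) where

    record Scale (K₀ n : ℕ) : Set where
      field
        K       : ℕ
        K₀≤K    : K₀ ℕ.≤ K
        ℓ≤lcs   : ℓ K ℕ.≤ lcs x y n
        lcs≤    : lcs x y n ℕ.≤ ℓ (suc K) ℕ.+ ((L ℕ.+ L) ℕ.+ (L ℕ.+ L))
        K≤log   : fromℕ (suc K) ≤ log B (fromℕ n)
        log≤K   : log B (fromℕ n) ≤ fromℕ (2 ℕ.+ K)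

      0<log : 0# < log B (fromℕ n)
      0<log = <-≤-trans (0<fromℕ K) K≤log

    -- `K` is one less than the integer part of log_b n: the run at `b ^ K` is then complete within
    -- the first `n` digits, at the price of letting log_b n range up to K + 2.
    scale : ∀ K₀ → k₀ ℕ.≤ K₀ → ∀ n → b ℕ.^ suc K₀ ℕ.≤ n → Scale K₀ n
    scale K₀ k₀≤K₀ n N≤n with log-floor (ℕₚ.≤-trans (ℕₚ.≤-trans (s≤s z≤n) (n<b^n (suc K₀))) N≤n)
    ... | zero  , b^K≤n , n< = ⊥-elim (ℕₚ.<⇒≱ n< (ℕₚ.≤-trans (b^-mono {1} {suc K₀} (s≤s z≤n)) N≤n))
    ... | suc K , b^K≤n , n< = record
      { K     = K
      ; K₀≤K  = K₀≤K
      ; ℓ≤lcs = greatest-upper (CommonSubstring x y n) n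
                  (b ℕ.^ K , b ℕ.^ K , fits , fits , common-run fx fy k₀≤K)
                  (ℕₚ.≤-trans (ℕₚ.m≤n+m (ℓ K) (b ℕ.^ K)) fits)
      ; lcs≤  = greatest-least (CommonSubstring x y n) n
                  λ { l (i , j , _ , j+l≤n , eq) → ℕₚ.<⇒≤ (common-bound fx fy i j n< j+l≤n eq) }
      ; K≤log = log-upper 1<B B^-unbounded (suc K) (≤-respˡ (fromℕ-^ b (suc K)) (fromℕ-mono-≤ b^K≤n))
      ; log≤K = log-least 1<B B^-unbounded (2 ℕ.+ K) (<-≤-trans (fromℕ-mono-< n<) (≤-reflexive (fromℕ-^ b (2 ℕ.+ K))))
      }
      where
      K₀≤K : K₀ ℕ.≤ K
      K₀≤K = ℕₚ.≮⇒≥ λ K<K₀ → ℕₚ.<⇒≱ n< (ℕₚ.≤-trans (b^-mono (s≤s K<K₀)) N≤n)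
      k₀≤K : k₀ ℕ.≤ K
      k₀≤K = ℕₚ.≤-trans k₀≤K₀ K₀≤K
      fits : b ℕ.^ K ℕ.+ ℓ K ℕ.≤ n
      fits = ℕₚ.≤-trans (ℕₚ.≤-trans (ℕₚ.≤-reflexive (ℕₚ.+-comm (b ℕ.^ K) (ℓ K)))
               (ℕₚ.≤-trans (ℕₚ.m≤n+m _ (L ℕ.+ L)) (run-end k₀≤K))) b^K≤n

    lcs-rate : ∀ α → [ 0# ] ≤⁺ α → HasRate ℓ α →
               TendsTo (λ n → fromℕ (lcs x y n) * log B (fromℕ n) ⁻¹) α
    lcs-rate ⊤⁺ _ rate T = b ℕ.^ suc K₀ , λ n N≤n → bound n (scale K₀ (ℕₚ.m≤m+n k₀ _) n N≤n)
      where
      m = proj₁ (archimedean T)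
      -- For K ≥ 2 + m one has m(2 + K) ≤ 2K + mK ≤ K².
      K₀ = k₀ ℕ.+ (2 ℕ.+ m)
      bound : ∀ n → Scale K₀ n → T ≤ fromℕ (lcs x y n) * log B (fromℕ n) ⁻¹
      bound n sc = x≤z*y⁻¹ 0<log (begin
        T * log B (fromℕ n)              ≤⟨ *-monoʳ-≤ (<⇒≤ 0<log) (proj₂ (archimedean T)) ⟩
        fromℕ m * log B (fromℕ n)        ≤⟨ *-monoˡ-≤ (0≤fromℕ m) log≤K ⟩
        fromℕ m * fromℕ (2 ℕ.+ K)        ≈⟨ fromℕ-* m (2 ℕ.+ K) ⟨
        fromℕ (m ℕ.* (2 ℕ.+ K))          ≤⟨ fromℕ-mono-≤ (ℕₚ.≤-trans quadratic (ℕₚ.≤-trans (rate K) ℓ≤lcs)) ⟩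
        fromℕ (lcs x y n)                ∎)
        where
        open Scale sc
        open ≤-Reasoning
        2+m≤K : 2 ℕ.+ m ℕ.≤ K
        2+m≤K = ℕₚ.≤-trans (ℕₚ.m≤n+m (2 ℕ.+ m) k₀) K₀≤K
        quadratic : m ℕ.* (2 ℕ.+ K) ℕ.≤ K ℕ.* K
        quadratic = ℕₚ.≤-trans (ℕₚ.≤-trans (ℕₚ.≤-reflexive (ℕₚ.*-distribˡ-+ m 2 K))
          (ℕₚ.+-monoˡ-≤ (m ℕ.* K) (ℕₚ.≤-trans (ℕₚ.≤-reflexive (ℕₚ.*-comm m 2)) (ℕₚ.*-monoʳ-≤ 2 (ℕₚ.≤-trans (ℕₚ.m≤n+m m 2) 2+m≤K)))))
          (ℕₚ.≤-trans (ℕₚ.≤-reflexive (≡.sym (ℕₚ.*-distribʳ-+ K 2 m))) (ℕₚ.*-monoˡ-≤ K 2+m≤K))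
    lcs-rate [ a ] [ 0≤a ] rate ε 0<ε = b ℕ.^ suc K₀ , λ n N≤n → bound n (scale K₀ (ℕₚ.m≤m+n k₀ m) n N≤n)
      where
      open ≤-Reasoning
      C : ℕ
      C = (L ℕ.+ L) ℕ.+ (L ℕ.+ L)
      D : ℝ
      -- `D` covers both errors: from above, the excess `C` of a match over a run; from below, 2a
      -- because log_b n may reach K + 2, and 1 from the rounding in `ℓ`.
      D = (a + a) + fromℕ (suc C)
      m = proj₁ (archimedean (D * ε ⁻¹))
      K₀ = k₀ ℕ.+ m
      0≤2a : 0# ≤ a + a
      0≤2a = 0≤+ 0≤a 0≤a
      bound : ∀ n → Scale K₀ n →
              fromℕ (lcs x y n) * log B (fromℕ n) ⁻¹ - a < ε × a - fromℕ (lcs x y n) * log B (fromℕ n) ⁻¹ < ε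
      bound n sc =
        x-y<z (≰⇒> λ p → <⇒≱ s<  (x≤z*y⁻¹⇒x*y≤z 0<log p)) ,
        x-y<z (≰⇒> λ p → <⇒≱ aλ< (begin
          ε * λₙ + s                     ≈⟨ +-congˡ (trans (*-assoc s _ _) (trans (*-congˡ (⁻¹-inverseˡ 0<log)) (*-identityʳ s))) ⟨
          ε * λₙ + s * λₙ ⁻¹ * λₙ        ≈⟨ distribʳ _ _ _ ⟨
          (ε + s * λₙ ⁻¹) * λₙ           ≤⟨ *-monoʳ-≤ (<⇒≤ 0<log) p ⟩
          a * λₙ                         ∎))
        where
        open Scale sc
        s λₙ : ℝ
        s = fromℕ (lcs x y n)
        λₙ = log B (fromℕ n)
        D<ελ : D < ε * λₙ
        D<ελ = ≤-<-trans (z*y⁻¹≤x⇒z≤x*y 0<ε (proj₂ (archimedean (D * ε ⁻¹))))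
          (<-≤-trans (≰⇒> λ p → <⇒≱ (fromℕ-mono-< {m} {suc K} (s≤s (ℕₚ.≤-trans (ℕₚ.m≤n+m m k₀) K₀≤K)))
                                   (*-cancelʳ-≤ 0<ε p))
            (≤-trans (≤-reflexive (*-comm (fromℕ (suc K)) ε)) (*-monoˡ-≤ (<⇒≤ 0<ε) K≤log)))
        s≤ : s ≤ a * λₙ + D
        s≤ = begin
          s                                         ≤⟨ fromℕ-mono-≤ lcs≤ ⟩
          fromℕ (ℓ (suc K) ℕ.+ C)                   ≈⟨ fromℕ-+ (ℓ (suc K)) C ⟩
          fromℕ (ℓ (suc K)) + fromℕ C               ≤⟨ +-mono-≤ (≤-trans (proj₁ (rate (suc K))) (*-monoˡ-≤ 0≤a K≤log))
                                                               (≤-trans (fromℕ-mono-≤ (ℕₚ.n≤1+n C)) (x≤y+x (fromℕ (suc C)) 0≤2a)) ⟩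
          a * λₙ + D                                ∎
        s< : s < (ε + a) * λₙ
        s< = ≤-<-trans s≤ (<-≤-trans (≤-<-trans (≤-reflexive (+-comm _ _)) (+-monoˡ-< (a * λₙ) D<ελ)) (≤-reflexive (sym (distribʳ _ _ _))))
        aλ≤ : a * λₙ ≤ D + s
        aλ≤ = begin
          a * λₙ                                    ≤⟨ *-monoˡ-≤ 0≤a log≤K ⟩
          a * (1# + (1# + fromℕ K))                 ≈⟨ Solver.solve 2 (λ a k → a :* (con 1 :+ (con 1 :+ k)) := (a :+ a) :+ a :* k) refl a (fromℕ K) ⟩
          (a + a) + a * fromℕ K                     ≤⟨ +-monoʳ-≤ _ (proj₂ (rate K)) ⟩
          (a + a) + (1# + fromℕ (ℓ K))              ≈⟨ +-assoc _ _ _ ⟨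
          (a + a) + 1# + fromℕ (ℓ K)                ≤⟨ +-mono-≤ (+-monoʳ-≤ _ (x≤x+y 1# (0≤fromℕ C))) (fromℕ-mono-≤ ℓ≤lcs) ⟩
          D + s                                     ∎
          where open Solver using (con; _:+_; _:*_; _:=_)
        aλ< : a * λₙ < ε * λₙ + s
        aλ< = ≤-<-trans aλ≤ (+-monoˡ-< s D<ελ)

-- Lower bound: covers of small total power miss a point

module LowerBoundOnDimension (lem : ∀ {ℓ} → ExcludedMiddle ℓ) (R : CompleteOrderedField)
    (b : ℕ) (2≤b : 2 ℕ.≤ b) (q : ℕ)
    (M L : ℕ) .{{_ : NonZero M}} .{{_ : NonZero L}} (M≡ : M ≡ 4 ℕ.* suc q) (L≡ : L ≡ M ℕ.* suc M)
    (ℓ : ℕ → ℕ) (ℓ-mono : ∀ {m n} → m ℕ.≤ n → ℓ m ℕ.≤ ℓ n)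
    (k₀ : ℕ) (sparse : ∀ k → k₀ ℕ.≤ k → 2 ℕ.* M ℕ.* (ℓ k ℕ.+ (L ℕ.+ L)) ℕ.≤ b ℕ.^ k) where

  open Analysis lem R hiding (zero)
  open RealLemmas lem R
  open AnalysisLemmas lem R
  open BaseLemmas lem R b 2≤b
  open Expansions lem R b 2≤b
  open Templates lem b 2≤b M L L≡ ℓ ℓ-mono k₀ sparse
  open Rates lem R
  open LongestCommonSubstrings lem R b 2≤b M L L≡ ℓ ℓ-mono k₀ sparse
  open Avoidance lem R b 2≤b
  open Least lem
  open Counting
  open Doubling

  -- The digits of x and y alternate in one sequence, so that a square cylinder becomes a prefix of
  -- even length and `avoid` can handle both coordinates together.
  digitsX digitsY : (ℕ → Fin b) → ℕ → Fin b
  digitsX z = z ∘ double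
  digitsY z = z ∘ suc ∘ double

  point : (ℕ → Fin b) → ℝ²
  point z = value (digitsX z) , value (digitsY z)

  follows-X : ∀ {z} → Follows template z → Follows tX (digitsX z)
  follows-X f n c eq = f (double n) c (≡.trans (interleave-even tX tY n) eq)

  follows-Y : ∀ {z} → Follows template z → Follows tY (digitsY z)
  follows-Y f n c eq = f (suc (double n)) c (≡.trans (interleave-odd tX tY n) eq)

  point∈S : ∀ {α} → [ 0# ] ≤⁺ α → HasRate ℓ α → ∀ {z} → Follows template z → point z ∈ S b α
  point∈S {α} 0≤α rate {z} f =
    value∈UnitInterval x (nonterminating-X fx) , value∈UnitInterval y (nonterminating-Y fy) ,
    x , y , isExpansion x (nonterminating-X fx) , isExpansion y (nonterminating-Y fy) ,
    lcs-rate fx fy α 0≤α rate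
    where
    x = digitsX z
    y = digitsY z
    fx = follows-X {z} f
    fy = follows-Y {z} f

  points-separated : ∀ {z z′} → Follows template z → Follows template z′ → ∀ {k} →
                     dist (point z) (point z′) < β ^ k → dist (point z′) (point z) < β ^ k →
                     ∀ j → j ℕ.< double (k ℕ.∸ L) → z j ≡ z′ j
  points-separated {z} {z′} f f′ {k} d< d′< j j< = by-parity (half j)
    where
    inside : ∀ {i} → double i ℕ.< double (k ℕ.∸ L) → i ℕ.+ L ℕ.< k
    inside {i} i< = ℕₚ.≰⇒> λ k≤i+L → ℕₚ.<⇒≱ (double-cancel-< i<)
      (ℕₚ.m≤n+o⇒m∸n≤o k L (ℕₚ.≤-trans k≤i+L (ℕₚ.≤-reflexive (ℕₚ.+-comm i L))))
    by-parity : (∃ λ i → j ≡ double i ⊎ j ≡ suc (double i)) → z j ≡ z′ j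
    by-parity (i , inj₁ ≡.refl) = separated L {digitsX z} {digitsX z′} (common-X (follows-X {z} f) (follows-X {z′} f′)) {k}
      (≤-<-trans (Δx≤dist _ _ _ _) d<) (≤-<-trans (Δx≤dist _ _ _ _) d′<) i (inside j<)
    by-parity (i , inj₂ ≡.refl) = separated L {digitsY z} {digitsY z′} (common-Y (follows-Y {z} f) (follows-Y {z′} f′)) {k}
      (≤-<-trans (Δy≤dist _ _ _ _) d<) (≤-<-trans (Δy≤dist _ _ _ _) d′<) i (inside (ℕₚ.<-trans ℕₚ.≤-refl j<))

  p c₀ C : ℕ
  p = suc (q ℕ.+ q)
  c₀ = L ℕ.+ M
  C = c₀ ℕ.+ p ℕ.* L ℕ.+ p

  F : ℕ → ℕ
  F k = free template (double k)

  -- `M` = 4(q+1) turns the loss `4 * k` of `free-density` into k out of 2(q+1)k, which leaves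
  -- p/(q+1) free digits per level up to a constant.
  p*k≤F : ∀ k → p ℕ.* k ℕ.≤ suc q ℕ.* F k ℕ.+ c₀
  p*k≤F k = ℕₚ.+-cancelʳ-≤ k _ _ (ℕₚ.*-cancelˡ-≤ 4 (begin
    4 ℕ.* (p ℕ.* k ℕ.+ k)                                        ≡⟨ solve 2 (λ q k → con 4 :* ((con 1 :+ (q :+ q)) :* k :+ k) := con 4 :* (con 1 :+ q) :* (k :+ k)) ≡.refl q k ⟩
    4 ℕ.* suc q ℕ.* (k ℕ.+ k)                                    ≡⟨ ≡.cong₂ ℕ._*_ (≡.sym M≡) (≡.sym (double≡ k)) ⟩
    M ℕ.* double k                                               ≤⟨ free-density k ⟩
    M ℕ.* F k ℕ.+ (4 ℕ.* k ℕ.+ c₀)                               ≡⟨ ≡.cong (λ x → x ℕ.* F k ℕ.+ (4 ℕ.* k ℕ.+ c₀)) M≡ ⟩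
    4 ℕ.* suc q ℕ.* F k ℕ.+ (4 ℕ.* k ℕ.+ c₀)                     ≤⟨ ℕₚ.+-monoʳ-≤ (4 ℕ.* suc q ℕ.* F k) (ℕₚ.+-monoʳ-≤ (4 ℕ.* k) (ℕₚ.m≤n*m c₀ 4)) ⟩
    4 ℕ.* suc q ℕ.* F k ℕ.+ (4 ℕ.* k ℕ.+ 4 ℕ.* c₀)               ≡⟨ solve 4 (λ q F k c → con 4 :* q :* F :+ (con 4 :* k :+ con 4 :* c) := con 4 :* (q :* F :+ c :+ k)) ≡.refl (suc q) (F k) k c₀ ⟩
    4 ℕ.* (suc q ℕ.* F k ℕ.+ c₀ ℕ.+ k)                           ∎))
    where
    open ℕₚ.≤-Reasoning
    open +-*-Solver using (solve; con; _:+_; _:*_; _:=_)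

  k≤F : ∀ k → k ℕ.≤ F k ℕ.+ c₀
  k≤F k = ℕₚ.*-cancelˡ-≤ (suc q) (begin
    suc q ℕ.* k                          ≤⟨ ℕₚ.*-monoˡ-≤ k (s≤s (ℕₚ.m≤m+n q q)) ⟩
    p ℕ.* k                              ≤⟨ p*k≤F k ⟩
    suc q ℕ.* F k ℕ.+ c₀                 ≤⟨ ℕₚ.+-monoʳ-≤ (suc q ℕ.* F k) (ℕₚ.m≤n*m c₀ (suc q)) ⟩
    suc q ℕ.* F k ℕ.+ suc q ℕ.* c₀       ≡⟨ ℕₚ.*-distribˡ-+ (suc q) (F k) c₀ ⟨
    suc q ℕ.* (F k ℕ.+ c₀)               ∎)
    where open ℕₚ.≤-Reasoning

  -- Points of the set closer than β^((q+1)u) share this many digits in each coordinate; `L` digits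
  -- are lost to the windows in `separated`.
  level : ℕ → ℕ
  level u = suc q ℕ.* u ℕ.∸ L

  -- Compares the measure of a cylinder at `level u` with β^(p(u+1)), a lower bound for the s-power
  -- of a diameter of at least β^((q+1)(u+1)). `C` collects the density error `c₀`, the `L` lost
  -- levels and the step from u to u + 1.
  p*[1+u]≤C+F : ∀ u → p ℕ.* suc u ℕ.≤ C ℕ.+ F (level u)
  p*[1+u]≤C+F u = ℕₚ.*-cancelˡ-≤ (suc q) (begin
    suc q ℕ.* (p ℕ.* suc u)                                ≡⟨ solve 3 (λ q p u → q :* (p :* (con 1 :+ u)) := p :* (q :* u) :+ q :* p) ≡.refl (suc q) p u ⟩
    p ℕ.* (suc q ℕ.* u) ℕ.+ suc q ℕ.* p                    ≤⟨ ℕₚ.+-monoˡ-≤ (suc q ℕ.* p) (ℕₚ.*-monoʳ-≤ p (ℕₚ.m≤n+m∸n (suc q ℕ.* u) L)) ⟩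
    p ℕ.* (L ℕ.+ level u) ℕ.+ suc q ℕ.* p                  ≡⟨ ≡.cong (ℕ._+ suc q ℕ.* p) (ℕₚ.*-distribˡ-+ p L (level u)) ⟩
    p ℕ.* L ℕ.+ p ℕ.* level u ℕ.+ suc q ℕ.* p              ≤⟨ ℕₚ.+-monoˡ-≤ (suc q ℕ.* p) (ℕₚ.+-monoʳ-≤ (p ℕ.* L) (p*k≤F (level u))) ⟩
    p ℕ.* L ℕ.+ (suc q ℕ.* f ℕ.+ c₀) ℕ.+ suc q ℕ.* p       ≤⟨ ℕₚ.+-monoˡ-≤ (suc q ℕ.* p) (ℕₚ.+-mono-≤ (ℕₚ.m≤n*m (p ℕ.* L) (suc q)) (ℕₚ.+-monoʳ-≤ (suc q ℕ.* f) (ℕₚ.m≤n*m c₀ (suc q)))) ⟩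
    suc q ℕ.* (p ℕ.* L) ℕ.+ (suc q ℕ.* f ℕ.+ suc q ℕ.* c₀) ℕ.+ suc q ℕ.* p
      ≡⟨ solve 5 (λ q x f c p → q :* x :+ (q :* f :+ q :* c) :+ q :* p := q :* (c :+ x :+ p :+ f)) ≡.refl (suc q) (p ℕ.* L) f c₀ p ⟩
    suc q ℕ.* (C ℕ.+ f)                                    ∎)
    where
    open ℕₚ.≤-Reasoning
    open +-*-Solver using (solve; con; _:+_; _:*_; _:=_)
    f = F (level u)

  module _ {s : ℝ} (s-small : fromℕ (suc q) * s ≤ fromℕ p) where

    diamPower-lower : ∀ {U} u → DiamAtMost 1# U → β ^ (suc q ℕ.* u) ≤ diam U → β ^ (p ℕ.* u) ≤ diamPower s U
    diamPower-lower {U} u small β^≤diam with lem {P = ∃ U}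
    ... | yes _ = ^ʳ-upper p q (0≤diam U) (diam≤ 0≤1 small) (0≤^ 0≤β (p ℕ.* u)) s-small (begin
            (β ^ (p ℕ.* u)) ^ suc q       ≈⟨ ^-assocʳ β (p ℕ.* u) (suc q) ⟩
            β ^ (p ℕ.* u ℕ.* suc q)       ≡⟨ ≡.cong (β ^_) (+-*-Solver.solve 3 (λ p u q → p :* u :* q := q :* u :* p) ≡.refl p u (suc q)) ⟩
            β ^ (suc q ℕ.* u ℕ.* p)       ≈⟨ ^-assocʳ β (suc q ℕ.* u) p ⟨
            (β ^ (suc q ℕ.* u)) ^ p       ≤⟨ ^-monoˡ-≤ (0≤^ 0≤β (suc q ℕ.* u)) β^≤diam p ⟩
            diam U ^ p                    ∎)
      where
      open ≤-Reasoning
      open +-*-Solver using (_:*_; _:=_)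
    ... | no empty = ⊥-elim (<⇒≱ (0<^ 0<β (suc q ℕ.* u)) (≤-trans β^≤diam
            (sup-least _ ≤-refl λ { r (x , _ , x∈U , _) → ⊥-elim (empty (x , x∈U)) })))

    module _ (U : Pred ℝ² 0ℓ) (small : DiamAtMost 1# U) (i : ℕ) where

      record Cylinder : Set where
        field
          depth    : ℕ
          word     : ℕ → Fin b
          contains : ∀ {z} → Follows template z → point z ∈ U → ∀ j → j ℕ.< double depth → z j ≡ word j
          measure  : β ^ F depth ≤ B ^ C * diamPower s U + β ^ (3 ℕ.+ i)

      private
        -- At scale T the error term alone bounds the measure; this covers
        -- the sets U that are empty or of diameter zero.
        T : ℕ
        T = 3 ℕ.+ i ℕ.+ c₀ ℕ.+ L

        deep : 3 ℕ.+ i ℕ.≤ F (level T)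
        deep = ℕₚ.+-cancelʳ-≤ c₀ _ _ (begin
          3 ℕ.+ i ℕ.+ c₀           ≡⟨ ℕₚ.m+n∸n≡m (3 ℕ.+ i ℕ.+ c₀) L ⟨
          T ℕ.∸ L                  ≤⟨ ℕₚ.∸-monoˡ-≤ L (ℕₚ.m≤n*m T (suc q)) ⟩
          level T                  ≤⟨ k≤F (level T) ⟩
          F (level T) ℕ.+ c₀       ∎)
          where open ℕₚ.≤-Reasoning

        -- Below the cut-off `T`, the least such u > 0 places the diameter between two consecutive
        -- scales: the lower bound yields `measure`, the upper one `contains`.
        Fits : ℕ → Set
        Fits u = β ^ (suc q ℕ.* suc u) ≤ diam U ⊎ u ≡ T

        measure-≤ : ∀ u → Fits u → β ^ F (level u) ≤ B ^ C * diamPower s U + β ^ (3 ℕ.+ i)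
        measure-≤ u (inj₂ ≡.refl) = ≤-trans (^-antitoneʳ 0≤β β≤1 deep)
          (x≤y+x _ (*-nonneg (0≤^ (<⇒≤ 0<B) C) (0≤diamPower s U)))
        measure-≤ u (inj₁ p≤) = begin
          β ^ f                                        ≈⟨ *-identityˡ _ ⟨
          1# * β ^ f                                   ≈⟨ *-congʳ (B^*β^≈1 C) ⟨
          B ^ C * β ^ C * β ^ f                        ≈⟨ trans (*-assoc _ _ _) (*-congˡ (sym (^-homo-* β C f))) ⟩
          B ^ C * β ^ (C ℕ.+ f)                        ≤⟨ *-monoˡ-≤ (0≤^ (<⇒≤ 0<B) C) (≤-trans (^-antitoneʳ 0≤β β≤1 (p*[1+u]≤C+F u)) (diamPower-lower (suc u) small p≤)) ⟩
          B ^ C * diamPower s U                        ≤⟨ x≤x+y _ (0≤^ 0≤β (3 ℕ.+ i)) ⟩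
          B ^ C * diamPower s U + β ^ (3 ℕ.+ i)        ∎
          where
          open ≤-Reasoning
          f = F (level u)

        diam-small : ∀ u → (∀ v → v ℕ.< u → ¬ Fits v) → ∀ {j} → j ℕ.< double (level u) → diam U < β ^ (suc q ℕ.* u)
        -- For u = 0 minimality says nothing, but `level 0` is 0 and there is no such `j`.
        diam-small zero    min {j} j< = ⊥-elim (impossible (≡.subst (λ k → j ℕ.< double (k ℕ.∸ L)) (ℕₚ.*-zeroʳ (suc q)) j<))
          where
          impossible : ¬ (j ℕ.< double (0 ℕ.∸ L))
          impossible lt with () ← ≡.subst (λ k → j ℕ.< double k) (ℕₚ.0∸n≡0 L) lt
        diam-small (suc u) min _ = ≰⇒> λ p≤ → min u ℕₚ.≤-refl (inj₁ p≤)

        search : ∃ λ u → u ℕ.≤ T × Fits u × (∀ v → v ℕ.< u → ¬ Fits v)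
        search = least Fits T (inj₂ ≡.refl)

        -- All points of the set in `U` agree to the required depth, so the digits of any one of
        -- them serve as the word; if there is none, any word does.
        from-witness : Dec (∃ λ z → Follows template z × point z ∈ U) → Cylinder
        from-witness w = record
          { depth    = level u
          ; word     = word w
          ; contains = contains w
          ; measure  = measure-≤ u (proj₁ (proj₂ (proj₂ search)))
          }
          where
          u = proj₁ search
          word : Dec (∃ λ z → Follows template z × point z ∈ U) → ℕ → Fin b
          word (yes (z , _)) = z
          word (no _)        = λ _ → 0F
          contains : ∀ w {z} → Follows template z → point z ∈ U → ∀ j → j ℕ.< double (level u) → z j ≡ word w j
          contains (no none) {z} f z∈U j j< = ⊥-elim (none (z , f , z∈U))
          contains (yes (z′ , f′ , z′∈U)) {z} f z∈U j j< = points-separated {z} {z′} f f′ {suc q ℕ.* u}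
            (≤-<-trans (dist≤diam small (point z) (point z′) z∈U z′∈U) d<)
            (≤-<-trans (dist≤diam small (point z′) (point z) z′∈U z∈U) d<) j j<
            where d< = diam-small u (proj₂ (proj₂ (proj₂ search))) j<

      cylinder : Cylinder
      cylinder = from-witness lem

    -- A total of β^(C+2) leaves β² after the factor `B ^ C` in `measure`, the error terms add up to
    -- at most another β², and 2β² ≤ β < 1 is the threshold for `avoid`.
    uncovered : (U : ℕ → Pred ℝ² 0ℓ) → (∀ i → DiamAtMost 1# (U i)) →
                (∀ n → partialSum (λ i → diamPower s (U i)) n ≤ β ^ (C ℕ.+ 2)) →
                ∃ λ z → Follows template z × (∀ i → ¬ (point z ∈ U i))
    uncovered U small total = z , f , λ i z∈Uᵢ → proj₂ (proj₂ avoiding) i (cyl.contains i f z∈Uᵢ)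
      where
      open ≤-Reasoning
      module cyl (i : ℕ) = Cylinder (cylinder (U i) (small i) i)
      cover-part : ∀ n → B ^ C * partialSum (λ i → diamPower s (U i)) n ≤ β * β
      cover-part n = begin
        B ^ C * partialSum (λ i → diamPower s (U i)) n  ≤⟨ *-monoˡ-≤ (0≤^ (<⇒≤ 0<B) C) (total n) ⟩
        B ^ C * β ^ (C ℕ.+ 2)                           ≈⟨ *-congˡ (^-homo-* β C 2) ⟩
        B ^ C * (β ^ C * β ^ 2)                         ≈⟨ *-assoc _ _ _ ⟨
        B ^ C * β ^ C * β ^ 2                           ≈⟨ trans (*-congʳ (B^*β^≈1 C)) (*-identityˡ _) ⟩
        β * (β * 1#)                                    ≈⟨ *-congˡ (*-identityʳ β) ⟩
        β * β                                           ∎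
      tail-part : ∀ n → partialSum (λ i → β ^ (3 ℕ.+ i)) n ≤ β * β
      tail-part n = begin
        partialSum (λ i → β ^ (3 ℕ.+ i)) n              ≤⟨ partialSum-mono {λ i → β ^ (3 ℕ.+ i)} {λ i → β * β * β ^ suc i} n (λ i _ → ≤-reflexive (sym (*-assoc β β (β ^ suc i)))) ⟩
        partialSum (λ i → β * β * β ^ suc i) n          ≈⟨ partialSum-* (β * β) (λ i → β ^ suc i) n ⟨
        β * β * partialSum (λ i → β ^ suc i) n          ≤⟨ *-monoˡ-≤ (*-nonneg 0≤β 0≤β) (∑β^≤1 n) ⟩
        β * β * 1#                                      ≈⟨ *-identityʳ _ ⟩
        β * β                                           ∎
      light : ∀ n → partialSum (λ i → β ^ F (cyl.depth i)) n ≤ β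
      light n = begin
        partialSum (λ i → β ^ F (cyl.depth i)) n
          ≤⟨ partialSum-mono {λ i → β ^ F (cyl.depth i)} {λ i → B ^ C * diamPower s (U i) + β ^ (3 ℕ.+ i)} n (λ i _ → cyl.measure i) ⟩
        partialSum (λ i → B ^ C * diamPower s (U i) + β ^ (3 ℕ.+ i)) n
          ≈⟨ partialSum-+ (λ i → B ^ C * diamPower s (U i)) (λ i → β ^ (3 ℕ.+ i)) n ⟩
        partialSum (λ i → B ^ C * diamPower s (U i)) n + partialSum (λ i → β ^ (3 ℕ.+ i)) n
          ≈⟨ +-congʳ (sym (partialSum-* (B ^ C) (λ i → diamPower s (U i)) n)) ⟩
        B ^ C * partialSum (λ i → diamPower s (U i)) n + partialSum (λ i → β ^ (3 ℕ.+ i)) n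
          ≤⟨ +-mono-≤ (cover-part n) (tail-part n) ⟩
        β * β + β * β            ≈⟨ distribˡ β β β ⟨
        β * (β + β)              ≤⟨ *-monoˡ-≤ 0≤β β+β≤1 ⟩
        β * 1#                   ≈⟨ *-identityʳ β ⟩
        β                        ∎
      avoiding : ∃ λ z → (∀ n c → template n ≡ just c → z n ≡ c) × (∀ i → ¬ (∀ j → j ℕ.< double (cyl.depth i) → z j ≡ cyl.word i j))
      avoiding = avoid template (λ i → double (cyl.depth i)) cyl.word β (<-≤-trans (x<x+y β 0<β) β+β≤1) light
      z = proj₁ avoiding
      f : Follows template z
      f = proj₁ (proj₂ avoiding)

    -- Mesh 1 keeps the diameters within the range of `^ʳ-upper`. If `ℋ` vanishes, so does its value
    -- at this mesh, which yields a cover with a total as small as `uncovered` asks.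
    ℋ≉0 : ∀ {α} → [ 0# ] ≤⁺ α → HasRate ℓ α → ¬ (ℋ s (S b α) ≈⁺ [ 0# ])
    ℋ≉0 {α} 0≤α rate ℋ≈0 =
      let (U , covers , small) , total = cover
          z , f , avoids = uncovered U small λ n → [≤]-injective (⨆-upper (λ n → [ partialSum (λ i → diamPower s (U i)) n ]) total n)
          i , z∈Uᵢ = covers {point z} (point∈S {α} 0≤α rate {z} f)
      in avoids i z∈Uᵢ
      where
      open AddSupOrder _≤_ using ([≤]-injective)
      sums : Cover 1# (S b α) → ℝ ⁺
      sums (U , _) = ⨆ λ n → [ partialSum (λ i → diamPower s (U i)) n ]
      cover : ∃ λ c → sums c ≤⁺ [ β ^ (C ℕ.+ 2) ]
      cover = ⨅-approx sums (⨆-upper (λ (δ , _) → ℋδ s δ (S b α)) (≤⁺-refl-≈ ℋ≈0) (1# , 0<1)) (0<^ 0<β (C ℕ.+ 2))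

-- The dimension is 2

module Dimension (lem : ∀ {ℓ} → ExcludedMiddle ℓ) (R : CompleteOrderedField)
    (b : ℕ) (2≤b : 2 ℕ.≤ b) where

  open Analysis lem R hiding (zero)
  open RealLemmas lem R
  open AnalysisLemmas lem R
  open Rates lem R
  open BaseLemmas lem R b 2≤b using (≤+ε⇒≤)
  open Growth b 2≤b
  open AddSupEquality _≈_ using ([_])
  open AddSupOrder _≤_ using ([_]; ≤⁺-antisym)

  2≤s : ∀ {α s} → [ 0# ] ≤⁺ α → ℋ s (S b α) ≈⁺ [ 0# ] → 1# + 1# ≤ s
  2≤s {α} {s} 0≤α ℋ≈0 = ≮⇒≥ λ s<2 → contradiction-from s<2
    where
    contradiction-from : ¬ (s < 1# + 1#)
    contradiction-from s<2 = LowerBoundOnDimension.ℋ≉0 lem R b 2≤b q M L ≡.refl ≡.refl ℓ ℓ-mono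
      (proj₁ sp) (proj₂ sp) s-small 0≤α ℓ-rate ℋ≈0
      where
      open ≤-Reasoning
      open RunLengths (runLengths α 0≤α)
      ε : ℝ
      ε = (1# + 1#) - s
      q M L : ℕ
      -- q + 1 ≥ 1/(2 - s) makes p/(q+1) = 2 - 1/(q+1) at least s.
      q = proj₁ (archimedean (ε ⁻¹))
      M = 4 ℕ.* suc q
      L = M ℕ.* suc M
      sp = eventually-sparse {ℓ} {A} ℓ-growth (2 ℕ.* M) (L ℕ.+ L)
      0<ε : 0# < ε
      0<ε = 0<y-x s<2
      1≤εq : 1# ≤ ε * fromℕ (suc q)
      1≤εq = begin
        1#                        ≈⟨ ⁻¹-inverseʳ ε (>⇒≉ 0<ε) ⟨
        ε * ε ⁻¹                  ≤⟨ *-monoˡ-≤ (<⇒≤ 0<ε) (≤-trans (proj₂ (archimedean (ε ⁻¹))) (fromℕ-mono-≤ (ℕₚ.n≤1+n q))) ⟩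
        ε * fromℕ (suc q)         ∎
      s-small : fromℕ (suc q) * s ≤ fromℕ (suc (q ℕ.+ q))
      s-small = +-cancelʳ-≤ 1# (begin
        fromℕ (suc q) * s + 1#                        ≤⟨ +-monoʳ-≤ _ 1≤εq ⟩
        fromℕ (suc q) * s + ε * fromℕ (suc q)         ≈⟨ +-congˡ (*-comm _ _) ⟩
        fromℕ (suc q) * s + fromℕ (suc q) * ε         ≈⟨ distribˡ _ _ _ ⟨
        fromℕ (suc q) * (s + ε)                       ≈⟨ *-congˡ (trans (+-comm s ε) (x-y+y≈x (1# + 1#) s)) ⟩
        fromℕ (suc q) * (1# + 1#)                     ≈⟨ trans (distribˡ _ _ _) (+-cong (*-identityʳ _) (*-identityʳ _)) ⟩
        fromℕ (suc q) + fromℕ (suc q)                 ≈⟨ fromℕ-+ (suc q) (suc q) ⟨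
        fromℕ (suc q ℕ.+ suc q)                       ≡⟨ ≡.cong fromℕ (≡.cong suc (ℕₚ.+-suc q q)) ⟩
        1# + fromℕ (suc (q ℕ.+ q))                    ≈⟨ +-comm _ _ ⟩
        fromℕ (suc (q ℕ.+ q)) + 1#                    ∎)

  S⊆UnitSquare : ∀ {α} → S b α ⊆ UpperBoundOnDimension.UnitSquare lem R b 2≤b
  S⊆UnitSquare (x∈I , y∈I , _) = x∈I , y∈I

  ℋ[2+η]≈0 : ∀ α {η} → 0# < η → ℋ ((1# + 1#) + η) (S b α) ≈⁺ [ 0# ]
  ℋ[2+η]≈0 α {η} 0<η = UpperBoundOnDimension.ℋ≈0 lem R b 2≤b {E = S b α} (λ {p} → S⊆UnitSquare {α} {p}) q s-large
    where
    open ≤-Reasoning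
    q : ℕ
    q = proj₁ (archimedean (η ⁻¹))
    s-large : fromℕ (suc (suc q ℕ.+ suc q)) ≤ fromℕ (suc q) * ((1# + 1#) + η)
    s-large = begin
      1# + fromℕ (suc q ℕ.+ suc q)                                ≈⟨ +-comm _ _ ⟩
      fromℕ (suc q ℕ.+ suc q) + 1#                                ≤⟨ +-mono-≤ (≤-reflexive 2q≈) 1≤qη ⟩
      fromℕ (suc q) * (1# + 1#) + fromℕ (suc q) * η               ≈⟨ distribˡ _ _ _ ⟨
      fromℕ (suc q) * ((1# + 1#) + η)                             ∎
      where
      2q≈ : fromℕ (suc q ℕ.+ suc q) ≈ fromℕ (suc q) * (1# + 1#)
      2q≈ = trans (fromℕ-+ (suc q) (suc q)) (sym (trans (distribˡ _ _ _) (+-cong (*-identityʳ _) (*-identityʳ _))))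
      1≤qη : 1# ≤ fromℕ (suc q) * η
      1≤qη = begin
        1#                        ≈⟨ ⁻¹-inverseˡ 0<η ⟨
        η ⁻¹ * η                  ≤⟨ *-monoʳ-≤ (<⇒≤ 0<η) (≤-trans (proj₂ (archimedean (η ⁻¹))) (fromℕ-mono-≤ (ℕₚ.n≤1+n q))) ⟩
        fromℕ (suc q) * η         ∎

  dim≈2 : ∀ α → [ 0# ] ≤⁺ α → dimℋ (S b α) ≈⁺ [ 1# + 1# ]
  dim≈2 α 0≤α = ≤⁺-antisym antisym
    -- Every exponent 2 + η is admissible in the infimum, which is therefore at most 2 in the limit;
    -- exponent 2 itself is not examined.
    (≤+ε⇒≤ λ η 0<η → ⨅-lower exponent lower
      (_ , 0≤+ (0≤+ 0≤1 0≤1) (<⇒≤ 0<η) , ℋ[2+η]≈0 α 0<η) [ ≤-refl ])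
    (⨅-greatest exponent lower)
    where
    exponent : (∃ λ s → 0# ≤ s × ℋ s (S b α) ≈⁺ [ 0# ]) → ℝ ⁺
    exponent (s , _) = [ s ]
    lower : ∀ i → [ 1# + 1# ] ≤⁺ exponent i
    lower (s , _ , ℋ≈0) = [ 2≤s {α} 0≤α ℋ≈0 ]

theorem1p1 : (lem : ∀ {ℓ} → ExcludedMiddle ℓ) (R : CompleteOrderedField) →
    let open Analysis lem R in
    (b : ℕ) → 2 ℕ.≤ b →
    (α : ℝ ⁺) → [ 0# ] ≤⁺ α →
    dimℋ (S b α) ≈⁺ [ 1# + 1# ]
theorem1p1 lem R = Dimension.dim≈2 lem R
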